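{- Let $n \ge 2$ be an integer, $\alpha,\beta\in\mathbb{R}$ with $\beta>0$ and $\alpha^2 < n\beta$, and let $\mathbb{M}_{\alpha,\beta} := \{M \in \mathbb{R}^{n\times n} : s(M) = n\alpha,\ q(M) = n\beta\}$. Let $M \in \mathbb{M}_{\alpha,\beta}$ be a matrix whose determinant is maximal among all elements of $\mathbb{M}_{\alpha,\beta}$ (such a matrix exists by compactness). Then: If $\alpha^2 \le \beta$: (A) $MM^T = \beta I$, and (B) $\det M = \beta^{n/2}$. If $\alpha^2 \ge \beta$: (C) every row sum and every column sum of $M$ equals $\alpha$; (D) $MM^T = (\beta-\delta)I + \delta J$, where $\delta := \frac{\alpha^2-\beta}{n-1}$ (so $\beta - \delta = \frac{n\beta-\alpha^2}{n-1}$); and (E) $\det M = |\alpha|(\beta-\delta)^{\frac{n-1}{2}}$.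
   Context: For a real matrix $M$, $s(M)$ denotes the sum of all entries of $M$ and $q(M)$ the sum of the squares of all entries of $M$. $I$ is the $n\times n$ identity matrix and $J$ is the $n\times n$ matrix with all entries equal to $1$. -}

module Defs where

open import Algebra.Bundles.Raw using (RawRing)
import Algebra.Definitions.RawSemiring as RawSemiringDefs
open import Data.Fin.Base using (Fin; zero; suc; toℕ; punchIn)
import Data.Fin.Properties as Fin
open import Data.Integer.Base using (+_)
open import Data.Nat.Base as ℕ using (ℕ; zero; suc; pred; NonZero; NonTrivial)
import Data.Nat.Properties as ℕ
open import Data.Product.Base using (Σ-syntax; _×_; _,_; proj₁; proj₂)
open import Data.Rational.Base as ℚ using (ℚ; 0ℚ; 1ℚ; ½)
import Data.Rational.Properties as ℚ
open import Data.Rational.Solver using (module +-*-Solver)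
open import Data.Vec.Functional using (Vector)
open import Data.Sum.Base using (inj₁; inj₂)
open import Level using (0ℓ)
open import Relation.Binary.PropositionalEquality
  using (_≡_; refl; sym; trans; cong; subst; subst₂)
open import Relation.Nullary using (yes; no)

------------------------------------------------------------------------
-- The real numbers: Cauchy sequences of rationals, compared up to _≃_

Eventually : (ℕ → Set) → Set
Eventually P = Σ[ N ∈ ℕ ] ∀ n → N ℕ.≤ n → P n

IsCauchy : (ℕ → ℚ) → Set
IsCauchy f = ∀ ε → 0ℚ ℚ.< ε →
  Σ[ N ∈ ℕ ] ∀ m n → N ℕ.≤ m → N ℕ.≤ n → ℚ.∣ f m ℚ.- f n ∣ ℚ.< ε

record ℝ : Set where
  constructor mkℝ
  field
    seq      : ℕ → ℚ
    isCauchy : IsCauchy seq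

open ℝ public

infix 4 _≃_ _≤_ _<_

-- These are records, rather than functions into Set, so that x and y can be
-- inferred from the type of a proof.

record _≃_ (x y : ℝ) : Set where
  constructor mk≃
  field
    un≃ : ∀ ε → 0ℚ ℚ.< ε → Eventually λ n → ℚ.∣ seq x n ℚ.- seq y n ∣ ℚ.< ε

record _≤_ (x y : ℝ) : Set where
  constructor mk≤
  field
    un≤ : ∀ ε → 0ℚ ℚ.< ε → Eventually λ n → seq x n ℚ.< seq y n ℚ.+ ε

record _<_ (x y : ℝ) : Set where
  constructor mk<
  field
    un< : Σ[ ε ∈ ℚ ] 0ℚ ℚ.< ε × Eventually λ n → seq x n ℚ.+ ε ℚ.< seq y n

open _≃_ public
open _≤_ public
open _<_ public

private
  half-pos : ∀ {ε} → 0ℚ ℚ.< ε → 0ℚ ℚ.< ½ ℚ.* ε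
  half-pos {ε} 0<ε =
    ℚ.positive⁻¹ (½ ℚ.* ε) {{ℚ.pos*pos⇒pos ½ ε {{ℚ.positive 0<ε}}}}

  halves : ∀ ε → ½ ℚ.* ε ℚ.+ ½ ℚ.* ε ≡ ε
  halves ε = trans (sym (ℚ.*-distribʳ-+ ε ½ ½)) (ℚ.*-identityˡ ε)

  p≡[p-q]+q : ∀ p q → p ≡ (p ℚ.- q) ℚ.+ q
  p≡[p-q]+q = solve 2 (λ p q → p := (p :- q) :+ q) refl
    where open +-*-Solver

  ∣p-q∣≡∣q-p∣ : ∀ p q → ℚ.∣ p ℚ.- q ∣ ≡ ℚ.∣ q ℚ.- p ∣
  ∣p-q∣≡∣q-p∣ p q = trans (sym (ℚ.∣-p∣≡∣p∣ (p ℚ.- q))) (cong ℚ.∣_∣ (lemma p q))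
    where
    open +-*-Solver
    lemma : ∀ p q → ℚ.- (p ℚ.- q) ≡ q ℚ.- p
    lemma = solve 2 (λ p q → :- (p :- q) := q :- p) refl

  ∣p∣≤∣p-q∣+∣q∣ : ∀ p q → ℚ.∣ p ∣ ℚ.≤ ℚ.∣ p ℚ.- q ∣ ℚ.+ ℚ.∣ q ∣
  ∣p∣≤∣p-q∣+∣q∣ p q =
    subst (λ t → ℚ.∣ t ∣ ℚ.≤ ℚ.∣ p ℚ.- q ∣ ℚ.+ ℚ.∣ q ∣) (sym (p≡[p-q]+q p q))
      (ℚ.∣p+q∣≤∣p∣+∣q∣ (p ℚ.- q) q)

  ∣p∣-∣q∣≤∣p-q∣ : ∀ p q → ℚ.∣ p ∣ ℚ.- ℚ.∣ q ∣ ℚ.≤ ℚ.∣ p ℚ.- q ∣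
  ∣p∣-∣q∣≤∣p-q∣ p q =
    subst (ℚ.∣ p ∣ ℚ.- ℚ.∣ q ∣ ℚ.≤_) (lemma ℚ.∣ p ℚ.- q ∣ ℚ.∣ q ∣)
      (ℚ.+-monoˡ-≤ (ℚ.- ℚ.∣ q ∣) (∣p∣≤∣p-q∣+∣q∣ p q))
    where
    open +-*-Solver
    lemma : ∀ a b → (a ℚ.+ b) ℚ.- b ≡ a
    lemma = solve 2 (λ a b → (a :+ b) :- b := a) refl

  ∣∣p∣-∣q∣∣≤∣p-q∣ : ∀ p q → ℚ.∣ ℚ.∣ p ∣ ℚ.- ℚ.∣ q ∣ ∣ ℚ.≤ ℚ.∣ p ℚ.- q ∣
  ∣∣p∣-∣q∣∣≤∣p-q∣ p q with ℚ.∣p∣≡p∨∣p∣≡-p (ℚ.∣ p ∣ ℚ.- ℚ.∣ q ∣)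
  ... | inj₁ eq = subst (ℚ._≤ ℚ.∣ p ℚ.- q ∣) (sym eq) (∣p∣-∣q∣≤∣p-q∣ p q)
  ... | inj₂ eq = subst₂ ℚ._≤_ (trans (lemma ℚ.∣ p ∣ ℚ.∣ q ∣) (sym eq)) (∣p-q∣≡∣q-p∣ q p)
                    (∣p∣-∣q∣≤∣p-q∣ q p)
    where
    open +-*-Solver
    lemma : ∀ a b → b ℚ.- a ≡ ℚ.- (a ℚ.- b)
    lemma = solve 2 (λ a b → b :- a := :- (a :- b)) refl

  bounded : ∀ f → IsCauchy f →
    Σ[ B ∈ ℚ ] 0ℚ ℚ.< B × Eventually λ n → ℚ.∣ f n ∣ ℚ.≤ B
  bounded f f-cauchy with f-cauchy 1ℚ (ℚ.positive⁻¹ 1ℚ)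
  ... | N , close =
    1ℚ ℚ.+ ℚ.∣ f N ∣ ,
    ℚ.+-mono-<-≤ (ℚ.positive⁻¹ 1ℚ) (ℚ.0≤∣p∣ (f N)) ,
    N , λ n N≤n → ℚ.≤-trans (∣p∣≤∣p-q∣+∣q∣ (f n) (f N))
                    (ℚ.+-monoˡ-≤ ℚ.∣ f N ∣ (ℚ.<⇒≤ (close n N N≤n ℕ.≤-refl)))

  ∣ab∣<cd : ∀ a b c d → 0ℚ ℚ.< c → ℚ.∣ a ∣ ℚ.≤ c → ℚ.∣ b ∣ ℚ.< d →
    ℚ.∣ a ℚ.* b ∣ ℚ.< c ℚ.* d
  ∣ab∣<cd a b c d 0<c ∣a∣≤c ∣b∣<d = begin-strict
    ℚ.∣ a ℚ.* b ∣         ≡⟨ ℚ.∣p*q∣≡∣p∣*∣q∣ a b ⟩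
    ℚ.∣ a ∣ ℚ.* ℚ.∣ b ∣  ≤⟨ ℚ.*-monoʳ-≤-nonNeg ℚ.∣ b ∣ {{ℚ.nonNegative (ℚ.0≤∣p∣ b)}} ∣a∣≤c ⟩
    c ℚ.* ℚ.∣ b ∣         <⟨ ℚ.*-monoʳ-<-pos c {{ℚ.positive 0<c}} ∣b∣<d ⟩
    c ℚ.* d               ∎
    where open ℚ.≤-Reasoning

  ∣aa′-bb′∣<Bη+Cη : ∀ a a′ b b′ B C η → 0ℚ ℚ.< B → 0ℚ ℚ.< C →
    ℚ.∣ a ∣ ℚ.≤ B → ℚ.∣ b′ ∣ ℚ.≤ C →
    ℚ.∣ a ℚ.- b ∣ ℚ.< η → ℚ.∣ a′ ℚ.- b′ ∣ ℚ.< η →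
    ℚ.∣ a ℚ.* a′ ℚ.- b ℚ.* b′ ∣ ℚ.< B ℚ.* η ℚ.+ C ℚ.* η
  ∣aa′-bb′∣<Bη+Cη a a′ b b′ B C η 0<B 0<C ∣a∣≤B ∣b′∣≤C a~b a′~b′ =
    subst (λ t → ℚ.∣ t ∣ ℚ.< B ℚ.* η ℚ.+ C ℚ.* η) (sym (lemma a a′ b b′))
      (ℚ.≤-<-trans
        (ℚ.∣p+q∣≤∣p∣+∣q∣ (a ℚ.* (a′ ℚ.- b′)) (b′ ℚ.* (a ℚ.- b)))
        (ℚ.+-mono-<
          {ℚ.∣ a ℚ.* (a′ ℚ.- b′) ∣} {B ℚ.* η} {ℚ.∣ b′ ℚ.* (a ℚ.- b) ∣} {C ℚ.* η}
          (∣ab∣<cd a (a′ ℚ.- b′) B η 0<B ∣a∣≤B a′~b′)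
          (∣ab∣<cd b′ (a ℚ.- b) C η 0<C ∣b′∣≤C a~b)))
    where
    open +-*-Solver
    lemma : ∀ a b c d → a ℚ.* b ℚ.- c ℚ.* d ≡ a ℚ.* (b ℚ.- d) ℚ.+ d ℚ.* (a ℚ.- c)
    lemma = solve 4 (λ a b c d → a :* b :- c :* d := a :* (b :- d) :+ d :* (a :- c)) refl

  split : ∀ B C ε → 0ℚ ℚ.< B → 0ℚ ℚ.< C → 0ℚ ℚ.< ε →
    Σ[ η ∈ ℚ ] 0ℚ ℚ.< η × B ℚ.* η ℚ.+ C ℚ.* η ≡ ε
  split B C ε 0<B 0<C 0<ε = go (B ℚ.+ C) refl (ℚ.positive (ℚ.+-mono-< 0<B 0<C))
    where
    go : ∀ D → D ≡ B ℚ.+ C → ℚ.Positive D →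
      Σ[ η ∈ ℚ ] 0ℚ ℚ.< η × B ℚ.* η ℚ.+ C ℚ.* η ≡ ε
    go D D≡B+C D-pos =
      1/D ℚ.* ε ,
      ℚ.positive⁻¹ (1/D ℚ.* ε)
        {{ℚ.pos*pos⇒pos 1/D {{ℚ.1/pos⇒pos D {{D-pos}}}} ε {{ℚ.positive 0<ε}}}} ,
      trans (sym (ℚ.*-distribʳ-+ (1/D ℚ.* ε) B C))
        (trans (cong (ℚ._* (1/D ℚ.* ε)) (sym D≡B+C))
          (trans (sym (ℚ.*-assoc D 1/D ε))
            (trans (cong (ℚ._* ε) (ℚ.*-inverseʳ D {{ℚ.pos⇒nonZero D {{D-pos}}}}))
              (ℚ.*-identityˡ ε))))
      where
      1/D : ℚ
      1/D = (ℚ.1/ D) {{ℚ.pos⇒nonZero D {{D-pos}}}}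

abstract
  const-cauchy : ∀ q → IsCauchy (λ _ → q)
  const-cauchy q ε 0<ε = 0 , λ _ _ _ _ →
    subst (λ t → ℚ.∣ t ∣ ℚ.< ε) (sym (ℚ.+-inverseʳ q)) 0<ε

  +-cauchy : ∀ f g → IsCauchy f → IsCauchy g → IsCauchy (λ n → f n ℚ.+ g n)
  +-cauchy f g f-cauchy g-cauchy ε 0<ε
    with f-cauchy (½ ℚ.* ε) (half-pos 0<ε) | g-cauchy (½ ℚ.* ε) (half-pos 0<ε)
  ... | N₁ , close₁ | N₂ , close₂ = N₁ ℕ.⊔ N₂ , λ m n N≤m N≤n → begin-strict
      ℚ.∣ (f m ℚ.+ g m) ℚ.- (f n ℚ.+ g n) ∣
        ≡⟨ cong ℚ.∣_∣ (lemma (f m) (g m) (f n) (g n)) ⟩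
      ℚ.∣ (f m ℚ.- f n) ℚ.+ (g m ℚ.- g n) ∣
        ≤⟨ ℚ.∣p+q∣≤∣p∣+∣q∣ (f m ℚ.- f n) (g m ℚ.- g n) ⟩
      ℚ.∣ f m ℚ.- f n ∣ ℚ.+ ℚ.∣ g m ℚ.- g n ∣
        <⟨ ℚ.+-mono-<
             (close₁ m n (ℕ.m⊔n≤o⇒m≤o N₁ N₂ N≤m) (ℕ.m⊔n≤o⇒m≤o N₁ N₂ N≤n))
             (close₂ m n (ℕ.m⊔n≤o⇒n≤o N₁ N₂ N≤m) (ℕ.m⊔n≤o⇒n≤o N₁ N₂ N≤n)) ⟩
      ½ ℚ.* ε ℚ.+ ½ ℚ.* ε
        ≡⟨ halves ε ⟩
      ε ∎
    where
    open ℚ.≤-Reasoning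
    open +-*-Solver
    lemma : ∀ a b c d → (a ℚ.+ b) ℚ.- (c ℚ.+ d) ≡ (a ℚ.- c) ℚ.+ (b ℚ.- d)
    lemma = solve 4 (λ a b c d → (a :+ b) :- (c :+ d) := (a :- c) :+ (b :- d)) refl

  neg-cauchy : ∀ f → IsCauchy f → IsCauchy (λ n → ℚ.- f n)
  neg-cauchy f f-cauchy ε 0<ε with f-cauchy ε 0<ε
  ... | N , close = N , λ m n N≤m N≤n →
      subst (ℚ._< ε)
        (trans (∣p-q∣≡∣q-p∣ (f m) (f n)) (cong ℚ.∣_∣ (lemma (f m) (f n))))
        (close m n N≤m N≤n)
    where
    open +-*-Solver
    lemma : ∀ a b → b ℚ.- a ≡ ℚ.- a ℚ.- ℚ.- b
    lemma = solve 2 (λ a b → b :- a := :- a :- :- b) refl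

  abs-cauchy : ∀ f → IsCauchy f → IsCauchy (λ n → ℚ.∣ f n ∣)
  abs-cauchy f f-cauchy ε 0<ε with f-cauchy ε 0<ε
  ... | N , close = N , λ m n N≤m N≤n →
      ℚ.≤-<-trans (∣∣p∣-∣q∣∣≤∣p-q∣ (f m) (f n)) (close m n N≤m N≤n)

  *-cauchy : ∀ f g → IsCauchy f → IsCauchy g → IsCauchy (λ n → f n ℚ.* g n)
  *-cauchy f g f-cauchy g-cauchy ε 0<ε =
    let B , 0<B , K₁ , bound₁ = bounded f f-cauchy
        C , 0<C , K₂ , bound₂ = bounded g g-cauchy
        η , 0<η , Bη+Cη≡ε     = split B C ε 0<B 0<C 0<ε
        N₁ , close₁           = f-cauchy η 0<η
        N₂ , close₂           = g-cauchy η 0<η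
    in (K₁ ℕ.⊔ N₁) ℕ.⊔ (K₂ ℕ.⊔ N₂) , λ m n N≤m N≤n →
      let ≤m₁ = ℕ.m⊔n≤o⇒m≤o (K₁ ℕ.⊔ N₁) (K₂ ℕ.⊔ N₂) N≤m
          ≤n₁ = ℕ.m⊔n≤o⇒m≤o (K₁ ℕ.⊔ N₁) (K₂ ℕ.⊔ N₂) N≤n
          ≤m₂ = ℕ.m⊔n≤o⇒n≤o (K₁ ℕ.⊔ N₁) (K₂ ℕ.⊔ N₂) N≤m
          ≤n₂ = ℕ.m⊔n≤o⇒n≤o (K₁ ℕ.⊔ N₁) (K₂ ℕ.⊔ N₂) N≤n
      in subst (ℚ.∣ f m ℚ.* g m ℚ.- f n ℚ.* g n ∣ ℚ.<_) Bη+Cη≡ε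
           (∣aa′-bb′∣<Bη+Cη (f m) (g m) (f n) (g n) B C η 0<B 0<C
             (bound₁ m (ℕ.m⊔n≤o⇒m≤o K₁ N₁ ≤m₁))
             (bound₂ n (ℕ.m⊔n≤o⇒m≤o K₂ N₂ ≤n₂))
             (close₁ m n (ℕ.m⊔n≤o⇒n≤o K₁ N₁ ≤m₁) (ℕ.m⊔n≤o⇒n≤o K₁ N₁ ≤n₁))
             (close₂ m n (ℕ.m⊔n≤o⇒n≤o K₂ N₂ ≤m₂) (ℕ.m⊔n≤o⇒n≤o K₂ N₂ ≤n₂)))

infix  8 -_
infixl 7 _*_
infixl 6 _+_ _-_

fromℚ : ℚ → ℝ
fromℚ q = mkℝ (λ _ → q) (const-cauchy q)

0ℝ 1ℝ : ℝ
0ℝ = fromℚ 0ℚ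
1ℝ = fromℚ 1ℚ

-- Opaque only so that arguments of the operations can be inferred by
-- unification.

opaque
  _+_ _*_ : ℝ → ℝ → ℝ
  x + y = mkℝ (λ n → seq x n ℚ.+ seq y n) (+-cauchy (seq x) (seq y) (isCauchy x) (isCauchy y))
  x * y = mkℝ (λ n → seq x n ℚ.* seq y n) (*-cauchy (seq x) (seq y) (isCauchy x) (isCauchy y))

  -_ ∣_∣ : ℝ → ℝ
  - x   = mkℝ (λ n → ℚ.- seq x n) (neg-cauchy (seq x) (isCauchy x))
  ∣ x ∣ = mkℝ (λ n → ℚ.∣ seq x n ∣) (abs-cauchy (seq x) (isCauchy x))

_-_ : ℝ → ℝ → ℝ
x - y = x + (- y)

fromℕ : ℕ → ℝ
fromℕ n = fromℚ (+ n ℚ./ 1)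

ℝ-rawRing : RawRing 0ℓ 0ℓ
ℝ-rawRing = record
  { Carrier = ℝ ; _≈_ = _≃_ ; _+_ = _+_ ; _*_ = _*_ ; -_ = -_ ; 0# = 0ℝ ; 1# = 1ℝ }

open RawSemiringDefs (RawRing.rawSemiring ℝ-rawRing) public using (sum; _^_)

-- IsHalfPower x k y means y = x^{k/2}, read as (√x)^k with √x the nonnegative
-- square root of x.

IsHalfPower : ℝ → ℕ → ℝ → Set
IsHalfPower x k y = Σ[ r ∈ ℝ ] 0ℝ ≤ r × r ^ 2 ≃ x × y ≃ r ^ k

------------------------------------------------------------------------
-- Square real matrices

Matrix : ℕ → Set
Matrix n = Fin n → Vector ℝ n

infix  4 _≋_
infixl 6 _⊕_
infixl 7 _⊗_ _·_
infix  9 _ᵀ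

_≋_ : ∀ {n} → Matrix n → Matrix n → Set
A ≋ B = ∀ i j → A i j ≃ B i j

I J : ∀ n → Matrix n
I n i j with i Fin.≟ j
... | yes _ = 1ℝ
... | no  _ = 0ℝ
J n i j = 1ℝ

_⊕_ _⊗_ : ∀ {n} → Matrix n → Matrix n → Matrix n
(A ⊕ B) i j = A i j + B i j
(A ⊗ B) i j = sum λ k → A i k * B k j

_·_ : ∀ {n} → ℝ → Matrix n → Matrix n
(c · A) i j = c * A i j

_ᵀ : ∀ {n} → Matrix n → Matrix n
(A ᵀ) i j = A j i

-- Laplace expansion along the first row.

det : ∀ {n} → Matrix n → ℝ
det {zero}  A = 1ℝ
det {suc n} A = sum λ j →
  (- 1ℝ) ^ toℕ j * (A zero j * det λ i k → A (suc i) (punchIn j k))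

rowSum colSum : ∀ {n} → Matrix n → Fin n → ℝ
rowSum A i = sum λ j → A i j
colSum A j = sum λ i → A i j

s q : ∀ {n} → Matrix n → ℝ
s A = sum λ i → sum λ j → A i j
q A = sum λ i → sum λ j → A i j ^ 2

𝕄 : (n : ℕ) → ℝ → ℝ → Matrix n → Set
𝕄 n α β M = s M ≃ fromℕ n * α × q M ≃ fromℕ n * β

HasMaximalDet : (n : ℕ) → ℝ → ℝ → Matrix n → Set
HasMaximalDet n α β M = 𝕄 n α β M × (∀ N → 𝕄 n α β N → det N ≤ det M)

nonTrivial⇒nonZero-pred : ∀ n → .{{NonTrivial n}} → NonZero (pred n)
nonTrivial⇒nonZero-pred (suc (suc _)) = _

-- x divided by n - 1

_/[_-1] : ℝ → (n : ℕ) → .{{NonTrivial n}} → ℝ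
x /[ n -1] = x * fromℚ ((+ 1 ℚ./ pred n) {{nonTrivial⇒nonZero-pred n}})

δ : (n : ℕ) → .{{NonTrivial n}} → ℝ → ℝ → ℝ
δ n α β = (α ^ 2 - β) /[ n -1]

{-# OPTIONS --safe #-}

-- Hadamard's inequality and the inequality of arithmetic and geometric means
-- give det (X Xᵀ) ≤ cⁿ whenever the squared entries of X sum up to at most n c,
-- and equality forces X Xᵀ = c I.
--
-- If α² ≤ β, this is applied to X = M and c = β; the bound is attained by √β
-- times a reflection, chosen such that the entries have the prescribed sum.
--
-- If α² ≥ β, put r = √(β - δ) and N = r I + b J, where n b = α - r. Then N
-- satisfies the constraints and N Nᵀ = (β - δ) I + δ J, so it has to be shown
-- that M Mᵀ = N Nᵀ. Here X = B M and c = (r α)², where B = α I - b J is r α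
-- times the inverse of N: from det M ² ≥ det N ² follows det (X Xᵀ) ≥ cⁿ, and
-- n c - q X is δ ≥ 0 times the sum of the (Cⱼ - α)² over the column sums Cⱼ of M.
--
-- Up to the existence of square roots, all conclusions are equations between
-- reals and therefore stable under double negation, so that the order may be
-- treated as if it were decidable.

module Submission where

open import Defs
open import Algebra.Bundles using (CommutativeRing)
import Algebra.Properties.CommutativeSemigroup as CommutativeSemigroupProperties
import Algebra.Properties.Semiring.Sum as SemiringSum
import Algebra.Solver.Ring as RingSolver
import Algebra.Solver.Ring.AlmostCommutativeRing as ACR
open import Data.Fin.Base using (Fin; zero; suc; toℕ; punchIn; punchOut)
import Data.Fin.Properties as Fin
open import Data.Integer.Base as ℤ using (+_; -[1+_])
import Data.Integer.Properties as ℤ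
open import Data.Maybe.Base using (Maybe; just; nothing)
open import Data.Nat.Base as ℕ using (ℕ; zero; suc; pred; NonTrivial)
import Data.Nat.Coprimality as Coprimality
import Data.Nat.Properties as ℕ
open import Data.Product.Base using (Σ-syntax; _×_; _,_; proj₁; proj₂)
open import Data.Rational.Base as ℚ using (ℚ; 0ℚ; 1ℚ; ½; mkℚ)
import Data.Rational.Properties as ℚ
import Data.Rational.Solver as ℚ-Solver
open import Data.Sum.Base using (_⊎_; inj₁; inj₂)
open import Data.Vec.Functional using (Vector; _∷_; head; tail; insertAt)
open import Data.Vec.Functional.Properties using (insertAt-lookup; insertAt-punchIn)
open import Function.Base using (_∘_)
open import Level using (0ℓ)
import Relation.Binary.Reasoning.Setoid
open import Relation.Binary.PropositionalEquality as ≡ using (_≡_; _≢_)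
open import Relation.Nullary using (¬_; Dec; yes; no; contradiction)
open import Relation.Nullary.Negation.Core using (Stable)

-- Hadamard's inequality ignores the sum of the entries, so for `α² > β` its bound for `M` itself is
-- not attained. The expected optimum `N` supplies the correction: at `M = N` the product `B M` is
-- `r α` times the identity, where the bound is attained, and `B² = α² I - δ J` turns the trace of
-- `X Xᵀ` into `α² q(M) - δ |C|²`. The prescribed sum enters as the mean of the column sums, and the
-- sign of `δ` decides whether this trace stays below `n c`; this is what separates the two cases.
-- Only squared determinants are compared. Exchanging two rows preserves the constraints and negates
-- the determinant, so a maximal determinant is also maximal in absolute value, and the signs of `α`
-- and `det N` are irrelevant until the final formula. The equality case of Hadamard's inequality is
-- proved by induction on the rows, and the inequality is a consequence of it. As the determinant is
-- given by Laplace expansion, transposition and products rest on the uniqueness of alternating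
-- multilinear functions up to a factor.

private
  module ℚ-solver = ℚ-Solver.+-*-Solver

-- Rational estimates

*-posᵠ : ∀ {p q} → 0ℚ ℚ.< p → 0ℚ ℚ.< q → 0ℚ ℚ.< p ℚ.* q
*-posᵠ {p} {q} 0<p 0<q =
  ℚ.positive⁻¹ (p ℚ.* q) {{ℚ.pos*pos⇒pos p {{ℚ.positive 0<p}} q {{ℚ.positive 0<q}}}}

*-nonNegᵠ : ∀ {p q} → 0ℚ ℚ.≤ p → 0ℚ ℚ.≤ q → 0ℚ ℚ.≤ p ℚ.* q
*-nonNegᵠ {p} {q} 0≤p 0≤q =
  ℚ.nonNegative⁻¹ (p ℚ.* q)
    {{ℚ.nonNeg*nonNeg⇒nonNeg p {{ℚ.nonNegative 0≤p}} q {{ℚ.nonNegative 0≤q}}}}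

infixl 6 _⊹_
_⊹_ : ∀ {p q} → 0ℚ ℚ.< p → 0ℚ ℚ.< q → 0ℚ ℚ.< p ℚ.+ q
_⊹_ = ℚ.+-mono-<

<⇒0<ᵠ : ∀ {p q} → p ℚ.< q → 0ℚ ℚ.< q ℚ.- p
<⇒0<ᵠ {p} {q} p<q =
  ≡.subst (ℚ._< q ℚ.- p) (ℚ.+-inverseʳ p) (ℚ.+-monoˡ-< (ℚ.- p) p<q)

-- Most strict estimates take this form: the difference is exhibited as a sum of visibly positive
-- terms, and the ring solver checks the identity `d ≡ q - p`.
0<⇒<ᵠ : ∀ {d} p q → 0ℚ ℚ.< d → d ≡ q ℚ.- p → p ℚ.< q
0<⇒<ᵠ {d} p q 0<d d≡q-p =
  ≡.subst₂ ℚ._<_ (ℚ.+-identityˡ p) (≡.trans (≡.cong (ℚ._+ p) d≡q-p) (lemma p q))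
    (ℚ.+-monoˡ-< p 0<d)
  where
  open ℚ-solver
  lemma : ∀ p q → q ℚ.- p ℚ.+ p ≡ q
  lemma = solve 2 (λ p q → q :- p :+ p := q) ≡.refl

≤⇒0≤ᵠ : ∀ {p q} → p ℚ.≤ q → 0ℚ ℚ.≤ q ℚ.- p
≤⇒0≤ᵠ {p} {q} p≤q =
  ≡.subst (ℚ._≤ q ℚ.- p) (ℚ.+-inverseʳ p) (ℚ.+-monoˡ-≤ (ℚ.- p) p≤q)

p≤∣p∣ : ∀ p → p ℚ.≤ ℚ.∣ p ∣
p≤∣p∣ p with ℚ.≤-total 0ℚ p
... | inj₁ 0≤p = ℚ.≤-reflexive (≡.sym (ℚ.0≤p⇒∣p∣≡p 0≤p))
... | inj₂ p≤0 = ℚ.≤-trans p≤0 (ℚ.0≤∣p∣ p)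

∣p-q∣-comm : ∀ p q → ℚ.∣ p ℚ.- q ∣ ≡ ℚ.∣ q ℚ.- p ∣
∣p-q∣-comm p q = ≡.trans (≡.sym (ℚ.∣-p∣≡∣p∣ (p ℚ.- q))) (≡.cong ℚ.∣_∣ (lemma p q))
  where
  open ℚ-solver
  lemma : ∀ p q → ℚ.- (p ℚ.- q) ≡ q ℚ.- p
  lemma = solve 2 (λ p q → :- (p :- q) := q :- p) ≡.refl

close⇒0<ˡ : ∀ p q {ε} → ℚ.∣ p ℚ.- q ∣ ℚ.< ε → 0ℚ ℚ.< ε ℚ.- (p ℚ.- q)
close⇒0<ˡ p q close = <⇒0<ᵠ (ℚ.≤-<-trans (p≤∣p∣ (p ℚ.- q)) close)

close⇒0<ʳ : ∀ p q {ε} → ℚ.∣ p ℚ.- q ∣ ℚ.< ε → 0ℚ ℚ.< ε ℚ.- (q ℚ.- p)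
close⇒0<ʳ p q {ε} close =
  close⇒0<ˡ q p (≡.subst (ℚ._< ε) (∣p-q∣-comm p q) close)

0<⇒close : ∀ p q ε → 0ℚ ℚ.< ε ℚ.- (p ℚ.- q) → 0ℚ ℚ.< ε ℚ.- (q ℚ.- p) →
  ℚ.∣ p ℚ.- q ∣ ℚ.< ε
0<⇒close p q ε l r with ℚ.∣p∣≡p∨∣p∣≡-p (p ℚ.- q)
... | inj₁ eq = ≡.subst (ℚ._< ε) (≡.sym eq) (0<⇒<ᵠ _ _ l ≡.refl)
... | inj₂ eq = ≡.subst (ℚ._< ε) (≡.sym eq) (0<⇒<ᵠ _ _ r (lemma p q ε))
  where
  open ℚ-solver
  lemma : ∀ p q ε → ε ℚ.- (q ℚ.- p) ≡ ε ℚ.- ℚ.- (p ℚ.- q)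
  lemma = solve 3 (λ p q ε → ε :- (q :- p) := ε :- :- (p :- q)) ≡.refl

½*-posᵠ : ∀ {ε} → 0ℚ ℚ.< ε → 0ℚ ℚ.< ½ ℚ.* ε
½*-posᵠ = *-posᵠ (ℚ.positive⁻¹ ½)

p*1/p : ∀ {p} → 0ℚ ℚ.< p → Σ[ r ∈ ℚ ] 0ℚ ℚ.< r × p ℚ.* r ≡ 1ℚ
p*1/p {p} 0<p =
  (ℚ.1/ p) {{nz}} , ℚ.positive⁻¹ _ {{ℚ.1/pos⇒pos p {{pos}}}} , ℚ.*-inverseʳ p {{nz}}
  where
  pos : ℚ.Positive p
  pos = ℚ.positive 0<p
  nz : ℚ.NonZero p
  nz = ℚ.pos⇒nonZero p {{pos}}

-- The commutative ring of real numbers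

both : ∀ {P Q : ℕ → Set} → Eventually P → Eventually Q → Eventually λ n → P n × Q n
both (M , p) (N , q) = M ℕ.⊔ N , λ n M⊔N≤n →
  p n (ℕ.m⊔n≤o⇒m≤o M N M⊔N≤n) , q n (ℕ.m⊔n≤o⇒n≤o M N M⊔N≤n)

eventually-map : ∀ {P Q : ℕ → Set} → (∀ n → P n → Q n) → Eventually P → Eventually Q
eventually-map f (N , p) = N , λ n N≤n → f n (p n N≤n)

eventually-sat : ∀ {P : ℕ → Set} → Eventually P → Σ[ n ∈ ℕ ] P n
eventually-sat (N , p) = N , p N ℕ.≤-refl

cauchy-tail : ∀ x ε → 0ℚ ℚ.< ε →
  Σ[ N ∈ ℕ ] Eventually λ n → ℚ.∣ seq x n ℚ.- seq x N ∣ ℚ.< ε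
cauchy-tail x ε 0<ε with isCauchy x ε 0<ε
... | N , close = N , N , λ n N≤n → close n N N≤n ℕ.≤-refl

pointwise : ∀ {x y} → (∀ n → seq x n ≡ seq y n) → x ≃ y
pointwise {x} {y} eq = mk≃ λ ε 0<ε → 0 , λ n _ →
  ≡.subst (ℚ._< ε)
    (≡.sym (≡.cong ℚ.∣_∣ (≡.trans (≡.cong (ℚ._- seq y n) (eq n)) (ℚ.+-inverseʳ (seq y n))))) 0<ε

≃-refl : ∀ {x} → x ≃ x
≃-refl = pointwise λ _ → ≡.refl

≃-sym : ∀ {x y} → x ≃ y → y ≃ x
≃-sym {x} {y} x≃y = mk≃ λ ε 0<ε →
  eventually-map (λ n → ≡.subst (ℚ._< ε) (∣p-q∣-comm (seq x n) (seq y n))) (un≃ x≃y ε 0<ε)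

≃-trans : ∀ {x y z} → x ≃ y → y ≃ z → x ≃ z
≃-trans {x} {y} {z} x≃y y≃z = mk≃ λ ε 0<ε →
  eventually-map
    (λ n (p , q) → 0<⇒close (seq x n) (seq z n) ε
      (≡.subst (0ℚ ℚ.<_) (lemma₁ (seq x n) (seq y n) (seq z n) ε) (close⇒0<ˡ (seq x n) (seq y n) p ⊹ close⇒0<ˡ (seq y n) (seq z n) q))
      (≡.subst (0ℚ ℚ.<_) (lemma₂ (seq x n) (seq y n) (seq z n) ε) (close⇒0<ʳ (seq x n) (seq y n) p ⊹ close⇒0<ʳ (seq y n) (seq z n) q)))
    (both (un≃ x≃y (½ ℚ.* ε) (½*-posᵠ 0<ε)) (un≃ y≃z (½ ℚ.* ε) (½*-posᵠ 0<ε)))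
  where
  open ℚ-solver
  lemma₁ : ∀ x y z ε →
    (½ ℚ.* ε ℚ.- (x ℚ.- y)) ℚ.+ (½ ℚ.* ε ℚ.- (y ℚ.- z)) ≡ ε ℚ.- (x ℚ.- z)
  lemma₁ = solve 4 (λ x y z ε →
    (con ½ :* ε :- (x :- y)) :+ (con ½ :* ε :- (y :- z)) := ε :- (x :- z)) ≡.refl
  lemma₂ : ∀ x y z ε →
    (½ ℚ.* ε ℚ.- (y ℚ.- x)) ℚ.+ (½ ℚ.* ε ℚ.- (z ℚ.- y)) ≡ ε ℚ.- (z ℚ.- x)
  lemma₂ = solve 4 (λ x y z ε →
    (con ½ :* ε :- (y :- x)) :+ (con ½ :* ε :- (z :- y)) := ε :- (z :- x)) ≡.refl

bounded : ∀ x → Σ[ B ∈ ℚ ] 0ℚ ℚ.< B × Eventually λ n → ℚ.∣ seq x n ∣ ℚ.≤ B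
bounded x with cauchy-tail x 1ℚ (ℚ.positive⁻¹ 1ℚ)
... | N , close =
  1ℚ ℚ.+ ℚ.∣ seq x N ∣ ,
  ℚ.+-mono-<-≤ (ℚ.positive⁻¹ 1ℚ) (ℚ.0≤∣p∣ (seq x N)) ,
  eventually-map (λ n p → begin
    ℚ.∣ seq x n ∣
      ≡⟨ ≡.cong ℚ.∣_∣ (lemma (seq x n) (seq x N)) ⟩
    ℚ.∣ (seq x n ℚ.- seq x N) ℚ.+ seq x N ∣
      ≤⟨ ℚ.∣p+q∣≤∣p∣+∣q∣ (seq x n ℚ.- seq x N) (seq x N) ⟩
    ℚ.∣ seq x n ℚ.- seq x N ∣ ℚ.+ ℚ.∣ seq x N ∣
      ≤⟨ ℚ.+-monoˡ-≤ ℚ.∣ seq x N ∣ (ℚ.<⇒≤ p) ⟩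
    1ℚ ℚ.+ ℚ.∣ seq x N ∣ ∎) close
  where
  open ℚ.≤-Reasoning
  open ℚ-solver using (solve; _:=_; _:+_; _:-_)
  lemma : ∀ p q → p ≡ (p ℚ.- q) ℚ.+ q
  lemma = solve 2 (λ p q → p := (p :- q) :+ q) ≡.refl

opaque
  unfolding _+_ _*_ -_ ∣_∣

  +-congˡ : ∀ x {y z} → y ≃ z → x + y ≃ x + z
  +-congˡ x {y} {z} y≃z = mk≃ λ ε 0<ε →
    eventually-map (λ n → ≡.subst (λ t → ℚ.∣ t ∣ ℚ.< ε) (lemma (seq x n) (seq y n) (seq z n)))
      (un≃ y≃z ε 0<ε)
    where
    open ℚ-solver
    lemma : ∀ x y z → y ℚ.- z ≡ (x ℚ.+ y) ℚ.- (x ℚ.+ z)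
    lemma = solve 3 (λ x y z → y :- z := (x :+ y) :- (x :+ z)) ≡.refl

  -‿cong : ∀ {x y} → x ≃ y → - x ≃ - y
  -‿cong {x} {y} x≃y = mk≃ λ ε 0<ε →
    eventually-map (λ n → ≡.subst (λ t → ℚ.∣ t ∣ ℚ.< ε) (lemma (seq x n) (seq y n)))
      (un≃ (≃-sym x≃y) ε 0<ε)
    where
    open ℚ-solver
    lemma : ∀ x y → y ℚ.- x ≡ ℚ.- x ℚ.- ℚ.- y
    lemma = solve 2 (λ x y → y :- x := :- x :- :- y) ≡.refl

  *-congˡ : ∀ x {y z} → y ≃ z → x * y ≃ x * z
  *-congˡ x {y} {z} y≃z = mk≃ λ ε 0<ε →
    let B , 0<B , bound = bounded x
        r , 0<r , Br≡1  = p*1/p 0<B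
    in eventually-map
         (λ n (xn≤B , close) → ≡.subst₂ (λ s t → ℚ.∣ s ∣ ℚ.< t)
           (lemma₁ (seq x n) (seq y n) (seq z n))
           (≡.trans (≡.sym (ℚ.*-assoc B r ε))
             (≡.trans (≡.cong (ℚ._* ε) Br≡1) (ℚ.*-identityˡ ε)))
           (estimate (seq x n) (seq y n ℚ.- seq z n) B (r ℚ.* ε) 0<B xn≤B close))
         (both bound (un≃ y≃z (r ℚ.* ε) (*-posᵠ 0<r 0<ε)))
    where
    open ℚ-solver using (solve; _:=_; _:*_; _:-_)
    lemma₁ : ∀ x y z → x ℚ.* (y ℚ.- z) ≡ x ℚ.* y ℚ.- x ℚ.* z
    lemma₁ = solve 3 (λ x y z → x :* (y :- z) := x :* y :- x :* z) ≡.refl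
    estimate : ∀ a b c d → 0ℚ ℚ.< c → ℚ.∣ a ∣ ℚ.≤ c → ℚ.∣ b ∣ ℚ.< d →
      ℚ.∣ a ℚ.* b ∣ ℚ.< c ℚ.* d
    estimate a b c d 0<c ∣a∣≤c ∣b∣<d = begin-strict
      ℚ.∣ a ℚ.* b ∣       ≡⟨ ℚ.∣p*q∣≡∣p∣*∣q∣ a b ⟩
      ℚ.∣ a ∣ ℚ.* ℚ.∣ b ∣ ≤⟨ ℚ.*-monoʳ-≤-nonNeg ℚ.∣ b ∣ {{ℚ.nonNegative (ℚ.0≤∣p∣ b)}} ∣a∣≤c ⟩
      c ℚ.* ℚ.∣ b ∣       <⟨ ℚ.*-monoʳ-<-pos c {{ℚ.positive 0<c}} ∣b∣<d ⟩
      c ℚ.* d             ∎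
      where open ℚ.≤-Reasoning

  +-comm : ∀ x y → x + y ≃ y + x
  +-comm x y = pointwise λ n → ℚ.+-comm (seq x n) (seq y n)

  +-assoc : ∀ x y z → (x + y) + z ≃ x + (y + z)
  +-assoc x y z = pointwise λ n → ℚ.+-assoc (seq x n) (seq y n) (seq z n)

  +-identityˡ : ∀ x → 0ℝ + x ≃ x
  +-identityˡ x = pointwise λ n → ℚ.+-identityˡ (seq x n)

  +-inverseˡ : ∀ x → - x + x ≃ 0ℝ
  +-inverseˡ x = pointwise λ n → ℚ.+-inverseˡ (seq x n)

  *-comm : ∀ x y → x * y ≃ y * x
  *-comm x y = pointwise λ n → ℚ.*-comm (seq x n) (seq y n)

  *-assoc : ∀ x y z → (x * y) * z ≃ x * (y * z)
  *-assoc x y z = pointwise λ n → ℚ.*-assoc (seq x n) (seq y n) (seq z n)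

  *-identityˡ : ∀ x → 1ℝ * x ≃ x
  *-identityˡ x = pointwise λ n → ℚ.*-identityˡ (seq x n)

  *-distribˡ-+ : ∀ x y z → x * (y + z) ≃ x * y + x * z
  *-distribˡ-+ x y z = pointwise λ n → ℚ.*-distribˡ-+ (seq x n) (seq y n) (seq z n)

  fromℚ-+ : ∀ p q → fromℚ (p ℚ.+ q) ≃ fromℚ p + fromℚ q
  fromℚ-+ p q = pointwise λ _ → ≡.refl

  fromℚ-* : ∀ p q → fromℚ (p ℚ.* q) ≃ fromℚ p * fromℚ q
  fromℚ-* p q = pointwise λ _ → ≡.refl

  fromℚ-neg : ∀ p → fromℚ (ℚ.- p) ≃ - fromℚ p
  fromℚ-neg p = pointwise λ _ → ≡.refl

+-cong : ∀ {x y u v} → x ≃ y → u ≃ v → x + u ≃ y + v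
+-cong {x} {y} {u} {v} x≃y u≃v =
  ≃-trans (+-congˡ x u≃v) (≃-trans (+-comm x v) (≃-trans (+-congˡ v x≃y) (+-comm v y)))

*-cong : ∀ {x y u v} → x ≃ y → u ≃ v → x * u ≃ y * v
*-cong {x} {y} {u} {v} x≃y u≃v =
  ≃-trans (*-congˡ x u≃v) (≃-trans (*-comm x v) (≃-trans (*-congˡ v x≃y) (*-comm v y)))

ℝ-commutativeRing : CommutativeRing 0ℓ 0ℓ
ℝ-commutativeRing = record
  { Carrier = ℝ ; _≈_ = _≃_ ; _+_ = _+_ ; _*_ = _*_ ; -_ = -_ ; 0# = 0ℝ ; 1# = 1ℝ
  ; isCommutativeRing = record
    { isRing = record
      { +-isAbelianGroup = record
        { isGroup = record
          { isMonoid = record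
            { isSemigroup = record
              { isMagma = record
                { isEquivalence = record { refl = ≃-refl ; sym = ≃-sym ; trans = ≃-trans }
                ; ∙-cong = +-cong }
              ; assoc = +-assoc }
            ; identity = +-identityˡ , λ x → ≃-trans (+-comm x 0ℝ) (+-identityˡ x) }
          ; inverse = +-inverseˡ , λ x → ≃-trans (+-comm x (- x)) (+-inverseˡ x)
          ; ⁻¹-cong = -‿cong }
        ; comm = +-comm }
      ; *-cong = *-cong
      ; *-assoc = *-assoc
      ; *-identity = *-identityˡ , λ x → ≃-trans (*-comm x 1ℝ) (*-identityˡ x)
      ; distrib = *-distribˡ-+ , λ x y z →
          ≃-trans (*-comm (y + z) x)
            (≃-trans (*-distribˡ-+ x y z) (+-cong (*-comm x y) (*-comm x z))) }
    ; *-comm = *-comm } }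

open CommutativeRing ℝ-commutativeRing
  using (+-identityʳ; *-identityʳ)
  renaming (zeroˡ to *-zeroˡ; zeroʳ to *-zeroʳ; -‿inverseʳ to +-inverseʳ)
open CommutativeSemigroupProperties (CommutativeRing.+-commutativeSemigroup ℝ-commutativeRing)
  using () renaming (x∙yz≈y∙xz to x+[y+z]≃y+[x+z])
open CommutativeSemigroupProperties (CommutativeRing.*-commutativeSemigroup ℝ-commutativeRing)
  using () renaming (x∙yz≈y∙xz to x*[y*z]≃y*[x*z])
open SemiringSum (CommutativeRing.semiring ℝ-commutativeRing)
  using (∑-distrib-+; ∑-comm; *-distribˡ-sum; *-distribʳ-sum; sum-replicate-zero)
  renaming (sum-cong-≋ to sum-cong)
module ≃-Reasoning = Relation.Binary.Reasoning.Setoid (CommutativeRing.setoid ℝ-commutativeRing)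

private
  fromℚ-≟ : ∀ p q → Maybe (fromℚ p ≃ fromℚ q)
  fromℚ-≟ p q with p ℚ.≟ q
  ... | yes ≡.refl = just ≃-refl
  ... | no _       = nothing

  ℚ⟶ℝ : CommutativeRing.rawRing ℚ.+-*-commutativeRing
    ACR.-Raw-AlmostCommutative⟶ ACR.fromCommutativeRing ℝ-commutativeRing
  ℚ⟶ℝ = record
    { ⟦_⟧ = fromℚ ; +-homo = fromℚ-+ ; *-homo = fromℚ-* ; -‿homo = fromℚ-neg
    ; 0-homo = ≃-refl ; 1-homo = ≃-refl }

-- Rational coefficients have decidable equality, unlike real ones, and let identities with
-- constants such as `½` be normalised.
module ℝ-solver = RingSolver (CommutativeRing.rawRing ℚ.+-*-commutativeRing)
  (ACR.fromCommutativeRing ℝ-commutativeRing) ℚ⟶ℝ fromℚ-≟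

-- The order

<⇒≱ : ∀ {x y} → x < y → ¬ (y ≤ x)
<⇒≱ {x} {y} (mk< (ε , 0<ε , x+ε<y)) y≤x with eventually-sat (both x+ε<y (un≤ y≤x ε 0<ε))
... | n , p , q = ℚ.<-irrefl ≡.refl (ℚ.<-trans p q)

-- Two reals cannot be compared effectively, two terms of their sequences can. From some index on,
-- the sequences stay within `η = ε / 8` of fixed terms `a` and `b`. If `b < a + ε / 2`, then `y`
-- stays below `x + ε`; otherwise `y` exceeds `x` by `ε / 4`, which is excluded.
≮⇒≥ : ∀ {x y} → ¬ (x < y) → y ≤ x
≮⇒≥ {x} {y} x≮y = mk≤ λ ε 0<ε →
  let η = ½ ℚ.* (½ ℚ.* (½ ℚ.* ε))
      0<η = ½*-posᵠ (½*-posᵠ (½*-posᵠ 0<ε))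
      K , close-x = cauchy-tail x η 0<η
      L , close-y = cauchy-tail y η 0<η
  in compare ε 0<ε (both close-x close-y) (seq y L ℚ.<? seq x K ℚ.+ ½ ℚ.* ε)
  where
  open ℚ-solver
  below : ∀ x y a b ε → let η = ½ ℚ.* (½ ℚ.* (½ ℚ.* ε)) in
    (η ℚ.- (a ℚ.- x)) ℚ.+ (η ℚ.- (y ℚ.- b)) ℚ.+ ((a ℚ.+ ½ ℚ.* ε) ℚ.- b) ℚ.+ ½ ℚ.* (½ ℚ.* ε)
    ≡ (x ℚ.+ ε) ℚ.- y
  below = solve 5 (λ x y a b ε → let η = con ½ :* (con ½ :* (con ½ :* ε)) in
    (η :- (a :- x)) :+ (η :- (y :- b)) :+ ((a :+ con ½ :* ε) :- b) :+ con ½ :* (con ½ :* ε)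
    := (x :+ ε) :- y) ≡.refl
  above : ∀ x y a b ε → let η = ½ ℚ.* (½ ℚ.* (½ ℚ.* ε)) in
    (η ℚ.- (x ℚ.- a)) ℚ.+ (η ℚ.- (b ℚ.- y)) ℚ.+ (b ℚ.- (a ℚ.+ ½ ℚ.* ε))
    ≡ y ℚ.- (x ℚ.+ ½ ℚ.* (½ ℚ.* ε))
  above = solve 5 (λ x y a b ε → let η = con ½ :* (con ½ :* (con ½ :* ε)) in
    (η :- (x :- a)) :+ (η :- (b :- y)) :+ (b :- (a :+ con ½ :* ε))
    := y :- (x :+ con ½ :* (con ½ :* ε))) ≡.refl
  compare : ∀ ε {a b} → 0ℚ ℚ.< ε → let η = ½ ℚ.* (½ ℚ.* (½ ℚ.* ε)) in
    Eventually (λ n → ℚ.∣ seq x n ℚ.- a ∣ ℚ.< η × ℚ.∣ seq y n ℚ.- b ∣ ℚ.< η) →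
    Dec (b ℚ.< a ℚ.+ ½ ℚ.* ε) → Eventually λ n → seq y n ℚ.< seq x n ℚ.+ ε
  compare ε {a} {b} 0<ε close (yes b<a+½ε) = eventually-map
    (λ n (p , q) → 0<⇒<ᵠ _ _
      (close⇒0<ʳ (seq x n) a p ⊹ close⇒0<ˡ (seq y n) b q ⊹ <⇒0<ᵠ b<a+½ε ⊹ ½*-posᵠ (½*-posᵠ 0<ε))
      (below (seq x n) (seq y n) a b ε)) close
  compare ε {a} {b} 0<ε close (no b≮a+½ε) = contradiction
    (mk< (½ ℚ.* (½ ℚ.* ε) , ½*-posᵠ (½*-posᵠ 0<ε) , eventually-map
      (λ n (p , q) → 0<⇒<ᵠ _ _
        (ℚ.+-mono-<-≤ (close⇒0<ˡ (seq x n) a p ⊹ close⇒0<ʳ (seq y n) b q) (≤⇒0≤ᵠ (ℚ.≮⇒≥ b≮a+½ε)))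
        (above (seq x n) (seq y n) a b ε)) close))
    x≮y

≤-reflexive : ∀ {x y} → x ≃ y → x ≤ y
≤-reflexive {x} {y} x≃y = mk≤ λ ε 0<ε → eventually-map
  (λ n p → 0<⇒<ᵠ (seq x n) (seq y n ℚ.+ ε) (close⇒0<ˡ (seq x n) (seq y n) p) (lemma (seq x n) (seq y n) ε))
  (un≃ x≃y ε 0<ε)
  where
  open ℚ-solver
  lemma : ∀ x y ε → ε ℚ.- (x ℚ.- y) ≡ y ℚ.+ ε ℚ.- x
  lemma = solve 3 (λ x y ε → ε :- (x :- y) := y :+ ε :- x) ≡.refl

≤-antisym : ∀ {x y} → x ≤ y → y ≤ x → x ≃ y
≤-antisym {x} {y} x≤y y≤x = mk≃ λ ε 0<ε → eventually-map
  (λ n (p , q) → 0<⇒close (seq x n) (seq y n) ε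
    (≡.subst (0ℚ ℚ.<_) (lemma (seq x n) (seq y n) ε) (<⇒0<ᵠ p))
    (≡.subst (0ℚ ℚ.<_) (lemma (seq y n) (seq x n) ε) (<⇒0<ᵠ q)))
  (both (un≤ x≤y ε 0<ε) (un≤ y≤x ε 0<ε))
  where
  open ℚ-solver
  lemma : ∀ x y ε → y ℚ.+ ε ℚ.- x ≡ ε ℚ.- (x ℚ.- y)
  lemma = solve 3 (λ x y ε → y :+ ε :- x := ε :- (x :- y)) ≡.refl

<-≤-trans : ∀ {x y z} → x < y → y ≤ z → x < z
<-≤-trans {x} {y} {z} (mk< (ε , 0<ε , x+ε<y)) y≤z =
  mk< (½ ℚ.* ε , ½*-posᵠ 0<ε , eventually-map
    (λ n (p , q) → 0<⇒<ᵠ _ _ (<⇒0<ᵠ p ⊹ <⇒0<ᵠ q) (lemma (seq x n) (seq y n) (seq z n) ε))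
    (both x+ε<y (un≤ y≤z (½ ℚ.* ε) (½*-posᵠ 0<ε))))
  where
  open ℚ-solver
  lemma : ∀ x y z ε → (y ℚ.- (x ℚ.+ ε)) ℚ.+ (z ℚ.+ ½ ℚ.* ε ℚ.- y) ≡ z ℚ.- (x ℚ.+ ½ ℚ.* ε)
  lemma = solve 4 (λ x y z ε →
    (y :- (x :+ ε)) :+ (z :+ con ½ :* ε :- y) := z :- (x :+ con ½ :* ε)) ≡.refl

≤-<-trans : ∀ {x y z} → x ≤ y → y < z → x < z
≤-<-trans {x} {y} {z} x≤y (mk< (ε , 0<ε , y+ε<z)) =
  mk< (½ ℚ.* ε , ½*-posᵠ 0<ε , eventually-map
    (λ n (p , q) → 0<⇒<ᵠ _ _ (<⇒0<ᵠ p ⊹ <⇒0<ᵠ q) (lemma (seq x n) (seq y n) (seq z n) ε))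
    (both y+ε<z (un≤ x≤y (½ ℚ.* ε) (½*-posᵠ 0<ε))))
  where
  open ℚ-solver
  lemma : ∀ x y z ε → (z ℚ.- (y ℚ.+ ε)) ℚ.+ (y ℚ.+ ½ ℚ.* ε ℚ.- x) ≡ z ℚ.- (x ℚ.+ ½ ℚ.* ε)
  lemma = solve 4 (λ x y z ε →
    (z :- (y :+ ε)) :+ (y :+ con ½ :* ε :- x) := z :- (x :+ con ½ :* ε)) ≡.refl

<-irrefl : ∀ {x} → ¬ (x < x)
<-irrefl x<x = <⇒≱ x<x (≤-reflexive ≃-refl)

≤-refl : ∀ {x} → x ≤ x
≤-refl = ≤-reflexive ≃-refl

≤-trans : ∀ {x y z} → x ≤ y → y ≤ z → x ≤ z
≤-trans x≤y y≤z = ≮⇒≥ λ z<x → <⇒≱ (≤-<-trans y≤z z<x) x≤y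

<⇒≤ : ∀ {x y} → x < y → x ≤ y
<⇒≤ {x} {y} (mk< (ε , 0<ε , x+ε<y)) = ≮⇒≥ λ (mk< (η , 0<η , y+η<x)) →
  let n , p , q = eventually-sat (both x+ε<y y+η<x)
  in ℚ.<-asym (grow (seq x n) 0<ε p) (grow (seq y n) 0<η q)
  where
  grow : ∀ p {q ε} → 0ℚ ℚ.< ε → p ℚ.+ ε ℚ.< q → p ℚ.< q
  grow p {q} {ε} 0<ε =
    ℚ.<-trans (≡.subst (ℚ._< p ℚ.+ ε) (ℚ.+-identityʳ p) (ℚ.+-monoʳ-< p 0<ε))

≤-stable : ∀ {x y} → Stable (x ≤ y)
≤-stable ¬¬x≤y = ≮⇒≥ λ y<x → ¬¬x≤y (<⇒≱ y<x)

≃-stable : ∀ {x y} → Stable (x ≃ y)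
≃-stable ¬¬x≃y = ≤-antisym
  (≤-stable λ x≰y → ¬¬x≃y (x≰y ∘ ≤-reflexive))
  (≤-stable λ y≰x → ¬¬x≃y (y≰x ∘ ≤-reflexive ∘ ≃-sym))

by-cases : ∀ {P : Set} → Stable P → ∀ x y → (x < y → P) → (y ≤ x → P) → P
by-cases stable x y f g = stable λ ¬p → ¬p (g (≮⇒≥ (¬p ∘ f)))

opaque
  unfolding _+_ _*_ -_ ∣_∣

  +-monoˡ-≤ : ∀ z {x y} → x ≤ y → x + z ≤ y + z
  +-monoˡ-≤ z {x} {y} x≤y = mk≤ λ ε 0<ε → eventually-map
    (λ n p → 0<⇒<ᵠ _ _ (<⇒0<ᵠ p) (lemma (seq x n) (seq y n) (seq z n) ε)) (un≤ x≤y ε 0<ε)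
    where
    open ℚ-solver
    lemma : ∀ x y z ε → (y ℚ.+ ε) ℚ.- x ≡ ((y ℚ.+ z) ℚ.+ ε) ℚ.- (x ℚ.+ z)
    lemma = solve 4 (λ x y z ε → (y :+ ε) :- x := ((y :+ z) :+ ε) :- (x :+ z)) ≡.refl

  +-monoˡ-< : ∀ z {x y} → x < y → x + z < y + z
  +-monoˡ-< z {x} {y} (mk< (ε , 0<ε , x+ε<y)) = mk< (ε , 0<ε , eventually-map
    (λ n p → 0<⇒<ᵠ _ _ (<⇒0<ᵠ p) (lemma (seq x n) (seq y n) (seq z n) ε)) x+ε<y)
    where
    open ℚ-solver
    lemma : ∀ x y z ε → y ℚ.- (x ℚ.+ ε) ≡ (y ℚ.+ z) ℚ.- ((x ℚ.+ z) ℚ.+ ε)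
    lemma = solve 4 (λ x y z ε → y :- (x :+ ε) := (y :+ z) :- ((x :+ z) :+ ε)) ≡.refl

  0<x*y : ∀ {x y} → 0ℝ < x → 0ℝ < y → 0ℝ < x * y
  0<x*y {x} {y} (mk< (ε , 0<ε , ε<x)) (mk< (η , 0<η , η<y)) =
    mk< (ε ℚ.* η , *-posᵠ 0<ε 0<η , eventually-map (λ n (p , q) →
      estimate (seq x n) (seq y n)
        (≡.subst (ℚ._< seq x n) (ℚ.+-identityˡ ε) p)
        (≡.subst (ℚ._< seq y n) (ℚ.+-identityˡ η) q)) (both ε<x η<y))
    where
    open ℚ.≤-Reasoning
    estimate : ∀ a b → ε ℚ.< a → η ℚ.< b → 0ℚ ℚ.+ ε ℚ.* η ℚ.< a ℚ.* b
    estimate a b ε<a η<b = begin-strict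
      0ℚ ℚ.+ ε ℚ.* η ≡⟨ ℚ.+-identityˡ (ε ℚ.* η) ⟩
      ε ℚ.* η        <⟨ ℚ.*-monoˡ-<-pos η {{ℚ.positive 0<η}} ε<a ⟩
      a ℚ.* η        <⟨ ℚ.*-monoʳ-<-pos a {{ℚ.positive (ℚ.<-trans 0<ε ε<a)}} η<b ⟩
      a ℚ.* b        ∎

  0≤∣x∣ : ∀ x → 0ℝ ≤ ∣ x ∣
  0≤∣x∣ x = mk≤ λ ε 0<ε → 0 , λ n _ → ℚ.+-mono-≤-< (ℚ.0≤∣p∣ (seq x n)) 0<ε

  ∣x∣*∣x∣≃x*x : ∀ x → ∣ x ∣ * ∣ x ∣ ≃ x * x
  ∣x∣*∣x∣≃x*x x = pointwise λ n → lemma (seq x n) (ℚ.∣p∣≡p∨∣p∣≡-p (seq x n))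
    where
    open ℚ-solver using (solve; _:=_; _:*_; :-_)
    lemma : ∀ p → ℚ.∣ p ∣ ≡ p ⊎ ℚ.∣ p ∣ ≡ ℚ.- p → ℚ.∣ p ∣ ℚ.* ℚ.∣ p ∣ ≡ p ℚ.* p
    lemma p (inj₁ eq) = ≡.cong₂ ℚ._*_ eq eq
    lemma p (inj₂ eq) = ≡.trans (≡.cong₂ ℚ._*_ eq eq)
      (solve 1 (λ p → (:- p) :* (:- p) := p :* p) ≡.refl p)

≤-respˡ : ∀ {x y z} → x ≃ y → x ≤ z → y ≤ z
≤-respˡ x≃y = ≤-trans (≤-reflexive (≃-sym x≃y))

≤-respʳ : ∀ {x y z} → y ≃ z → x ≤ y → x ≤ z
≤-respʳ y≃z x≤y = ≤-trans x≤y (≤-reflexive y≃z)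

<-respˡ : ∀ {x y z} → x ≃ y → x < z → y < z
<-respˡ x≃y = ≤-<-trans (≤-reflexive (≃-sym x≃y))

<-respʳ : ∀ {x y z} → y ≃ z → x < y → x < z
<-respʳ y≃z x<y = <-≤-trans x<y (≤-reflexive y≃z)

private
  x-x≃0 : ∀ x → x - x ≃ 0ℝ
  x-x≃0 = solve 1 (λ x → x :- x := con 0ℚ) ≃-refl
    where open ℝ-solver

  y-x+x≃y : ∀ x y → y - x + x ≃ y
  y-x+x≃y = solve 2 (λ x y → y :- x :+ x := y) ≃-refl
    where open ℝ-solver

0≤⇒≤ : ∀ {x y d} → d ≃ y - x → 0ℝ ≤ d → x ≤ y
0≤⇒≤ {x} {y} d≃y-x 0≤d = ≤-respˡ (+-identityˡ x) (≤-respʳ (y-x+x≃y x y)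
  (+-monoˡ-≤ x (≤-respʳ d≃y-x 0≤d)))

≤⇒0≤ : ∀ {x y} → x ≤ y → 0ℝ ≤ y - x
≤⇒0≤ {x} x≤y = ≤-respˡ (x-x≃0 x) (+-monoˡ-≤ (- x) x≤y)

0<⇒< : ∀ {x y d} → d ≃ y - x → 0ℝ < d → x < y
0<⇒< {x} {y} d≃y-x 0<d = <-respˡ (+-identityˡ x) (<-respʳ (y-x+x≃y x y)
  (+-monoˡ-< x (<-respʳ d≃y-x 0<d)))

<⇒0< : ∀ {x y} → x < y → 0ℝ < y - x
<⇒0< {x} x<y = <-respˡ (x-x≃0 x) (+-monoˡ-< (- x) x<y)

0≤x+y : ∀ {x y} → 0ℝ ≤ x → 0ℝ ≤ y → 0ℝ ≤ x + y
0≤x+y {x} {y} 0≤x 0≤y = ≤-trans 0≤y (≤-respˡ (+-identityˡ y) (+-monoˡ-≤ y 0≤x))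

0<x+y : ∀ {x y} → 0ℝ < x → 0ℝ ≤ y → 0ℝ < x + y
0<x+y {x} {y} 0<x 0≤y = ≤-<-trans 0≤y (<-respˡ (+-identityˡ y) (+-monoˡ-< y 0<x))

-- Case distinction leaves a product of positive numbers or a product with zero, which avoids
-- termwise bounds on the sequences.
0≤x*y : ∀ {x y} → 0ℝ ≤ x → 0ℝ ≤ y → 0ℝ ≤ x * y
0≤x*y {x} {y} 0≤x 0≤y =
  by-cases ≤-stable 0ℝ x
    (λ 0<x → by-cases ≤-stable 0ℝ y (λ 0<y → <⇒≤ (0<x*y 0<x 0<y))
      λ y≤0 → ≤-reflexive (≃-sym (≃-trans (*-congˡ x (≤-antisym y≤0 0≤y)) (x*0 x))))
    λ x≤0 → ≤-reflexive (≃-sym (≃-trans (*-cong (≤-antisym x≤0 0≤x) ≃-refl) (0*x y)))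
  where
  open ℝ-solver
  x*0 : ∀ x → x * 0ℝ ≃ 0ℝ
  x*0 = solve 1 (λ x → x :* con 0ℚ := con 0ℚ) ≃-refl
  0*x : ∀ x → 0ℝ * x ≃ 0ℝ
  0*x = solve 1 (λ x → con 0ℚ :* x := con 0ℚ) ≃-refl

x<0⇒0<-x : ∀ {x} → x < 0ℝ → 0ℝ < - x
x<0⇒0<-x {x} x<0 = <-respʳ (+-identityˡ (- x)) (<⇒0< x<0)

x≤0⇒0≤-x : ∀ {x} → x ≤ 0ℝ → 0ℝ ≤ - x
x≤0⇒0≤-x {x} x≤0 = ≤-respʳ (+-identityˡ (- x)) (≤⇒0≤ x≤0)

-x*-x≃x*x : ∀ x → (- x) * (- x) ≃ x * x
-x*-x≃x*x = solve 1 (λ x → (:- x) :* (:- x) := x :* x) ≃-refl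
  where open ℝ-solver

0≤x*x : ∀ x → 0ℝ ≤ x * x
0≤x*x x = by-cases ≤-stable 0ℝ x (λ 0<x → <⇒≤ (0<x*y 0<x 0<x))
  λ x≤0 → ≤-respʳ (-x*-x≃x*x x) (0≤x*y (x≤0⇒0≤-x x≤0) (x≤0⇒0≤-x x≤0))

x*x≤0⇒x≃0 : ∀ {x} → x * x ≤ 0ℝ → x ≃ 0ℝ
x*x≤0⇒x≃0 {x} x²≤0 = ≤-antisym
  (≮⇒≥ λ 0<x → <⇒≱ (0<x*y 0<x 0<x) x²≤0)
  (≮⇒≥ λ x<0 → <⇒≱ (<-respʳ (-x*-x≃x*x x) (0<x*y (x<0⇒0<-x x<0) (x<0⇒0<-x x<0))) x²≤0)

*-monoˡ-≤ : ∀ {z x y} → 0ℝ ≤ z → x ≤ y → z * x ≤ z * y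
*-monoˡ-≤ {z} {x} {y} 0≤z x≤y = 0≤⇒≤ (lemma z x y) (0≤x*y 0≤z (≤⇒0≤ x≤y))
  where
  open ℝ-solver
  lemma : ∀ z x y → z * (y - x) ≃ z * y - z * x
  lemma = solve 3 (λ z x y → z :* (y :- x) := z :* y :- z :* x) ≃-refl

*-monoˡ-< : ∀ {z x y} → 0ℝ < z → x < y → z * x < z * y
*-monoˡ-< {z} {x} {y} 0<z x<y = 0<⇒< (lemma z x y) (0<x*y 0<z (<⇒0< x<y))
  where
  open ℝ-solver
  lemma : ∀ z x y → z * (y - x) ≃ z * y - z * x
  lemma = solve 3 (λ z x y → z :* (y :- x) := z :* y :- z :* x) ≃-refl

*-cancelˡ-≤ : ∀ {z x y} → 0ℝ < z → z * x ≤ z * y → x ≤ y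
*-cancelˡ-≤ 0<z zx≤zy = ≮⇒≥ λ y<x → <⇒≱ (*-monoˡ-< 0<z y<x) zx≤zy

*-cancelˡ-≃ : ∀ {z x y} → 0ℝ < z → z * x ≃ z * y → x ≃ y
*-cancelˡ-≃ 0<z zx≃zy = ≤-antisym
  (*-cancelˡ-≤ 0<z (≤-reflexive zx≃zy)) (*-cancelˡ-≤ 0<z (≤-reflexive (≃-sym zx≃zy)))

-- If `x + y` is positive, it cancels from `(x + y) x ≃ (x + y) y`. Otherwise `y - x`, being
-- `- (x + y) + 2 y`, is nonnegative, and so is `x - y`.
x*x≃y*y⇒x≃y : ∀ {x y} → 0ℝ ≤ x → 0ℝ ≤ y → x * x ≃ y * y → x ≃ y
x*x≃y*y⇒x≃y {x} {y} 0≤x 0≤y x²≃y² = by-cases ≃-stable 0ℝ (x + y)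
  (λ 0<x+y → *-cancelˡ-≃ 0<x+y (≃-trans (lemma₁ x y)
    (≃-trans (+-cong ≃-refl x²≃y²) (lemma₂ x y))))
  (λ x+y≤0 → ≤-antisym
    (0≤⇒≤ (lemma₃ x y) (0≤x+y (x≤0⇒0≤-x x+y≤0) (0≤x+y 0≤y 0≤y)))
    (0≤⇒≤ (lemma₄ x y) (0≤x+y (x≤0⇒0≤-x x+y≤0) (0≤x+y 0≤x 0≤x))))
  where
  open ℝ-solver
  lemma₁ : ∀ x y → (x + y) * x ≃ x * y + x * x
  lemma₁ = solve 2 (λ x y → (x :+ y) :* x := x :* y :+ x :* x) ≃-refl
  lemma₂ : ∀ x y → x * y + y * y ≃ (x + y) * y
  lemma₂ = solve 2 (λ x y → x :* y :+ y :* y := (x :+ y) :* y) ≃-refl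
  lemma₃ : ∀ x y → - (x + y) + (y + y) ≃ y - x
  lemma₃ = solve 2 (λ x y → :- (x :+ y) :+ (y :+ y) := y :- x) ≃-refl
  lemma₄ : ∀ x y → - (x + y) + (x + x) ≃ x - y
  lemma₄ = solve 2 (λ x y → :- (x :+ y) :+ (x :+ x) := x :- y) ≃-refl

-- Natural multiples and square roots

n/1 : ∀ n → + n ℚ./ 1 ≡ mkℚ (+ n) 0 (Coprimality.sym (Coprimality.1-coprimeTo n))
n/1 n = ℚ.normalize-coprime (Coprimality.sym (Coprimality.1-coprimeTo n))

[1+n]/1 : ∀ n → + suc n ℚ./ 1 ≡ 1ℚ ℚ.+ + n ℚ./ 1
[1+n]/1 n rewrite n/1 n = ≡.cong (λ i → (+ 1 ℤ.+ i) ℚ./ 1) (≡.sym (ℤ.*-identityʳ (+ n)))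

[1+n]/1*1/[1+n] : ∀ n → + suc n ℚ./ 1 ℚ.* (+ 1 ℚ./ suc n) ≡ 1ℚ
[1+n]/1*1/[1+n] n
  rewrite n/1 (suc n) | ℚ.normalize-coprime {1} {n} (Coprimality.1-coprimeTo (suc n)) =
  ℚ.*-inverseʳ (mkℚ (+ suc n) 0 (Coprimality.sym (Coprimality.1-coprimeTo (suc n))))

archimedean : ∀ p → Σ[ K ∈ ℕ ] ∀ n → K ℕ.≤ n → p ℚ.< + n ℚ./ 1
archimedean p@(mkℚ i d _) = suc ℤ.∣ i ∣ , λ n ∣i∣<n →
  ≡.subst (p ℚ.<_) (≡.sym (n/1 n)) (ℚ.*<* (begin-strict
    i ℤ.* + 1         ≡⟨ ℤ.*-identityʳ i ⟩
    i                 ≤⟨ i≤∣i∣ i ⟩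
    + ℤ.∣ i ∣         <⟨ ℤ.+<+ ∣i∣<n ⟩
    + n               ≤⟨ ℤ.+≤+ (ℕ.m≤m*n n (suc d)) ⟩
    + (n ℕ.* suc d)   ≡⟨ ℤ.pos-* n (suc d) ⟩
    + n ℤ.* + suc d   ∎))
  where
  open ℤ.≤-Reasoning
  i≤∣i∣ : ∀ i → i ℤ.≤ + ℤ.∣ i ∣
  i≤∣i∣ (+ n)    = ℤ.≤-refl
  i≤∣i∣ -[1+ n ] = ℤ.-≤+

1/[1+n]<ε : ∀ ε → 0ℚ ℚ.< ε → Eventually λ n → + 1 ℚ./ suc n ℚ.< ε
1/[1+n]<ε ε 0<ε =
  let r , 0<r , εr≡1 = p*1/p 0<ε
      K , r<n        = archimedean r
  in K , λ n K≤n → ℚ.*-cancelˡ-<-nonNeg r {{ℚ.nonNegative (ℚ.<⇒≤ 0<r)}} (begin-strict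
       r ℚ.* (+ 1 ℚ./ suc n)
         <⟨ ℚ.*-monoˡ-<-pos (+ 1 ℚ./ suc n) {{ℚ.normalize-pos 1 (suc n)}}
              (r<n (suc n) (ℕ.m≤n⇒m≤1+n K≤n)) ⟩
       + suc n ℚ./ 1 ℚ.* (+ 1 ℚ./ suc n)
         ≡⟨ [1+n]/1*1/[1+n] n ⟩
       1ℚ
         ≡⟨ εr≡1 ⟨
       ε ℚ.* r
         ≡⟨ ℚ.*-comm ε r ⟩
       r ℚ.* ε ∎)
  where open ℚ.≤-Reasoning

*-mono-<ᵠ : ∀ {p q} → 0ℚ ℚ.≤ p → p ℚ.< q → p ℚ.* p ℚ.< q ℚ.* q
*-mono-<ᵠ {p} {q} 0≤p p<q = ℚ.≤-<-trans
  (ℚ.*-monoˡ-≤-nonNeg p {{ℚ.nonNegative 0≤p}} (ℚ.<⇒≤ p<q))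
  (ℚ.*-monoˡ-<-pos q {{ℚ.positive (ℚ.≤-<-trans 0≤p p<q)}} p<q)

-- The square of `a` is at most `q` and that of `a + K η` is above, so one of the `K` steps of
-- length `η` crosses. `K` counts the steps left and ensures termination.
grid-search : ∀ q η K a → 0ℚ ℚ.≤ η → 0ℚ ℚ.≤ a → a ℚ.* a ℚ.≤ q →
  let b = a ℚ.+ + K ℚ./ 1 ℚ.* η in q ℚ.< b ℚ.* b →
  Σ[ r ∈ ℚ ] 0ℚ ℚ.≤ r × r ℚ.* r ℚ.≤ q × q ℚ.< (r ℚ.+ η) ℚ.* (r ℚ.+ η)
grid-search q η zero a 0≤η 0≤a a²≤q q<b² =
  contradiction (ℚ.≤-<-trans a²≤q (≡.subst (λ b → q ℚ.< b ℚ.* b) (lemma a η) q<b²))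
    (ℚ.<-irrefl ≡.refl)
  where
  open ℚ-solver
  lemma : ∀ a η → a ℚ.+ 0ℚ ℚ.* η ≡ a
  lemma = solve 2 (λ a η → a :+ con 0ℚ :* η := a) ≡.refl
grid-search q η (suc K) a 0≤η 0≤a a²≤q q<b² with q ℚ.<? (a ℚ.+ η) ℚ.* (a ℚ.+ η)
... | yes q<[a+η]² = a , 0≤a , a²≤q , q<[a+η]²
... | no  q≮[a+η]² =
  grid-search q η K (a ℚ.+ η) 0≤η (ℚ.+-mono-≤ 0≤a 0≤η) (ℚ.≮⇒≥ q≮[a+η]²)
    (≡.subst (λ b → q ℚ.< b ℚ.* b)
      (≡.trans (≡.cong (λ k → a ℚ.+ k ℚ.* η) ([1+n]/1 K)) (lemma a η (+ K ℚ./ 1))) q<b²)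
  where
  open ℚ-solver
  lemma : ∀ a η k → a ℚ.+ (1ℚ ℚ.+ k) ℚ.* η ≡ a ℚ.+ η ℚ.+ k ℚ.* η
  lemma = solve 3 (λ a η k → a :+ (con 1ℚ :+ k) :* η := a :+ η :+ k :* η) ≡.refl

-- Given `r² ≤ q < (r + η)²`, `r ≤ b` and `η ≤ 1`, the error `q - r²` is below
-- `η (2 r + η) ≤ η (2 b + 1) = η B`. The number `b = q + 1` exceeds the root of `q`.
approx-√ : ∀ q ε → 0ℚ ℚ.≤ q → 0ℚ ℚ.< ε →
  Σ[ r ∈ ℚ ] 0ℚ ℚ.≤ r × ℚ.∣ r ℚ.* r ℚ.- q ∣ ℚ.< ε
approx-√ q ε 0≤q 0<ε =
  let b = q ℚ.+ 1ℚ
      B = b ℚ.+ b ℚ.+ 1ℚ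
      0<b = ℚ.+-mono-≤-< 0≤q 0<1
      0<B = 0<b ⊹ 0<b ⊹ 0<1
      e , 0<e , εe≡1 = p*1/p 0<ε
      -- The step `η = 1 / (B / ε + 1)` satisfies `η B < ε` and `η ≤ 1` at once, without a minimum.
      s = B ℚ.* e ℚ.+ 1ℚ
      0<s = *-posᵠ 0<B 0<e ⊹ 0<1
      η , 0<η , sη≡1 = p*1/p 0<s
      K , sb<K = archimedean (s ℚ.* b)
      b<Kη = ≡.subst₂ ℚ._<_
        (≡.trans (lemma₁ s b η) (≡.trans (≡.cong (ℚ._* b) sη≡1) (ℚ.*-identityˡ b)))
        (≡.sym (ℚ.+-identityˡ _))
        (ℚ.*-monoˡ-<-pos η {{ℚ.positive 0<η}} (sb<K K ℕ.≤-refl))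
      q<b² = 0<⇒<ᵠ q (b ℚ.* b)
        (ℚ.+-mono-≤-< (ℚ.+-mono-≤ (*-nonNegᵠ 0≤q 0≤q) 0≤q) 0<1) (lemma₂ q)
      r , 0≤r , r²≤q , q<[r+η]² = grid-search q η K 0ℚ (ℚ.<⇒≤ 0<η) ℚ.≤-refl 0≤q
        (ℚ.<-trans q<b² (*-mono-<ᵠ (ℚ.<⇒≤ 0<b) b<Kη))
      η≤1 = ℚ.<⇒≤ (0<⇒<ᵠ η 1ℚ (*-posᵠ 0<η (*-posᵠ 0<B 0<e))
        (≡.trans (lemma₃ η (B ℚ.* e)) (≡.cong (ℚ._- η) sη≡1)))
      ηB<ε = 0<⇒<ᵠ (η ℚ.* B) ε (*-posᵠ 0<η 0<ε)
        (≡.trans (lemma₄ η ε B)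
        (≡.trans (≡.cong (λ t → η ℚ.* (B ℚ.* t ℚ.+ ε) ℚ.- η ℚ.* B) (≡.sym εe≡1))
        (≡.trans (lemma₅ η ε B e)
        (≡.trans (≡.cong (λ t → t ℚ.* ε ℚ.- η ℚ.* B) sη≡1)
                 (≡.cong (ℚ._- η ℚ.* B) (ℚ.*-identityˡ ε))))))
      r≤b = ℚ.≮⇒≥ λ b<r → ℚ.<-irrefl ≡.refl
        (ℚ.<-≤-trans (ℚ.<-trans q<b² (*-mono-<ᵠ (ℚ.<⇒≤ 0<b) b<r)) r²≤q)
      gap = ℚ.+-mono-<-≤ (<⇒0<ᵠ q<[r+η]² ⊹ <⇒0<ᵠ ηB<ε)
        (*-nonNegᵠ (ℚ.<⇒≤ 0<η) (ℚ.+-mono-≤ (ℚ.+-mono-≤ (≤⇒0≤ᵠ r≤b) (≤⇒0≤ᵠ r≤b)) (≤⇒0≤ᵠ η≤1)))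
  in r , 0≤r , 0<⇒close (r ℚ.* r) q ε
       (≡.subst (0ℚ ℚ.<_) (lemma₆ (r ℚ.* r) q ε) (ℚ.+-mono-<-≤ 0<ε (≤⇒0≤ᵠ r²≤q)))
       (≡.subst (0ℚ ℚ.<_) (lemma₇ r q η ε b) gap)
  where
  open ℚ-solver
  0<1 : 0ℚ ℚ.< 1ℚ
  0<1 = ℚ.positive⁻¹ 1ℚ
  lemma₁ : ∀ s b η → s ℚ.* b ℚ.* η ≡ s ℚ.* η ℚ.* b
  lemma₁ = solve 3 (λ s b η → s :* b :* η := s :* η :* b) ≡.refl
  lemma₂ : ∀ q → q ℚ.* q ℚ.+ q ℚ.+ 1ℚ ≡ (q ℚ.+ 1ℚ) ℚ.* (q ℚ.+ 1ℚ) ℚ.- q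
  lemma₂ = solve 1 (λ q → q :* q :+ q :+ con 1ℚ := (q :+ con 1ℚ) :* (q :+ con 1ℚ) :- q) ≡.refl
  lemma₃ : ∀ η t → η ℚ.* t ≡ (t ℚ.+ 1ℚ) ℚ.* η ℚ.- η
  lemma₃ = solve 2 (λ η t → η :* t := (t :+ con 1ℚ) :* η :- η) ≡.refl
  lemma₄ : ∀ η ε B → η ℚ.* ε ≡ η ℚ.* (B ℚ.* 1ℚ ℚ.+ ε) ℚ.- η ℚ.* B
  lemma₄ = solve 3 (λ η ε B → η :* ε := η :* (B :* con 1ℚ :+ ε) :- η :* B) ≡.refl
  lemma₅ : ∀ η ε B e → η ℚ.* (B ℚ.* (ε ℚ.* e) ℚ.+ ε) ℚ.- η ℚ.* B
                     ≡ (B ℚ.* e ℚ.+ 1ℚ) ℚ.* η ℚ.* ε ℚ.- η ℚ.* B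
  lemma₅ = solve 4 (λ η ε B e → η :* (B :* (ε :* e) :+ ε) :- η :* B
    := (B :* e :+ con 1ℚ) :* η :* ε :- η :* B) ≡.refl
  lemma₆ : ∀ r q ε → ε ℚ.+ (q ℚ.- r) ≡ ε ℚ.- (r ℚ.- q)
  lemma₆ = solve 3 (λ r q ε → ε :+ (q :- r) := ε :- (r :- q)) ≡.refl
  lemma₇ : ∀ r q η ε b →
    ((r ℚ.+ η) ℚ.* (r ℚ.+ η) ℚ.- q) ℚ.+ (ε ℚ.- η ℚ.* (b ℚ.+ b ℚ.+ 1ℚ)) ℚ.+
      η ℚ.* ((b ℚ.- r) ℚ.+ (b ℚ.- r) ℚ.+ (1ℚ ℚ.- η))
    ≡ ε ℚ.- (q ℚ.- r ℚ.* r)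
  lemma₇ = solve 5 (λ r q η ε b →
    ((r :+ η) :* (r :+ η) :- q) :+ (ε :- η :* (b :+ b :+ con 1ℚ)) :+
      η :* ((b :- r) :+ (b :- r) :+ (con 1ℚ :- η))
    := ε :- (q :- r :* r)) ≡.refl

∣p-q∣²≤∣p²-q²∣ : ∀ p q → 0ℚ ℚ.≤ p → 0ℚ ℚ.≤ q →
  ℚ.∣ p ℚ.- q ∣ ℚ.* ℚ.∣ p ℚ.- q ∣ ℚ.≤ ℚ.∣ p ℚ.* p ℚ.- q ℚ.* q ∣
∣p-q∣²≤∣p²-q²∣ p q 0≤p 0≤q = begin
  ℚ.∣ p ℚ.- q ∣ ℚ.* ℚ.∣ p ℚ.- q ∣
    ≤⟨ ℚ.*-monoˡ-≤-nonNeg ℚ.∣ p ℚ.- q ∣ {{ℚ.nonNegative (ℚ.0≤∣p∣ (p ℚ.- q))}} (ℚ.∣p-q∣≤∣p∣+∣q∣ p q) ⟩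
  ℚ.∣ p ℚ.- q ∣ ℚ.* (ℚ.∣ p ∣ ℚ.+ ℚ.∣ q ∣)
    ≡⟨ ≡.cong (ℚ.∣ p ℚ.- q ∣ ℚ.*_) (≡.cong₂ ℚ._+_ (ℚ.0≤p⇒∣p∣≡p 0≤p) (ℚ.0≤p⇒∣p∣≡p 0≤q)) ⟩
  ℚ.∣ p ℚ.- q ∣ ℚ.* (p ℚ.+ q)
    ≡⟨ ≡.cong (ℚ.∣ p ℚ.- q ∣ ℚ.*_) (ℚ.0≤p⇒∣p∣≡p (ℚ.+-mono-≤ 0≤p 0≤q)) ⟨
  ℚ.∣ p ℚ.- q ∣ ℚ.* ℚ.∣ p ℚ.+ q ∣
    ≡⟨ ℚ.∣p*q∣≡∣p∣*∣q∣ (p ℚ.- q) (p ℚ.+ q) ⟨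
  ℚ.∣ (p ℚ.- q) ℚ.* (p ℚ.+ q) ∣
    ≡⟨ ≡.cong ℚ.∣_∣ (lemma p q) ⟩
  ℚ.∣ p ℚ.* p ℚ.- q ℚ.* q ∣ ∎
  where
  open ℚ.≤-Reasoning
  open ℚ-solver using (solve; _:=_; _:*_; _:+_; _:-_)
  lemma : ∀ p q → (p ℚ.- q) ℚ.* (p ℚ.+ q) ≡ p ℚ.* p ℚ.- q ℚ.* q
  lemma = solve 2 (λ p q → (p :- q) :* (p :+ q) := p :* p :- q :* q) ≡.refl

close-trans : ∀ p q r {δ ε} → ℚ.∣ p ℚ.- q ∣ ℚ.< δ → ℚ.∣ q ℚ.- r ∣ ℚ.< ε →
  ℚ.∣ p ℚ.- r ∣ ℚ.< δ ℚ.+ ε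
close-trans p q r {δ} {ε} p~q q~r =
  ≡.subst (λ t → ℚ.∣ t ∣ ℚ.< δ ℚ.+ ε) (lemma p q r)
    (ℚ.≤-<-trans (ℚ.∣p+q∣≤∣p∣+∣q∣ (p ℚ.- q) (q ℚ.- r)) (ℚ.+-mono-< p~q q~r))
  where
  open ℚ-solver
  lemma : ∀ p q r → (p ℚ.- q) ℚ.+ (q ℚ.- r) ≡ p ℚ.- r
  lemma = solve 3 (λ p q r → (p :- q) :+ (q :- r) := p :- r) ≡.refl

opaque
  unfolding ∣_∣ _*_

  -- The absolute value gives every term of the sequence an approximate rational root, with error
  -- below `1 / (n + 1)` in the square, whatever the sign of `x`.
  √∣_∣ : ∀ x → Σ[ r ∈ ℝ ] 0ℝ ≤ r × r * r ≃ ∣ x ∣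
  √∣ x ∣ =
    mkℝ root root-cauchy ,
    mk≤ (λ ε 0<ε → 0 , λ n _ → ℚ.+-mono-≤-< (0≤root n) 0<ε) ,
    mk≃ λ ε 0<ε → eventually-map (λ n → ℚ.<-trans (root-close n)) (1/[1+n]<ε ε 0<ε)
    where
    approximation : ∀ n → Σ[ r ∈ ℚ ] 0ℚ ℚ.≤ r ×
      ℚ.∣ r ℚ.* r ℚ.- ℚ.∣ seq x n ∣ ∣ ℚ.< + 1 ℚ./ suc n
    approximation n =
      approx-√ ℚ.∣ seq x n ∣ (+ 1 ℚ./ suc n) (ℚ.0≤∣p∣ (seq x n))
        (ℚ.positive⁻¹ (+ 1 ℚ./ suc n) {{ℚ.normalize-pos 1 (suc n)}})
    root : ℕ → ℚ
    root n = proj₁ (approximation n)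
    0≤root : ∀ n → 0ℚ ℚ.≤ root n
    0≤root n = proj₁ (proj₂ (approximation n))
    root-close : ∀ n → ℚ.∣ root n ℚ.* root n ℚ.- ℚ.∣ seq x n ∣ ∣ ℚ.< + 1 ℚ./ suc n
    root-close n = proj₂ (proj₂ (approximation n))
    open ℚ-solver
    thirds : ∀ ε → ½ ℚ.* (½ ℚ.* ε) ℚ.+ (½ ℚ.* ε ℚ.+ ½ ℚ.* (½ ℚ.* ε)) ≡ ε
    thirds = solve 1 (λ ε → con ½ :* (con ½ :* ε) :+ (con ½ :* ε :+ con ½ :* (con ½ :* ε)) := ε) ≡.refl
    root-cauchy : IsCauchy root
    root-cauchy ε 0<ε =
      -- Squares closer than `ε²` have roots closer than `ε`.
      let η       = ε ℚ.* ε
          0<η     = *-posᵠ 0<ε 0<ε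
          N , fine = 1/[1+n]<ε (½ ℚ.* (½ ℚ.* η)) (½*-posᵠ (½*-posᵠ 0<η))
          M , close = abs-cauchy (seq x) (isCauchy x) (½ ℚ.* η) (½*-posᵠ 0<η)
      in N ℕ.⊔ M , λ m n N⊔M≤m N⊔M≤n →
        let near k N⊔M≤k = ℚ.<-trans (root-close k) (fine k (ℕ.m⊔n≤o⇒m≤o N M N⊔M≤k))
            squares = ≡.subst (ℚ.∣ root m ℚ.* root m ℚ.- root n ℚ.* root n ∣ ℚ.<_) (thirds η)
              (close-trans (root m ℚ.* root m) ℚ.∣ seq x m ∣ (root n ℚ.* root n)
                (near m N⊔M≤m)
                (close-trans ℚ.∣ seq x m ∣ ℚ.∣ seq x n ∣ (root n ℚ.* root n)
                  (close m n (ℕ.m⊔n≤o⇒n≤o N M N⊔M≤m) (ℕ.m⊔n≤o⇒n≤o N M N⊔M≤n))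
                  (≡.subst (ℚ._< ½ ℚ.* (½ ℚ.* η)) (∣p-q∣-comm (root n ℚ.* root n) ℚ.∣ seq x n ∣) (near n N⊔M≤n))))
        in ℚ.≰⇒> λ ε≤∣rm-rn∣ → ℚ.<-irrefl ≡.refl (ℚ.<-≤-trans
             (ℚ.≤-<-trans (∣p-q∣²≤∣p²-q²∣ (root m) (root n) (0≤root m) (0≤root n)) squares)
             (ℚ.≤-trans
               (ℚ.*-monoˡ-≤-nonNeg ε {{ℚ.nonNegative (ℚ.<⇒≤ 0<ε)}} ε≤∣rm-rn∣)
               (ℚ.*-monoʳ-≤-nonNeg ℚ.∣ root m ℚ.- root n ∣ {{ℚ.nonNegative (ℚ.0≤∣p∣ (root m ℚ.- root n))}} ε≤∣rm-rn∣)))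

-- Both `∣ x ∣` and `x` are nonnegative, and their squares agree, so the root of one is a root of
-- the other.
√ : ∀ {x} → 0ℝ ≤ x → Σ[ r ∈ ℝ ] 0ℝ ≤ r × r * r ≃ x
√ {x} 0≤x with √∣ x ∣
... | r , 0≤r , r²≃∣x∣ =
  r , 0≤r , ≃-trans r²≃∣x∣ (x*x≃y*y⇒x≃y (0≤∣x∣ x) 0≤x (∣x∣*∣x∣≃x*x x))

fromℕ-suc : ∀ n → fromℕ (suc n) ≃ 1ℝ + fromℕ n
fromℕ-suc n = ≃-trans (pointwise λ _ → [1+n]/1 n) (fromℚ-+ 1ℚ (+ n ℚ./ 1))

fromℕ*1/n : ∀ n → fromℕ (suc n) * fromℚ (+ 1 ℚ./ suc n) ≃ 1ℝ
fromℕ*1/n n = ≃-trans (≃-sym (fromℚ-* (+ suc n ℚ./ 1) (+ 1 ℚ./ suc n)))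
  (pointwise λ _ → [1+n]/1*1/[1+n] n)

-- Determinants

≡⇒≃ : ∀ {x y : ℝ} → x ≡ y → x ≃ y
≡⇒≃ ≡.refl = ≃-refl

infix 4 _≈_ _≈ᴹ_

_≈_ : ∀ {n} → Vector ℝ n → Vector ℝ n → Set
u ≈ v = ∀ j → u j ≃ v j

_≈ᴹ_ : ∀ {k n} → Vector (Vector ℝ n) k → Vector (Vector ℝ n) k → Set
A ≈ᴹ B = ∀ i → A i ≈ B i

head∷tail : ∀ {k n} (A : Vector (Vector ℝ n) (suc k)) → (head A ∷ tail A) ≈ᴹ A
head∷tail A zero    j = ≃-refl
head∷tail A (suc i) j = ≃-refl

I-refl : ∀ {n} (i : Fin n) → I n i i ≃ 1ℝ
I-refl i with i Fin.≟ i
... | yes _  = ≃-refl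
... | no i≢i = contradiction ≡.refl i≢i

I-≢ : ∀ {n} {i j : Fin n} → i ≢ j → I n i j ≃ 0ℝ
I-≢ {i = i} {j} i≢j with i Fin.≟ j
... | yes i≡j = contradiction i≡j i≢j
... | no _    = ≃-refl

I-suc : ∀ {n} (i j : Fin n) → I (suc n) (suc i) (suc j) ≃ I n i j
I-suc {n} i j = by-dec (i Fin.≟ j)
  where
  by-dec : Dec (i ≡ j) → I (suc n) (suc i) (suc j) ≃ I n i j
  by-dec (yes ≡.refl) = ≃-trans (I-refl (suc i)) (≃-sym (I-refl i))
  by-dec (no i≢j)     = ≃-trans (I-≢ (i≢j ∘ Fin.suc-injective)) (≃-sym (I-≢ i≢j))

I-sym : ∀ {n} (i j : Fin n) → I n i j ≃ I n j i
I-sym {n} i j = by-dec (i Fin.≟ j)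
  where
  by-dec : Dec (i ≡ j) → I n i j ≃ I n j i
  by-dec (yes ≡.refl) = ≃-refl
  by-dec (no i≢j)     = ≃-trans (I-≢ i≢j) (≃-sym (I-≢ (i≢j ∘ ≡.sym)))

sum-zero : ∀ {n} {x : Vector ℝ n} → (∀ j → x j ≃ 0ℝ) → sum x ≃ 0ℝ
sum-zero {n} x≃0 = ≃-trans (sum-cong x≃0) (sum-replicate-zero n)

sum-I : ∀ {n} (i : Fin n) (x : Vector ℝ n) → sum (λ j → I n i j * x j) ≃ x i
sum-I {suc n} zero x = begin
  I (suc n) zero zero * x zero + sum (λ j → 0ℝ * x (suc j))
    ≈⟨ +-cong (*-cong (I-refl {suc n} zero) ≃-refl) (sum-zero λ j → *-zeroˡ (x (suc j))) ⟩
  1ℝ * x zero + 0ℝ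
    ≈⟨ ≃-trans (+-identityʳ _) (*-identityˡ _) ⟩
  x zero ∎
  where open ≃-Reasoning
sum-I {suc n} (suc i) x = begin
  0ℝ * x zero + sum (λ j → I (suc n) (suc i) (suc j) * x (suc j))
    ≈⟨ +-cong (*-zeroˡ _) (sum-cong λ j → *-cong (I-suc i j) ≃-refl) ⟩
  0ℝ + sum (λ j → I n i j * x (suc j))
    ≈⟨ ≃-trans (+-identityˡ _) (sum-I i (x ∘ suc)) ⟩
  x (suc i) ∎
  where open ≃-Reasoning

-- Alternating multilinear functions of the rows

data Adjacent : ∀ {n} → Fin n → Fin n → Set where
  here  : ∀ {n} → Adjacent {suc (suc n)} zero (suc zero)
  there : ∀ {n} {a b : Fin n} → Adjacent a b → Adjacent (suc a) (suc b)

record Swapped {k n} (a b : Fin k) (A B : Vector (Vector ℝ n) k) : Set where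
  constructor swapped
  field
    a↦b   : A a ≈ B b
    b↦a   : A b ≈ B a
    fixed : ∀ i → i ≢ a → i ≢ b → A i ≈ B i

-- A relation between three matrices rather than an update of one: an updated row would compute only
-- after an equality of indices has been decided.
record Combined {k n} (i : Fin k) (c : ℝ) (A B C : Vector (Vector ℝ n) k) : Set where
  constructor combined
  field
    at    : ∀ j → C i j ≃ c * A i j + B i j
    off₁  : ∀ l → l ≢ i → C l ≈ A l
    off₂  : ∀ l → l ≢ i → C l ≈ B l

-- The number of rows is independent of their length, because fixing the first row changes only the
-- former and inserting a zero column only the latter.
record Alternating {k n} (f : Vector (Vector ℝ n) k → ℝ) : Set where
  field
    resp   : ∀ {A B} → A ≈ᴹ B → f A ≃ f B
    linear : ∀ i c {A B C} → Combined i c A B C → f C ≃ c * f A + f B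
    swap   : ∀ {a b} → Adjacent a b → ∀ {A B} → Swapped a b A B → f A ≃ - f B

open Alternating

private
  x≃-x⇒x≃0 : ∀ {x} → x ≃ - x → x ≃ 0ℝ
  x≃-x⇒x≃0 {x} x≃-x = ≃-trans (lemma₁ x) (≃-trans (*-congˡ (fromℚ ½) (+-congˡ x x≃-x)) (lemma₂ x))
    where
    open ℝ-solver
    lemma₁ : ∀ x → x ≃ fromℚ ½ * (x + x)
    lemma₁ = solve 1 (λ x → x := con ½ :* (x :+ x)) ≃-refl
    lemma₂ : ∀ x → fromℚ ½ * (x - x) ≃ 0ℝ
    lemma₂ = solve 1 (λ x → con ½ :* (x :- x) := con 0ℚ) ≃-refl

  x≃x+x⇒x≃0 : ∀ {x} → x ≃ x + x → x ≃ 0ℝ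
  x≃x+x⇒x≃0 {x} x≃x+x = ≃-trans (lemma₁ x) (≃-trans (+-cong (≃-sym x≃x+x) ≃-refl) (lemma₂ x))
    where
    open ℝ-solver
    lemma₁ : ∀ x → x ≃ x + x - x
    lemma₁ = solve 1 (λ x → x := x :+ x :- x) ≃-refl
    lemma₂ : ∀ x → x - x ≃ 0ℝ
    lemma₂ = solve 1 (λ x → x :- x := con 0ℚ) ≃-refl

  -1*x≃-x : ∀ x → - 1ℝ * x ≃ - x
  -1*x≃-x = solve 1 (λ x → :- con 1ℚ :* x := :- x) ≃-refl
    where open ℝ-solver

tail-alternating : ∀ {k n} {f : Vector (Vector ℝ n) (suc k) → ℝ} → Alternating f →
  ∀ v → Alternating λ A → f (v ∷ A)
tail-alternating alt v .resp A≈B =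
  resp alt λ { zero _ → ≃-refl ; (suc i) → A≈B i }
tail-alternating alt v .linear i c (combined at off₁ off₂) = linear alt (suc i) c
  (combined at
    (λ { zero _ _ → ≃-refl ; (suc l) l≢i → off₁ l (l≢i ∘ ≡.cong suc) })
    (λ { zero _ _ → ≃-refl ; (suc l) l≢i → off₂ l (l≢i ∘ ≡.cong suc) }))
tail-alternating alt v .swap adj (swapped a↦b b↦a fixed) = swap alt (there adj)
  (swapped a↦b b↦a λ { zero _ _ _ → ≃-refl
                     ; (suc i) i≢a i≢b → fixed i (i≢a ∘ ≡.cong suc) (i≢b ∘ ≡.cong suc) })

-- Row `j` passes the `j` rows above it, with one sign change each.
move-to-front : ∀ {k n} {f : Vector (Vector ℝ n) (suc k) → ℝ} → Alternating f →
  ∀ j A → f (A j ∷ A ∘ punchIn j) ≃ (- 1ℝ) ^ toℕ j * f A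
move-to-front {f = f} alt zero A =
  ≃-trans (resp alt (head∷tail A)) (≃-sym (*-identityˡ (f A)))
move-to-front {suc k} {f = f} alt (suc j) A = begin
  f (A (suc j) ∷ A ∘ punchIn (suc j))
    ≈⟨ swap alt here (swapped (λ _ → ≃-refl) (λ _ → ≃-refl)
         λ { zero 0≢0 _ → contradiction ≡.refl 0≢0
           ; (suc zero) _ 1≢1 → contradiction ≡.refl 1≢1
           ; (suc (suc i)) _ _ _ → ≃-refl }) ⟩
  - f (A zero ∷ A (suc j) ∷ A ∘ suc ∘ punchIn j)
    ≈⟨ -‿cong (move-to-front (tail-alternating alt (A zero)) j (A ∘ suc)) ⟩
  - ((- 1ℝ) ^ toℕ j * f (A zero ∷ A ∘ suc))
    ≈⟨ -‿cong (*-congˡ _ (resp alt (head∷tail A))) ⟩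
  - ((- 1ℝ) ^ toℕ j * f A)
    ≈⟨ -1*x≃-x _ ⟨
  - 1ℝ * ((- 1ℝ) ^ toℕ j * f A)
    ≈⟨ *-assoc _ _ _ ⟨
  - 1ℝ * (- 1ℝ) ^ toℕ j * f A ∎
  where open ≃-Reasoning

sign²≃1 : ∀ n → (- 1ℝ) ^ n * (- 1ℝ) ^ n ≃ 1ℝ
sign²≃1 zero    = *-identityˡ 1ℝ
sign²≃1 (suc n) = ≃-trans (lemma ((- 1ℝ) ^ n)) (sign²≃1 n)
  where
  open ℝ-solver
  lemma : ∀ x → (- 1ℝ * x) * (- 1ℝ * x) ≃ x * x
  lemma = solve 1 (λ x → (:- con 1ℚ :* x) :* (:- con 1ℚ :* x) := x :* x) ≃-refl

-- Once the equal rows are next to each other, exchanging them changes nothing, so the value is its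
-- own negative. `σ * σ ≃ 1ℝ` carries this back to `A`.
vanish : ∀ {k n} {f : Vector (Vector ℝ n) (suc k) → ℝ} → Alternating f →
  ∀ i {A} → A zero ≈ A (suc i) → f A ≃ 0ℝ
vanish {suc k} {f = f} alt i {A} A₀≈Aᵢ = begin
  f A                       ≈⟨ *-identityˡ _ ⟨
  1ℝ * f A                  ≈⟨ *-cong (sign²≃1 (toℕ (suc i))) ≃-refl ⟨
  (σ * σ) * f A             ≈⟨ *-assoc _ _ _ ⟩
  σ * (σ * f A)             ≈⟨ *-congˡ σ (move-to-front alt (suc i) A) ⟨
  σ * f A′                  ≈⟨ *-congˡ σ f[A′]≃0 ⟩
  σ * 0ℝ                    ≈⟨ *-zeroʳ σ ⟩
  0ℝ                        ∎
  where
  open ≃-Reasoning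
  σ = (- 1ℝ) ^ toℕ (suc i)
  A′ = A (suc i) ∷ A ∘ punchIn (suc i)
  f[A′]≃0 : f A′ ≃ 0ℝ
  f[A′]≃0 = x≃-x⇒x≃0 (swap alt here (swapped (λ j → ≃-sym (A₀≈Aᵢ j)) A₀≈Aᵢ
    λ { zero 0≢0 _ → contradiction ≡.refl 0≢0
      ; (suc zero) _ 1≢1 → contradiction ≡.refl 1≢1
      ; (suc (suc _)) _ _ _ → ≃-refl }))

-- By linearity in row `i`, the difference is `c` times a value at which `v` occurs twice.
add-to-row : ∀ {k n} {f : Vector (Vector ℝ n) (suc k) → ℝ} → Alternating f →
  ∀ v i c {A B} → (∀ j → B i j ≃ c * v j + A i j) → (∀ l → l ≢ i → B l ≈ A l) →
  f (v ∷ B) ≃ f (v ∷ A)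
add-to-row {f = f} alt v i c {A} {B} at off = begin
  f (v ∷ B)
    ≈⟨ linear alt (suc i) c {v ∷ V} {v ∷ A} {v ∷ B} (combined
         (λ j → ≃-trans (at j) (+-cong (*-congˡ c (≡⇒≃ (≡.cong (λ u → u j) (≡.sym Vᵢ≡v)))) ≃-refl))
         (λ { zero _ _ → ≃-refl ; (suc l) l≢i j → ≡⇒≃ (≡.cong (λ u → u j) (≡.sym (V-≢ (l≢i ∘ ≡.cong suc)))) })
         (λ { zero _ _ → ≃-refl ; (suc l) l≢i → off l (l≢i ∘ ≡.cong suc) })) ⟩
  c * f (v ∷ V) + f (v ∷ A)
    ≈⟨ +-cong (*-congˡ c (vanish alt i λ j → ≡⇒≃ (≡.cong (λ u → u j) (≡.sym Vᵢ≡v)))) ≃-refl ⟩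
  c * 0ℝ + f (v ∷ A)
    ≈⟨ ≃-trans (+-cong (*-zeroʳ c) ≃-refl) (+-identityˡ _) ⟩
  f (v ∷ A) ∎
  where
  open ≃-Reasoning
  choose : ∀ {l} → Dec (l ≡ i) → Vector ℝ _
  choose         (yes _) = v
  choose {l = l} (no _)  = B l
  V : Vector (Vector ℝ _) _
  V l = choose (l Fin.≟ i)
  Vᵢ≡v : V i ≡ v
  Vᵢ≡v with i Fin.≟ i
  ... | yes _  = ≡.refl
  ... | no i≢i = contradiction ≡.refl i≢i
  V-≢ : ∀ {l} → l ≢ i → V l ≡ B l
  V-≢ {l} l≢i with l Fin.≟ i
  ... | yes l≡i = contradiction l≡i l≢i
  ... | no _    = ≡.refl

-- Stated for any `h` that is invariant under single additions: the induction fixes the first row of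
-- `B`, after which the function no longer has `e` directly in front of its argument.
add-to-rows : ∀ {k n} (e : Vector ℝ n) (h : Vector (Vector ℝ n) k → ℝ) →
  (∀ i c {A B} → (∀ j → B i j ≃ c * e j + A i j) → (∀ l → l ≢ i → B l ≈ A l) → h B ≃ h A) →
  (∀ {A B} → A ≈ᴹ B → h A ≃ h B) →
  ∀ (c : Vector ℝ k) {A B} → (∀ i j → B i j ≃ c i * e j + A i j) → h B ≃ h A
add-to-rows {zero}  e h add resp c at = resp λ ()
add-to-rows {suc k} e h add resp c {A} {B} at = begin
  h B
    ≈⟨ resp (head∷tail B) ⟨
  h (B zero ∷ tail B)
    ≈⟨ add-to-rows e (λ A → h (B zero ∷ A))
         (λ i c at off → add (suc i) c at
           λ { zero _ _ → ≃-refl ; (suc l) l≢i → off l (l≢i ∘ ≡.cong suc) })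
         (λ A≈B → resp λ { zero _ → ≃-refl ; (suc i) → A≈B i })
         (c ∘ suc) (at ∘ suc) ⟩
  h (B zero ∷ tail A)
    ≈⟨ add zero (c zero) (at zero)
         (λ { zero 0≢0 → contradiction ≡.refl 0≢0 ; (suc l) _ _ → ≃-refl }) ⟩
  h A ∎
  where open ≃-Reasoning

-- Uniqueness of alternating functions

insert0 : ∀ {n} → Fin (suc n) → Vector ℝ n → Vector ℝ (suc n)
insert0 j v = insertAt v j 0ℝ

at-or-punchIn : ∀ {n} (j : Fin (suc n)) (P : Fin (suc n) → Set) →
  P j → (∀ k → P (punchIn j k)) → ∀ l → P l
at-or-punchIn j P Pj Pin l with j Fin.≟ l
... | yes ≡.refl = Pj
... | no j≢l     = ≡.subst P (Fin.punchIn-punchOut j≢l) (Pin (punchOut j≢l))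

insert0-at : ∀ {n} j (v : Vector ℝ n) → insert0 j v j ≃ 0ℝ
insert0-at j v = ≡⇒≃ (insertAt-lookup v j 0ℝ)

insert0-punchIn : ∀ {n} j (v : Vector ℝ n) k → insert0 j v (punchIn j k) ≃ v k
insert0-punchIn j v k = ≡⇒≃ (insertAt-punchIn v j 0ℝ k)

insert0-resp : ∀ {n} j {u v : Vector ℝ n} → u ≈ v → insert0 j u ≈ insert0 j v
insert0-resp j {u} {v} u≈v = at-or-punchIn j (λ l → insert0 j u l ≃ insert0 j v l)
  (≃-trans (insert0-at j u) (≃-sym (insert0-at j v)))
  (λ k → ≃-trans (insert0-punchIn j u k) (≃-trans (u≈v k) (≃-sym (insert0-punchIn j v k))))

insert0-linear : ∀ {n} j c {u v w : Vector ℝ n} → (∀ k → w k ≃ c * u k + v k) →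
  ∀ l → insert0 j w l ≃ c * insert0 j u l + insert0 j v l
insert0-linear j c {u} {v} {w} w≈cu+v =
  at-or-punchIn j (λ l → insert0 j w l ≃ c * insert0 j u l + insert0 j v l)
    (begin
      insert0 j w j                     ≈⟨ insert0-at j w ⟩
      0ℝ                                ≈⟨ ≃-trans (+-identityʳ _) (*-zeroʳ c) ⟨
      c * 0ℝ + 0ℝ                       ≈⟨ +-cong (*-congˡ c (insert0-at j u)) (insert0-at j v) ⟨
      c * insert0 j u j + insert0 j v j ∎)
    (λ k → begin
      insert0 j w (punchIn j k)         ≈⟨ insert0-punchIn j w k ⟩
      w k                               ≈⟨ w≈cu+v k ⟩
      c * u k + v k                     ≈⟨ +-cong (*-congˡ c (insert0-punchIn j u k)) (insert0-punchIn j v k) ⟨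
      c * insert0 j u (punchIn j k) + insert0 j v (punchIn j k) ∎)
  where open ≃-Reasoning

insert0-I : ∀ {n} j (i : Fin n) → insert0 j (I n i) ≈ I (suc n) (punchIn j i)
insert0-I {n} j i = at-or-punchIn j (λ l → insert0 j (I n i) l ≃ I (suc n) (punchIn j i) l)
  (≃-trans (insert0-at j _) (≃-sym (I-≢ (Fin.punchInᵢ≢i j i))))
  (λ k → ≃-trans (insert0-punchIn j _ k) (I-punchIn k (i Fin.≟ k)))
  where
  I-punchIn : ∀ k → Dec (i ≡ k) → I n i k ≃ I (suc n) (punchIn j i) (punchIn j k)
  I-punchIn k (yes ≡.refl) = ≃-trans (I-refl i) (≃-sym (I-refl (punchIn j i)))
  I-punchIn k (no i≢k)     = ≃-trans (I-≢ i≢k) (≃-sym (I-≢ (i≢k ∘ Fin.punchIn-injective j i k)))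

-- Restricts `f` to matrices whose column `j` vanishes, where it is a function of the remaining
-- columns. This is the passage from a matrix to its minor.
insert0-alternating : ∀ {k n} {f : Vector (Vector ℝ (suc n)) k → ℝ} → Alternating f →
  ∀ j → Alternating λ A → f (insert0 j ∘ A)
insert0-alternating alt j .resp A≈B = resp alt λ i → insert0-resp j (A≈B i)
insert0-alternating alt j .linear i c (combined at off₁ off₂) = linear alt i c (combined
  (insert0-linear j c at)
  (λ l l≢i → insert0-resp j (off₁ l l≢i)) (λ l l≢i → insert0-resp j (off₂ l l≢i)))
insert0-alternating alt j .swap adj (swapped a↦b b↦a fixed) = swap alt adj (swapped
  (insert0-resp j a↦b) (insert0-resp j b↦a) λ i i≢a i≢b → insert0-resp j (fixed i i≢a i≢b))

expand : ∀ {n} (g : Vector ℝ n → ℝ) → (∀ {u v} → u ≈ v → g u ≃ g v) →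
  (∀ c {u v w} → (∀ k → w k ≃ c * u k + v k) → g w ≃ c * g u + g v) →
  ∀ v → g v ≃ sum λ j → v j * g (I n j)
-- A vector without entries satisfies `v = 1 v + v`, so `g v` is its own double.
expand {zero} g resp linear v = x≃x+x⇒x≃0
  (≃-trans (linear 1ℝ {v} {v} λ ()) (+-cong (*-identityˡ (g v)) ≃-refl))
expand {suc n} g resp linear v = begin
  g v
    ≈⟨ linear (v zero) {I (suc n) zero} {0ℝ ∷ tail v} (λ
         { zero    → ≃-sym (≃-trans (+-identityʳ _) (≃-trans (*-congˡ _ (I-refl {suc n} zero))
                       (≃-trans (*-comm _ _) (*-identityˡ _))))
         ; (suc k) → ≃-sym (≃-trans (+-cong (*-zeroʳ _) ≃-refl) (+-identityˡ _)) }) ⟩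
  v zero * g (I (suc n) zero) + g (0ℝ ∷ tail v)
    ≈⟨ +-congˡ _ (expand (λ w → g (0ℝ ∷ w))
         (λ u≈v → resp λ { zero → ≃-refl ; (suc j) → u≈v j })
         (λ c at → linear c λ
           { zero → ≃-sym (≃-trans (+-identityʳ _) (*-zeroʳ c)) ; (suc j) → at j })
         (tail v)) ⟩
  v zero * g (I (suc n) zero) + sum (λ j → v (suc j) * g (0ℝ ∷ I n j))
    ≈⟨ +-congˡ _ (sum-cong λ j → *-congˡ (v (suc j)) (resp λ
         { zero → ≃-refl ; (suc k) → ≃-sym (I-suc j k) })) ⟩
  sum (λ j → v j * g (I (suc n) j)) ∎
  where open ≃-Reasoning

minor : ∀ {n} → Fin (suc n) → Matrix (suc n) → Matrix n
minor j A i k = A (suc i) (punchIn j k)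

-- Linearity reduces the first row to unit vectors. Below a unit vector, column `j` can be cleared
-- by row additions, and what remains alternates in the rows of the minor. Only the recursion of
-- `det` is used, not that `det` alternates, so this may serve to prove properties of `det` by
-- evaluating a suitable `f` at the identity.
alternating⇒det : ∀ {n} {f : Matrix n → ℝ} → Alternating f → ∀ A → f A ≃ f (I n) * det A
alternating⇒det {zero} {f} alt A =
  ≃-trans (resp alt λ ()) (≃-sym (≃-trans (*-comm _ _) (*-identityˡ (f (I 0)))))
alternating⇒det {suc n} {f} alt A = begin
  f A
    ≈⟨ resp alt (head∷tail A) ⟨
  f (A zero ∷ tail A)
    ≈⟨ expand (λ v → f (v ∷ tail A))
         (λ u≈v → resp alt λ { zero → u≈v ; (suc i) _ → ≃-refl })
         (λ c at → linear alt zero c (combined at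
           (λ { zero 0≢0 → contradiction ≡.refl 0≢0 ; (suc l) _ _ → ≃-refl })
           (λ { zero 0≢0 → contradiction ≡.refl 0≢0 ; (suc l) _ _ → ≃-refl })))
         (A zero) ⟩
  sum (λ j → A zero j * f (I (suc n) j ∷ tail A))
    -- Subtracting `A (suc i) j` times the unit vector leaves the row of the minor with a zero
    -- inserted.
    ≈⟨ sum-cong (λ j → *-congˡ (A zero j) (clear j)) ⟩
  sum (λ j → A zero j * f (I (suc n) j ∷ insert0 j ∘ minor j A))
    ≈⟨ sum-cong (λ j → *-congˡ (A zero j)
         (alternating⇒det (insert0-alternating (tail-alternating alt (I (suc n) j)) j) (minor j A))) ⟩
  sum (λ j → A zero j * (f (I (suc n) j ∷ insert0 j ∘ I n) * det (minor j A)))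
    -- These rows are the identity with its row `j` moved to the front, which is the origin of the
    -- sign.
    ≈⟨ sum-cong (λ j → *-congˡ (A zero j) (*-cong (corner j) (≃-refl {det (minor j A)}))) ⟩
  sum (λ j → A zero j * ((- 1ℝ) ^ toℕ j * f (I (suc n)) * det (minor j A)))
    ≈⟨ sum-cong (λ j → rearrange (A zero j) ((- 1ℝ) ^ toℕ j) (f (I (suc n))) (det (minor j A))) ⟩
  sum (λ j → f (I (suc n)) * ((- 1ℝ) ^ toℕ j * (A zero j * det (minor j A))))
    ≈⟨ *-distribˡ-sum (f (I (suc n))) (λ j → (- 1ℝ) ^ toℕ j * (A zero j * det (minor j A))) ⟨
  f (I (suc n)) * det A ∎
  where
  open ≃-Reasoning
  rearrange : ∀ a s f d → a * (s * f * d) ≃ f * (s * (a * d))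
  rearrange = solve 4 (λ a s f d → a :* (s :* f :* d) := f :* (s :* (a :* d))) ≃-refl
    where open ℝ-solver
  clear : ∀ j → f (I (suc n) j ∷ tail A) ≃ f (I (suc n) j ∷ insert0 j ∘ minor j A)
  clear j = add-to-rows (I (suc n) j) (λ B → f (I (suc n) j ∷ B))
    (add-to-row alt (I (suc n) j))
    (resp (tail-alternating alt (I (suc n) j)))
    (λ i → A (suc i) j)
    λ i → at-or-punchIn j
      (λ l → A (suc i) l ≃ A (suc i) j * I (suc n) j l + insert0 j (minor j A i) l)
      (begin
        A (suc i) j                        ≈⟨ ≃-trans (*-comm _ _) (*-identityˡ _) ⟨
        A (suc i) j * 1ℝ                   ≈⟨ *-congˡ _ (I-refl j) ⟨
        A (suc i) j * I (suc n) j j        ≈⟨ +-identityʳ _ ⟨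
        A (suc i) j * I (suc n) j j + 0ℝ   ≈⟨ +-congˡ _ (insert0-at j _) ⟨
        A (suc i) j * I (suc n) j j + insert0 j (minor j A i) j ∎)
      (λ k → begin
        A (suc i) (punchIn j k)            ≈⟨ insert0-punchIn j _ k ⟨
        insert0 j (minor j A i) (punchIn j k)
          ≈⟨ ≃-trans (+-cong (*-zeroʳ (A (suc i) j)) ≃-refl) (+-identityˡ _) ⟨
        A (suc i) j * 0ℝ + insert0 j (minor j A i) (punchIn j k)
          ≈⟨ +-cong (*-congˡ _ (I-≢ (Fin.punchInᵢ≢i j k ∘ ≡.sym))) ≃-refl ⟨
        A (suc i) j * I (suc n) j (punchIn j k) + insert0 j (minor j A i) (punchIn j k) ∎)
  corner : ∀ j → f (I (suc n) j ∷ insert0 j ∘ I n) ≃ (- 1ℝ) ^ toℕ j * f (I (suc n))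
  corner j = ≃-trans
    (resp alt λ { zero _ → ≃-refl ; (suc i) → insert0-I j i })
    (move-to-front alt j (I (suc n)))

-- The determinant under transposition and products

sum-swap : ∀ {n} {a b : Fin n} → Adjacent a b → ∀ {x y : Vector ℝ n} →
  x a ≃ y b → x b ≃ y a → (∀ i → i ≢ a → i ≢ b → x i ≃ y i) → sum x ≃ sum y
sum-swap here {x} {y} a↦b b↦a fixed = ≃-trans
  (+-cong a↦b (+-cong b↦a (sum-cong λ i → fixed (suc (suc i)) (λ ()) (λ ()))))
  (x+[y+z]≃y+[x+z] (y (suc zero)) (y zero) _)
sum-swap (there adj) a↦b b↦a fixed =
  +-cong (fixed zero (λ ()) (λ ())) (sum-swap adj a↦b b↦a λ i i≢a i≢b →
    fixed (suc i) (i≢a ∘ Fin.suc-injective) (i≢b ∘ Fin.suc-injective))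

adjacent-sign : ∀ {n} {a b : Fin n} → Adjacent a b → (- 1ℝ) ^ toℕ b ≃ - (- 1ℝ) ^ toℕ a
adjacent-sign here = -1*x≃-x 1ℝ
adjacent-sign {a = suc a} {suc b} (there adj) = ≃-trans (*-congˡ (- 1ℝ) (adjacent-sign adj))
  (lemma ((- 1ℝ) ^ toℕ a))
  where
  open ℝ-solver
  lemma : ∀ x → - 1ℝ * - x ≃ - (- 1ℝ * x)
  lemma = solve 1 (λ x → :- con 1ℚ :* :- x := :- (:- con 1ℚ :* x)) ≃-refl

-- Whether `a` or its neighbour `b` is skipped matters only at the one position taken by the other.
-- So exchanging rows `a` and `b` exchanges the minors that omit them.
punchIn-swap : ∀ {n} {a b : Fin (suc n)} → Adjacent a b → ∀ i →
  (punchIn a i ≡ b × punchIn b i ≡ a) ⊎ punchIn a i ≡ punchIn b i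
punchIn-swap here zero    = inj₁ (≡.refl , ≡.refl)
punchIn-swap here (suc i) = inj₂ ≡.refl
punchIn-swap (there adj) zero = inj₂ ≡.refl
punchIn-swap (there adj) (suc i) with punchIn-swap adj i
... | inj₁ (p , q) = inj₁ (≡.cong suc p , ≡.cong suc q)
... | inj₂ p       = inj₂ (≡.cong suc p)

-- No index lies between `a` and `b`, so they remain neighbours when a third one is removed. This
-- lets the exchange of neighbours be pushed into a minor.
punchIn-adjacent : ∀ {n} {a b : Fin (suc n)} → Adjacent a b → ∀ j → j ≢ a → j ≢ b →
  Σ[ a′ ∈ Fin n ] Σ[ b′ ∈ Fin n ] Adjacent a′ b′ × punchIn j a′ ≡ a × punchIn j b′ ≡ b
punchIn-adjacent here zero 0≢0 _ = contradiction ≡.refl 0≢0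
punchIn-adjacent here (suc zero) _ 1≢1 = contradiction ≡.refl 1≢1
punchIn-adjacent {suc (suc n)} here (suc (suc j)) _ _ = zero , suc zero , here , ≡.refl , ≡.refl
punchIn-adjacent (there {a = a} {b} adj) zero _ _ = a , b , adj , ≡.refl , ≡.refl
punchIn-adjacent {suc n} (there adj) (suc j) j≢a j≢b
  with punchIn-adjacent adj j (j≢a ∘ ≡.cong suc) (j≢b ∘ ≡.cong suc)
... | a′ , b′ , adj′ , p , q = suc a′ , suc b′ , there adj′ , ≡.cong suc p , ≡.cong suc q

det-cong : ∀ {n} {A B : Matrix n} → A ≋ B → det A ≃ det B
det-cong {zero}  A≋B = ≃-refl
det-cong {suc n} A≋B = sum-cong λ j → *-congˡ ((- 1ℝ) ^ toℕ j) (*-cong (A≋B zero j)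
  (det-cong λ i k → A≋B (suc i) (punchIn j k)))

-- The first-row expansion of `A ᵀ` is the expansion of `A` along its first column; its minors are
-- the transposes of these.
row-minor : ∀ {k n} → Fin (suc k) → Vector (Vector ℝ (suc n)) (suc k) → Vector (Vector ℝ n) k
row-minor j A i k = A (punchIn j i) (suc k)

-- Expanding along the first row shows that det alternates in the columns; that it
-- alternates in the rows as well then follows from alternating⇒det, see det-ᵀ.

det∘ᵀ-alternating : ∀ {n} → Alternating λ (A : Matrix n) → det (A ᵀ)
det∘ᵀ-alternating .resp A≈B = det-cong λ i j → A≈B j i
det∘ᵀ-alternating {suc n} .linear i c {A} {B} {C} (combined at off₁ off₂) = begin
  det (C ᵀ)
    ≈⟨ sum-cong term ⟩
  sum (λ j → c * T A j + T B j)
    ≈⟨ ∑-distrib-+ (λ j → c * T A j) (T B) ⟩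
  sum (λ j → c * T A j) + sum (T B)
    ≈⟨ +-cong (*-distribˡ-sum c (T A)) ≃-refl ⟨
  c * det (A ᵀ) + det (B ᵀ) ∎
  where
  open ≃-Reasoning
  T : Matrix (suc n) → Fin (suc n) → ℝ
  T A j = (- 1ℝ) ^ toℕ j * (A j zero * det (row-minor j A ᵀ))
  lemma₁ : ∀ s c a b d → s * ((c * a + b) * d) ≃ c * (s * (a * d)) + s * (b * d)
  lemma₁ = solve 5 (λ s c a b d →
    s :* ((c :* a :+ b) :* d) := c :* (s :* (a :* d)) :+ s :* (b :* d)) ≃-refl
    where open ℝ-solver
  lemma₂ : ∀ s c a d e → s * (a * (c * d + e)) ≃ c * (s * (a * d)) + s * (a * e)
  lemma₂ = solve 5 (λ s c a d e →
    s :* (a :* (c :* d :+ e)) := c :* (s :* (a :* d)) :+ s :* (a :* e)) ≃-refl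
    where open ℝ-solver
  term : ∀ j → T C j ≃ c * T A j + T B j
  -- If row `i` is the removed one, linearity shows in the coefficient; otherwise the row survives
  -- in the minor, where the induction applies.
  term j with j Fin.≟ i
  ... | yes ≡.refl = begin
    T C j
      ≈⟨ *-congˡ _ (*-cong (at zero) ≃-refl) ⟩
    (- 1ℝ) ^ toℕ j * ((c * A j zero + B j zero) * det (row-minor j C ᵀ))
      ≈⟨ lemma₁ ((- 1ℝ) ^ toℕ j) c (A j zero) (B j zero) (det (row-minor j C ᵀ)) ⟩
    c * ((- 1ℝ) ^ toℕ j * (A j zero * det (row-minor j C ᵀ))) +
      (- 1ℝ) ^ toℕ j * (B j zero * det (row-minor j C ᵀ))
      ≈⟨ +-cong
           (*-congˡ c (*-congˡ _ (*-congˡ (A j zero)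
             (det-cong λ k l → off₁ (punchIn j l) (Fin.punchInᵢ≢i j l) (suc k)))))
           (*-congˡ _ (*-congˡ (B j zero)
             (det-cong λ k l → off₂ (punchIn j l) (Fin.punchInᵢ≢i j l) (suc k)))) ⟩
    c * T A j + T B j ∎
  ... | no j≢i = begin
    T C j
      ≈⟨ *-congˡ _ (*-congˡ (C j zero) (linear det∘ᵀ-alternating i′ c (combined at′ off₁′ off₂′))) ⟩
    (- 1ℝ) ^ toℕ j * (C j zero * (c * det (row-minor j A ᵀ) + det (row-minor j B ᵀ)))
      ≈⟨ lemma₂ ((- 1ℝ) ^ toℕ j) c (C j zero) (det (row-minor j A ᵀ)) (det (row-minor j B ᵀ)) ⟩
    c * ((- 1ℝ) ^ toℕ j * (C j zero * det (row-minor j A ᵀ))) +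
      (- 1ℝ) ^ toℕ j * (C j zero * det (row-minor j B ᵀ))
      ≈⟨ +-cong
           (*-congˡ c (*-congˡ _ (*-cong (off₁ j j≢i zero) ≃-refl)))
           (*-congˡ _ (*-cong (off₂ j j≢i zero) ≃-refl)) ⟩
    c * T A j + T B j ∎
    where
    i′ : Fin n
    i′ = punchOut j≢i
    at′ : ∀ k → row-minor j C i′ k ≃ c * row-minor j A i′ k + row-minor j B i′ k
    at′ k rewrite Fin.punchIn-punchOut j≢i = at (suc k)
    apart : ∀ l → l ≢ i′ → punchIn j l ≢ i
    apart l l≢i′ eq = l≢i′ (Fin.punchIn-injective j l i′
      (≡.trans eq (≡.sym (Fin.punchIn-punchOut j≢i))))
    off₁′ : ∀ l → l ≢ i′ → row-minor j C l ≈ row-minor j A l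
    off₁′ l l≢i′ k = off₁ (punchIn j l) (apart l l≢i′) (suc k)
    off₂′ : ∀ l → l ≢ i′ → row-minor j C l ≈ row-minor j B l
    off₂′ l l≢i′ k = off₂ (punchIn j l) (apart l l≢i′) (suc k)
det∘ᵀ-alternating {suc n} .swap {a} {b} adj {A} {B} (swapped a↦b b↦a fixed) = begin
  det (A ᵀ)
    -- The terms of `a` and `b` change places, with equal minors and opposite signs; in the other
    -- terms the exchange happens inside the minor.
    ≈⟨ sum-swap adj a-term b-term other ⟩
  sum (λ j → - 1ℝ * T B j)
    ≈⟨ *-distribˡ-sum (- 1ℝ) (T B) ⟨
  - 1ℝ * det (B ᵀ)
    ≈⟨ -1*x≃-x (det (B ᵀ)) ⟩
  - det (B ᵀ) ∎
  where
  open ≃-Reasoning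
  T : Matrix (suc n) → Fin (suc n) → ℝ
  T A j = (- 1ℝ) ^ toℕ j * (A j zero * det (row-minor j A ᵀ))
  minors : ∀ l k → A (punchIn a l) k ≃ B (punchIn b l) k
  minors l k with punchIn-swap adj l
  ... | inj₁ (p , q) rewrite p | q = b↦a k
  ... | inj₂ p = ≃-trans
    (fixed (punchIn a l) (Fin.punchInᵢ≢i a l) (Fin.punchInᵢ≢i b l ∘ ≡.trans (≡.sym p)) k)
    (≡⇒≃ (≡.cong (λ i → B i k) p))
  minors′ : ∀ l k → A (punchIn b l) k ≃ B (punchIn a l) k
  minors′ l k with punchIn-swap adj l
  ... | inj₁ (p , q) rewrite p | q = a↦b k
  ... | inj₂ p = ≃-trans
    (fixed (punchIn b l) (Fin.punchInᵢ≢i a l ∘ ≡.trans p) (Fin.punchInᵢ≢i b l) k)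
    (≡⇒≃ (≡.cong (λ i → B i k) (≡.sym p)))
  lemma : ∀ s x → s * x ≃ - 1ℝ * (- s * x)
  lemma = solve 2 (λ s x → s :* x := :- con 1ℚ :* (:- s :* x)) ≃-refl
    where open ℝ-solver
  lemma′ : ∀ s x → - s * x ≃ - 1ℝ * (s * x)
  lemma′ = solve 2 (λ s x → :- s :* x := :- con 1ℚ :* (s :* x)) ≃-refl
    where open ℝ-solver
  lemma″ : ∀ s a d → s * (a * - d) ≃ - 1ℝ * (s * (a * d))
  lemma″ = solve 3 (λ s a d → s :* (a :* :- d) := :- con 1ℚ :* (s :* (a :* d))) ≃-refl
    where open ℝ-solver
  a-term : T A a ≃ - 1ℝ * T B b
  a-term = begin
    T A a
      ≈⟨ *-congˡ _ (*-cong (a↦b zero) (det-cong λ k l → minors l (suc k))) ⟩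
    (- 1ℝ) ^ toℕ a * (B b zero * det (row-minor b B ᵀ))
      ≈⟨ lemma _ _ ⟩
    - 1ℝ * (- (- 1ℝ) ^ toℕ a * (B b zero * det (row-minor b B ᵀ)))
      ≈⟨ *-congˡ (- 1ℝ) (*-cong (adjacent-sign adj) ≃-refl) ⟨
    - 1ℝ * T B b ∎
  b-term : T A b ≃ - 1ℝ * T B a
  b-term = begin
    T A b
      ≈⟨ *-cong (adjacent-sign adj) (*-cong (b↦a zero) (det-cong λ k l → minors′ l (suc k))) ⟩
    - (- 1ℝ) ^ toℕ a * (B a zero * det (row-minor a B ᵀ))
      ≈⟨ lemma′ _ _ ⟩
    - 1ℝ * T B a ∎
  other : ∀ j → j ≢ a → j ≢ b → T A j ≃ - 1ℝ * T B j
  other j j≢a j≢b with punchIn-adjacent adj j j≢a j≢b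
  ... | a′ , b′ , adj′ , p , q = begin
    T A j
      ≈⟨ *-congˡ _ (*-cong (fixed j j≢a j≢b zero)
           (swap det∘ᵀ-alternating adj′ (swapped a↦b′ b↦a′ fixed′))) ⟩
    (- 1ℝ) ^ toℕ j * (B j zero * - det (row-minor j B ᵀ))
      ≈⟨ lemma″ _ _ _ ⟩
    - 1ℝ * T B j ∎
    where
    a↦b′ : row-minor j A a′ ≈ row-minor j B b′
    a↦b′ k rewrite p | q = a↦b (suc k)
    b↦a′ : row-minor j A b′ ≈ row-minor j B a′
    b↦a′ k rewrite p | q = b↦a (suc k)
    fixed′ : ∀ l → l ≢ a′ → l ≢ b′ → row-minor j A l ≈ row-minor j B l
    fixed′ l l≢a′ l≢b′ k = fixed (punchIn j l)
      (λ eq → l≢a′ (Fin.punchIn-injective j l a′ (≡.trans eq (≡.sym p))))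
      (λ eq → l≢b′ (Fin.punchIn-injective j l b′ (≡.trans eq (≡.sym q)))) (suc k)

det-block : ∀ {n} (A : Matrix (suc n)) → (∀ j → A zero (suc j) ≃ 0ℝ) →
  det A ≃ A zero zero * det λ i j → A (suc i) (suc j)
det-block A A₀≃0 = begin
  det A
    ≈⟨ +-cong (*-identityˡ _) (sum-zero λ j →
         ≃-trans (*-congˡ _ (*-cong (A₀≃0 j) ≃-refl))
                 (≃-trans (*-congˡ _ (*-zeroˡ _)) (*-zeroʳ _))) ⟩
  A zero zero * det (minor zero A) + 0ℝ
    ≈⟨ +-identityʳ _ ⟩
  A zero zero * det (λ i j → A (suc i) (suc j)) ∎
  where open ≃-Reasoning

det-scaledI : ∀ n c → det (c · I n) ≃ c ^ n
det-scaledI zero    c = ≃-refl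
det-scaledI (suc n) c = ≃-trans (det-block (c · I (suc n)) λ j → *-zeroʳ c)
  (*-cong (≃-trans (*-congˡ c (I-refl {suc n} zero)) (≃-trans (*-comm c 1ℝ) (*-identityˡ c)))
    (≃-trans (det-cong {n} λ i j → *-congˡ c (I-suc i j)) (det-scaledI n c)))

det-I : ∀ n → det (I n) ≃ 1ℝ
det-I zero    = ≃-refl
det-I (suc n) = ≃-trans (det-block (I (suc n)) λ _ → ≃-refl)
  (≃-trans (*-cong (I-refl {suc n} zero) (≃-trans (det-cong {n} I-suc) (det-I n))) (*-identityˡ 1ℝ))

-- The function `λ A → det (A ᵀ)` alternates in the rows of `A` and is one at the identity, so
-- uniqueness applies.
det-ᵀ : ∀ {n} (A : Matrix n) → det (A ᵀ) ≃ det A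
det-ᵀ {n} A = ≃-trans (alternating⇒det det∘ᵀ-alternating A)
  (≃-trans (*-cong (≃-trans (det-cong {n} λ i j → I-sym j i) (det-I n)) ≃-refl) (*-identityˡ (det A)))

det-alternating : ∀ {n} → Alternating (det {n})
det-alternating .resp = det-cong
det-alternating .linear i c {A} {B} {C} comb = ≃-trans (≃-sym (det-ᵀ C))
  (≃-trans (linear det∘ᵀ-alternating i c comb) (+-cong (*-congˡ c (det-ᵀ A)) (det-ᵀ B)))
det-alternating .swap adj {A} {B} sw = ≃-trans (≃-sym (det-ᵀ A))
  (≃-trans (swap det∘ᵀ-alternating adj sw) (-‿cong (det-ᵀ B)))

⊗-cong : ∀ {n} {A B C D : Matrix n} → A ≋ B → C ≋ D → A ⊗ C ≋ B ⊗ D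
⊗-cong A≋B C≋D i j = sum-cong λ k → *-cong (A≋B i k) (C≋D k j)

-- Row `i` of the product depends linearly on row `i` of `A` and on no other row, so
-- `λ A → det (A ⊗ B)` alternates; at the identity it is `det B`.
det-⊗ : ∀ {n} (A B : Matrix n) → det (A ⊗ B) ≃ det A * det B
det-⊗ {n} A B = ≃-trans (alternating⇒det alt A)
  (≃-trans (*-cong (det-cong λ i j → sum-I i (λ k → B k j)) ≃-refl) (*-comm _ _))
  where
  open ≃-Reasoning
  lemma : ∀ c x y z → (c * x + y) * z ≃ c * (x * z) + y * z
  lemma = solve 4 (λ c x y z → (c :* x :+ y) :* z := c :* (x :* z) :+ y :* z) ≃-refl
    where open ℝ-solver
  alt : Alternating λ A → det (A ⊗ B)
  alt .resp A≈A′ = det-cong (⊗-cong A≈A′ (λ _ _ → ≃-refl))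
  alt .linear i c {X} {Y} {Z} (combined at off₁ off₂) = linear det-alternating i c (combined
    (λ j → begin
      (Z ⊗ B) i j
        ≈⟨ sum-cong (λ k → ≃-trans (*-cong (at k) ≃-refl) (lemma c (X i k) (Y i k) (B k j))) ⟩
      sum (λ k → c * (X i k * B k j) + Y i k * B k j)
        ≈⟨ ∑-distrib-+ (λ k → c * (X i k * B k j)) (λ k → Y i k * B k j) ⟩
      sum (λ k → c * (X i k * B k j)) + (Y ⊗ B) i j
        ≈⟨ +-cong (*-distribˡ-sum c (λ k → X i k * B k j)) ≃-refl ⟨
      c * (X ⊗ B) i j + (Y ⊗ B) i j ∎)
    (λ l l≢i j → sum-cong λ k → *-cong (off₁ l l≢i k) ≃-refl)
    (λ l l≢i j → sum-cong λ k → *-cong (off₂ l l≢i k) ≃-refl))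
  alt .swap adj (swapped a↦b b↦a fixed) = swap det-alternating adj (swapped
    (λ j → sum-cong λ k → *-cong (a↦b k) ≃-refl)
    (λ j → sum-cong λ k → *-cong (b↦a k) ≃-refl)
    (λ l l≢a l≢b j → sum-cong λ k → *-cong (fixed l l≢a l≢b k) ≃-refl))

-- Powers and sums

0<fromℚ : ∀ {p} → 0ℚ ℚ.< p → 0ℝ < fromℚ p
0<fromℚ {p} 0<p = mk< (½ ℚ.* p , ½*-posᵠ 0<p , 0 , λ _ _ → 0<⇒<ᵠ _ _ (½*-posᵠ 0<p) (lemma p))
  where
  open ℚ-solver
  lemma : ∀ p → ½ ℚ.* p ≡ p ℚ.- (0ℚ ℚ.+ ½ ℚ.* p)
  lemma = solve 1 (λ p → con ½ :* p := p :- (con 0ℚ :+ con ½ :* p)) ≡.refl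

0<1 : 0ℝ < 1ℝ
0<1 = 0<fromℚ (ℚ.positive⁻¹ 1ℚ)

0≤fromℕ : ∀ n → 0ℝ ≤ fromℕ n
0≤fromℕ zero    = ≤-refl
0≤fromℕ (suc n) = ≤-respʳ (≃-sym (fromℕ-suc n)) (0≤x+y (<⇒≤ 0<1) (0≤fromℕ n))

0<fromℕ : ∀ n → 0ℝ < fromℕ (suc n)
0<fromℕ n = <-respʳ (≃-sym (fromℕ-suc n)) (0<x+y 0<1 (0≤fromℕ n))

^-cong : ∀ n {x y} → x ≃ y → x ^ n ≃ y ^ n
^-cong zero    x≃y = ≃-refl
^-cong (suc n) x≃y = *-cong x≃y (^-cong n x≃y)

^-distrib-* : ∀ n x y → (x * y) ^ n ≃ x ^ n * y ^ n
^-distrib-* zero    x y = ≃-sym (*-identityˡ 1ℝ)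
^-distrib-* (suc n) x y = ≃-trans (*-congˡ (x * y) (^-distrib-* n x y)) (lemma x y (x ^ n) (y ^ n))
  where
  open ℝ-solver
  lemma : ∀ x y u v → (x * y) * (u * v) ≃ (x * u) * (y * v)
  lemma = solve 4 (λ x y u v → (x :* y) :* (u :* v) := (x :* u) :* (y :* v)) ≃-refl

0<^ : ∀ n {x} → 0ℝ < x → 0ℝ < x ^ n
0<^ zero    0<x = 0<1
0<^ (suc n) 0<x = 0<x*y 0<x (0<^ n 0<x)

0≤^ : ∀ n {x} → 0ℝ ≤ x → 0ℝ ≤ x ^ n
0≤^ zero    0≤x = <⇒≤ 0<1
0≤^ (suc n) 0≤x = 0≤x*y 0≤x (0≤^ n 0≤x)

sum-const : ∀ n c → sum {n} (λ _ → c) ≃ fromℕ n * c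
sum-const zero    c = ≃-sym (*-zeroˡ c)
sum-const (suc n) c = begin
  c + sum {n} (λ _ → c)  ≈⟨ +-congˡ c (sum-const n c) ⟩
  c + fromℕ n * c        ≈⟨ lemma c (fromℕ n) ⟩
  (1ℝ + fromℕ n) * c     ≈⟨ *-cong (fromℕ-suc n) ≃-refl ⟨
  fromℕ (suc n) * c      ∎
  where
  open ≃-Reasoning
  lemma : ∀ c n → c + n * c ≃ (1ℝ + n) * c
  lemma = solve 2 (λ c n → c :+ n :* c := (con 1ℚ :+ n) :* c) ≃-refl
    where open ℝ-solver

0≤sum : ∀ {n} (x : Vector ℝ n) → (∀ i → 0ℝ ≤ x i) → 0ℝ ≤ sum x
0≤sum {zero}  x 0≤x = ≤-refl
0≤sum {suc n} x 0≤x = 0≤x+y (0≤x zero) (0≤sum (x ∘ suc) (0≤x ∘ suc))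

sum≤0⇒≃0 : ∀ {n} (x : Vector ℝ n) → (∀ i → 0ℝ ≤ x i) → sum x ≤ 0ℝ → ∀ i → x i ≃ 0ℝ
sum≤0⇒≃0 x 0≤x ∑≤0 zero = ≤-antisym
  (≤-trans (0≤⇒≤ (lemma (x zero) (sum (x ∘ suc))) (0≤sum (x ∘ suc) (0≤x ∘ suc))) ∑≤0)
  (0≤x zero)
  where
  open ℝ-solver
  lemma : ∀ a b → b ≃ a + b - a
  lemma = solve 2 (λ a b → b := a :+ b :- a) ≃-refl
sum≤0⇒≃0 x 0≤x ∑≤0 (suc i) = sum≤0⇒≃0 (x ∘ suc) (0≤x ∘ suc)
  (≤-trans (0≤⇒≤ (lemma (x zero) (sum (x ∘ suc))) (0≤x zero)) ∑≤0) i
  where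
  open ℝ-solver
  lemma : ∀ a b → a ≃ a + b - b
  lemma = solve 2 (λ a b → a := a :+ b :- b) ≃-refl

sum-linear : ∀ {n} a b (x y : Vector ℝ n) →
  sum (λ i → a * x i + b * y i) ≃ a * sum x + b * sum y
sum-linear a b x y = ≃-trans (∑-distrib-+ (λ i → a * x i) (λ i → b * y i))
  (+-cong (≃-sym (*-distribˡ-sum a x)) (≃-sym (*-distribˡ-sum b y)))

-- Inner products and Gram matrices

dot : ∀ {n} → Vector ℝ n → Vector ℝ n → ℝ
dot u v = sum λ i → u i * v i

dot-comm : ∀ {n} (u v : Vector ℝ n) → dot u v ≃ dot v u
dot-comm u v = sum-cong λ i → *-comm (u i) (v i)

dot-linear : ∀ {n} a b (u v w : Vector ℝ n) →
  dot (λ i → a * u i + b * v i) w ≃ a * dot u w + b * dot v w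
dot-linear a b u v w = ≃-trans
  (sum-cong λ i → lemma a b (u i) (v i) (w i))
  (sum-linear a b (λ i → u i * w i) (λ i → v i * w i))
  where
  open ℝ-solver
  lemma : ∀ a b u v w → (a * u + b * v) * w ≃ a * (u * w) + b * (v * w)
  lemma = solve 5 (λ a b u v w → (a :* u :+ b :* v) :* w := a :* (u :* w) :+ b :* (v :* w)) ≃-refl

0≤dot : ∀ {n} (u : Vector ℝ n) → 0ℝ ≤ dot u u
0≤dot u = 0≤sum _ λ i → 0≤x*x (u i)

dot≤0⇒≃0 : ∀ {n} (u : Vector ℝ n) → dot u u ≤ 0ℝ → ∀ i → u i ≃ 0ℝ
dot≤0⇒≃0 u u²≤0 i =
  x*x≤0⇒x≃0 (≤-reflexive (sum≤0⇒≃0 (λ i → u i * u i) (λ i → 0≤x*x (u i)) u²≤0 i))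

dot-zeroˡ : ∀ {n} {u : Vector ℝ n} v → (∀ i → u i ≃ 0ℝ) → dot u v ≃ 0ℝ
dot-zeroˡ v u≃0 = sum-zero λ i → ≃-trans (*-cong (u≃0 i) ≃-refl) (*-zeroˡ (v i))

-- For square `X` this unfolds to `X ⊗ X ᵀ`, which is used tacitly. Rectangular `X` occur because
-- elimination removes a row but keeps the length of the others.
Gram : ∀ {k n} → Vector (Vector ℝ n) k → Matrix k
Gram X i j = dot (X i) (X j)

-- Hadamard's inequality

private
  -- `h t c m` is the sum of `t^i c^(m-i)` over `i ≤ m`, the quotient of `t^(m+1) - c^(m+1)` by
  -- `t - c`. `Q t c m` is the sum of `(i+1) t^i c^(m-1-i)` over `i < m`, the quotient of the gap in
  -- `am-gm-gap` by `(t - c)²`. The recursions make positivity evident.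
  h Q : ℝ → ℝ → ℕ → ℝ
  h t c zero    = 1ℝ
  h t c (suc m) = t * h t c m + c ^ suc m
  Q t c zero    = 0ℝ
  Q t c (suc m) = t * Q t c m + h t c m

  h-factors : ∀ t c m → t ^ suc m - c ^ suc m ≃ (t - c) * h t c m
  h-factors t c zero = lemma t c
    where
    open ℝ-solver
    lemma : ∀ t c → t * 1ℝ - c * 1ℝ ≃ (t - c) * 1ℝ
    lemma = solve 2 (λ t c → t :* con 1ℚ :- c :* con 1ℚ := (t :- c) :* con 1ℚ) ≃-refl
  h-factors t c (suc m) = begin
    t * t ^ suc m - c * c ^ suc m
      ≈⟨ lemma₁ t c (t ^ suc m) (c ^ suc m) ⟩
    t * (t ^ suc m - c ^ suc m) + (t - c) * c ^ suc m
      ≈⟨ +-cong (*-congˡ t (h-factors t c m)) ≃-refl ⟩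
    t * ((t - c) * h t c m) + (t - c) * c ^ suc m
      ≈⟨ lemma₂ t c (h t c m) (c ^ suc m) ⟩
    (t - c) * h t c (suc m) ∎
    where
    open ≃-Reasoning
    lemma₁ : ∀ t c u v → t * u - c * v ≃ t * (u - v) + (t - c) * v
    lemma₁ = solve 4 (λ t c u v → t :* u :- c :* v := t :* (u :- v) :+ (t :- c) :* v) ≃-refl
      where open ℝ-solver
    lemma₂ : ∀ t c h v → t * ((t - c) * h) + (t - c) * v ≃ (t - c) * (t * h + v)
    lemma₂ = solve 4 (λ t c h v → t :* ((t :- c) :* h) :+ (t :- c) :* v := (t :- c) :* (t :* h :+ v)) ≃-refl
      where open ℝ-solver

  0<h : ∀ {t c} → 0ℝ ≤ t → 0ℝ < c → ∀ m → 0ℝ < h t c m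
  0<h 0≤t 0<c zero    = 0<1
  0<h 0≤t 0<c (suc m) =
    <-respʳ (+-comm _ _) (0<x+y (0<^ (suc m) 0<c) (0≤x*y 0≤t (<⇒≤ (0<h 0≤t 0<c m))))

  0≤Q : ∀ {t c} → 0ℝ ≤ t → 0ℝ < c → ∀ m → 0ℝ ≤ Q t c m
  0≤Q 0≤t 0<c zero    = ≤-refl
  0≤Q 0≤t 0<c (suc m) = 0≤x+y (0≤x*y 0≤t (0≤Q 0≤t 0<c m)) (<⇒≤ (0<h 0≤t 0<c m))

  0<Q : ∀ {t c} → 0ℝ ≤ t → 0ℝ < c → ∀ m → 0ℝ < Q t c (suc m)
  0<Q 0≤t 0<c m = <-respʳ (+-comm _ _) (0<x+y (0<h 0≤t 0<c m) (0≤x*y 0≤t (0≤Q 0≤t 0<c m)))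

-- The left-hand side is the gap in the inequality of arithmetic and geometric
-- means for the m + 1 numbers t, …, t and (m + 1) c - m t, whose mean is c.

am-gm-gap : ∀ t c m →
  c ^ suc m - (fromℕ (suc m) * c - fromℕ m * t) * t ^ m ≃ (t - c) * (t - c) * Q t c m
am-gm-gap t c zero = lemma t c
  where
  open ℝ-solver
  lemma : ∀ t c → c * 1ℝ - (1ℝ * c - 0ℝ * t) * 1ℝ ≃ (t - c) * (t - c) * 0ℝ
  lemma = solve 2 (λ t c → c :* con 1ℚ :- (con 1ℚ :* c :- con 0ℚ :* t) :* con 1ℚ
    := (t :- c) :* (t :- c) :* con 0ℚ) ≃-refl
am-gm-gap t c (suc m) = begin
  c ^ suc (suc m) - (fromℕ (suc (suc m)) * c - fromℕ (suc m) * t) * t ^ suc m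
    ≈⟨ +-congˡ _ (-‿cong (*-cong (+-cong
         (*-cong (≃-trans (fromℕ-suc (suc m)) (+-congˡ 1ℝ (fromℕ-suc m))) ≃-refl)
         (-‿cong (*-cong (fromℕ-suc m) ≃-refl))) ≃-refl)) ⟩
  c * (c * c ^ m) - ((1ℝ + (1ℝ + fromℕ m)) * c - (1ℝ + fromℕ m) * t) * (t * t ^ m)
    ≈⟨ lemma₁ t c (fromℕ m) (t ^ m) (c ^ m) ⟩
  t * (c * c ^ m - ((1ℝ + fromℕ m) * c - fromℕ m * t) * t ^ m) +
    (t - c) * (t * t ^ m - c * c ^ m)
    ≈⟨ +-cong (*-congˡ t (+-congˡ _ (-‿cong (*-cong (+-cong (*-cong (fromℕ-suc m) ≃-refl) ≃-refl) ≃-refl)))) ≃-refl ⟨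
  t * (c ^ suc m - (fromℕ (suc m) * c - fromℕ m * t) * t ^ m) +
    (t - c) * (t ^ suc m - c ^ suc m)
    ≈⟨ +-cong (*-congˡ t (am-gm-gap t c m)) (*-congˡ (t - c) (h-factors t c m)) ⟩
  t * ((t - c) * (t - c) * Q t c m) + (t - c) * ((t - c) * h t c m)
    ≈⟨ lemma₂ t (t - c) (Q t c m) (h t c m) ⟩
  (t - c) * (t - c) * Q t c (suc m) ∎
  where
  open ≃-Reasoning
  lemma₁ : ∀ t c n u v →
    c * (c * v) - ((1ℝ + (1ℝ + n)) * c - (1ℝ + n) * t) * (t * u) ≃
    t * (c * v - ((1ℝ + n) * c - n * t) * u) + (t - c) * (t * u - c * v)
  lemma₁ = solve 5 (λ t c n u v →
    c :* (c :* v) :- ((con 1ℚ :+ (con 1ℚ :+ n)) :* c :- (con 1ℚ :+ n) :* t) :* (t :* u) :=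
    t :* (c :* v :- ((con 1ℚ :+ n) :* c :- n :* t) :* u) :+ (t :- c) :* (t :* u :- c :* v)) ≃-refl
    where open ℝ-solver
  lemma₂ : ∀ t d q h → t * (d * d * q) + d * (d * h) ≃ d * d * (t * q + h)
  lemma₂ = solve 4 (λ t d q h → t :* (d :* d :* q) :+ d :* (d :* h) := d :* d :* (t :* q :+ h)) ≃-refl
    where open ℝ-solver

-- The gap is at most zero while its factor `Q` is positive, so `(t - c)²` vanishes. The exponents
-- start at two because `Q t c zero` is zero: a single number does not involve `t`.
am-gm-equality : ∀ {t c} m → 0ℝ ≤ t → 0ℝ < c →
  c ^ suc (suc m) ≤ (fromℕ (suc (suc m)) * c - fromℕ (suc m) * t) * t ^ suc m → t ≃ c
am-gm-equality {t} {c} m 0≤t 0<c le = begin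
  t           ≈⟨ lemma₁ t c ⟩
  (t - c) + c ≈⟨ +-cong t-c≃0 ≃-refl ⟩
  0ℝ + c      ≈⟨ +-identityˡ c ⟩
  c           ∎
  where
  open ≃-Reasoning
  lemma₁ : ∀ t c → t ≃ (t - c) + c
  lemma₁ = solve 2 (λ t c → t := (t :- c) :+ c) ≃-refl
    where open ℝ-solver
  lemma₂ : ∀ a b → b - a ≃ 0ℝ - (a - b)
  lemma₂ = solve 2 (λ a b → b :- a := con 0ℚ :- (a :- b)) ≃-refl
    where open ℝ-solver
  t-c≃0 : t - c ≃ 0ℝ
  t-c≃0 = x*x≤0⇒x≃0 (*-cancelˡ-≤ (0<Q 0≤t 0<c m)
    (≤-respʳ (≃-sym (*-zeroʳ _)) (≤-respˡ (≃-trans (am-gm-gap t c (suc m)) (*-comm _ _))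
      (0≤⇒≤ (lemma₂ _ _) (≤⇒0≤ le)))))

det-· : ∀ {n} c (A : Matrix n) → det (c · A) ≃ c ^ n * det A
det-· {zero}  c A = ≃-sym (*-identityˡ 1ℝ)
det-· {suc n} c A = begin
  det (c · A)
    ≈⟨ sum-cong (λ j → *-congˡ (σ j) (*-congˡ (c * A zero j) (det-· c (minor j A)))) ⟩
  sum (λ j → σ j * (c * A zero j * (c ^ n * det (minor j A))))
    ≈⟨ sum-cong (λ j → lemma (σ j) c (A zero j) (c ^ n) (det (minor j A))) ⟩
  sum (λ j → c ^ suc n * (σ j * (A zero j * det (minor j A))))
    ≈⟨ *-distribˡ-sum (c ^ suc n) (λ j → σ j * (A zero j * det (minor j A))) ⟨
  c ^ suc n * det A ∎
  where
  open ≃-Reasoning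
  σ : Fin (suc n) → ℝ
  σ j = (- 1ℝ) ^ toℕ j
  lemma : ∀ s c a p d → s * (c * a * (p * d)) ≃ c * p * (s * (a * d))
  lemma = solve 5 (λ s c a p d → s :* (c :* a :* (p :* d)) := c :* p :* (s :* (a :* d))) ≃-refl
    where open ℝ-solver

-- The rows after the first, projected orthogonally to it and scaled by its
-- squared length, so that no division is needed.

module Elimination {k n} (X : Vector (Vector ℝ n) (suc k)) where

  G : Matrix (suc k)
  G = Gram X

  y : ℝ
  y = G zero zero

  projected : Vector (Vector ℝ n) k
  projected i l = y * X (suc i) l + (- G (suc i) zero) * X zero l

  -- `y` times the Schur complement of the corner entry of `G`.
  schur : Matrix k
  schur i j = y * G (suc i) (suc j) + (- G (suc i) zero) * G zero (suc j)

  Gram-projected : Gram projected ≋ y · schur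
  Gram-projected i j = begin
    dot (projected i) (projected j)
      ≈⟨ dot-linear y (- a) u w (projected j) ⟩
    y * dot u (projected j) + (- a) * dot w (projected j)
      ≈⟨ +-cong (*-congˡ y (expandʳ u)) (*-congˡ (- a) (expandʳ w)) ⟩
    y * (y * dot u v + (- b) * a) + (- a) * (y * dot w v + (- b) * y)
      ≈⟨ lemma y a b (dot u v) (dot w v) ⟩
    y * (y * dot u v + (- a) * dot w v) ∎
    where
    open ≃-Reasoning
    u v w : Vector ℝ n
    u = X (suc i)
    v = X (suc j)
    w = X zero
    a b : ℝ
    a = G (suc i) zero
    b = G (suc j) zero
    expandʳ : ∀ z → dot z (projected j) ≃ y * dot z v + (- b) * dot z w
    expandʳ z = ≃-trans (dot-comm z (projected j)) (≃-trans (dot-linear y (- b) v w z)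
      (+-cong (*-congˡ y (dot-comm v z)) (*-congˡ (- b) (dot-comm w z))))
    lemma : ∀ y a b p q →
      y * (y * p + (- b) * a) + (- a) * (y * q + (- b) * y) ≃ y * (y * p + (- a) * q)
    lemma = solve 5 (λ y a b p q →
      y :* (y :* p :+ (:- b) :* a) :+ (:- a) :* (y :* q :+ (:- b) :* y)
      := y :* (y :* p :+ (:- a) :* q)) ≃-refl
      where open ℝ-solver

  -- Gaussian elimination below the corner as a triangular matrix with diagonal `1, y, …, y`: the
  -- first column of `L ⊗ G` vanishes below `y`, and the remaining block is `schur`.
  L : Matrix (suc k)
  L zero    = I (suc k) zero
  L (suc i) = (- G (suc i) zero) ∷ (y · I k) i

  det-L : det L ≃ y ^ k
  det-L = ≃-trans (det-block L λ _ → ≃-refl)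
    (≃-trans (*-cong (I-refl {suc k} zero) (det-scaledI k y)) (*-identityˡ (y ^ k)))

  L⊗G-suc : ∀ i j → (L ⊗ G) (suc i) j ≃ (- G (suc i) zero) * G zero j + y * G (suc i) j
  L⊗G-suc i j = +-congˡ _ (begin
    sum (λ l → y * I k i l * G (suc l) j)
      ≈⟨ sum-cong (λ l → *-assoc y (I k i l) (G (suc l) j)) ⟩
    sum (λ l → y * (I k i l * G (suc l) j))
      ≈⟨ *-distribˡ-sum y (λ l → I k i l * G (suc l) j) ⟨
    y * sum (λ l → I k i l * G (suc l) j)
      ≈⟨ *-congˡ y (sum-I i (λ l → G (suc l) j)) ⟩
    y * G (suc i) j ∎)
    where open ≃-Reasoning

  det-L⊗G : det (L ⊗ G) ≃ y * det schur
  det-L⊗G = begin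
    det (L ⊗ G)
      ≈⟨ det-ᵀ (L ⊗ G) ⟨
    det ((L ⊗ G) ᵀ)
      ≈⟨ det-block ((L ⊗ G) ᵀ) (λ i → ≃-trans (L⊗G-suc i zero) (cancel (G (suc i) zero) y)) ⟩
    (L ⊗ G) zero zero * det (λ i j → (L ⊗ G) (suc j) (suc i))
      ≈⟨ *-cong (sum-I {suc k} zero (λ l → G l zero))
           (det-cong {k} λ i j → ≃-trans (L⊗G-suc j (suc i)) (+-comm _ _)) ⟩
    y * det (schur ᵀ)
      ≈⟨ *-congˡ y (det-ᵀ schur) ⟩
    y * det schur ∎
    where
    open ≃-Reasoning
    cancel : ∀ a y → (- a) * y + y * a ≃ 0ℝ
    cancel = solve 2 (λ a y → (:- a) :* y :+ y :* a := con 0ℚ) ≃-refl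
      where open ℝ-solver

  -- Both determinants are linked through `det schur`. Keeping the factor `y` on the left avoids the
  -- exponent `2 k - 1`.
  det-Gram-projected : y * det (Gram projected) ≃ y ^ k * (y ^ k * det G)
  det-Gram-projected = begin
    y * det (Gram projected)       ≈⟨ *-congˡ y (≃-trans (det-cong {k} Gram-projected) (det-· y schur)) ⟩
    y * (y ^ k * det schur)        ≈⟨ x*[y*z]≃y*[x*z] y (y ^ k) (det schur) ⟩
    y ^ k * (y * det schur)        ≈⟨ *-congˡ (y ^ k) det-L⊗G ⟨
    y ^ k * det (L ⊗ G)            ≈⟨ *-congˡ (y ^ k) (≃-trans (det-⊗ L G) (*-cong det-L ≃-refl)) ⟩
    y ^ k * (y ^ k * det G)        ∎
    where open ≃-Reasoning

  -- Apart from scaling by `y²`, projecting costs `y` times the squared inner products with the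
  -- first row. In the equality case there is no room for this loss.
  trace-Gram-projected : sum (λ i → Gram projected i i) ≃
    y * y * sum (λ i → G (suc i) (suc i)) + (- y) * sum (λ i → G (suc i) zero * G (suc i) zero)
  trace-Gram-projected = ≃-trans
    (sum-cong λ i → ≃-trans (Gram-projected i i)
      (≃-trans (*-congˡ y (+-congˡ _ (*-congˡ _ (dot-comm (X zero) (X (suc i))))))
        (lemma y (G (suc i) zero) (G (suc i) (suc i)))))
    (sum-linear (y * y) (- y) (λ i → G (suc i) (suc i)) (λ i → G (suc i) zero * G (suc i) zero))
    where
    lemma : ∀ y a d → y * (y * d + (- a) * a) ≃ y * y * d + (- y) * (a * a)
    lemma = solve 3 (λ y a d → y :* (y :* d :+ (:- a) :* a) := y :* y :* d :+ (:- y) :* (a :* a)) ≃-refl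
      where open ℝ-solver

-- Hadamard's inequality |det X| ≤ ∏ |xᵢ| and the inequality of arithmetic and
-- geometric means combined, in the form of their equality case.

HadamardEquality : ℕ → Set
HadamardEquality k = ∀ {n} (X : Vector (Vector ℝ n) k) c → 0ℝ ≤ c →
  sum (λ i → Gram X i i) ≤ fromℕ k * c → c ^ k ≤ det (Gram X) → Gram X ≋ c · I k

-- If the determinant exceeded `c ^ k`, the equality case would make the Gram matrix `c I`, whose
-- determinant is exactly `c ^ k`.
hadamard-bound : ∀ {k} → HadamardEquality k → ∀ {n} (X : Vector (Vector ℝ n) k) c → 0ℝ ≤ c →
  sum (λ i → Gram X i i) ≤ fromℕ k * c → det (Gram X) ≤ c ^ k
hadamard-bound {k} hadamard X c 0≤c tr≤kc = ≮⇒≥ λ c^k<det → <-irrefl (<-respʳ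
  (≃-trans (det-cong (hadamard X c 0≤c tr≤kc (<⇒≤ c^k<det))) (det-scaledI k c)) c^k<det)

private
  -- The bound for the projected rows gives `det G ≤ y t^K`. Since `y` and `K` copies of `t` have
  -- mean `c`, this and `c^(K+1) ≤ det G` force `t = c = y`. The projected rows then satisfy the
  -- hypotheses of the equality case, and comparing traces shows that they were orthogonal to the
  -- first row before the projection.
  hadamard-step : ∀ k → HadamardEquality (suc k) → ∀ {n} (X : Vector (Vector ℝ n) (suc (suc k))) c →
    0ℝ < c → 0ℝ < Gram X zero zero →
    sum (λ i → Gram X i i) ≤ fromℕ (suc (suc k)) * c → c ^ suc (suc k) ≤ det (Gram X) →
    Gram X ≋ c · I (suc (suc k))
  hadamard-step k hadamard X c 0<c 0<y tr≤ c^≤det = result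
    where
    open Elimination X
    open ≃-Reasoning
    K : ℕ
    K = suc k
    T D t : ℝ
    T = sum λ i → G (suc i) (suc i)
    D = sum λ i → G (suc i) zero * G (suc i) zero
    -- The mean squared length available to each of the other `K` rows when the first has used `y`.
    t = (fromℕ (suc K) * c - y) * fromℚ (+ 1 ℚ./ K)

    0≤y : 0ℝ ≤ y
    0≤y = <⇒≤ 0<y
    0<y² : 0ℝ < y * y
    0<y² = 0<x*y 0<y 0<y
    0<y^K : 0ℝ < y ^ K
    0<y^K = 0<^ K 0<y

    Kt≃ : fromℕ K * t ≃ fromℕ (suc K) * c - y
    Kt≃ = ≃-trans (x*[y*z]≃y*[x*z] (fromℕ K) (fromℕ (suc K) * c - y) _)
      (≃-trans (*-congˡ _ (fromℕ*1/n k)) (≃-trans (*-comm _ _) (*-identityˡ _)))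

    T≤Kt : T ≤ fromℕ K * t
    T≤Kt = ≤-respʳ (≃-sym Kt≃) (0≤⇒≤ (lemma (fromℕ (suc K) * c) y T) (≤⇒0≤ tr≤))
      where
      lemma : ∀ a y t → a - (y + t) ≃ (a - y) - t
      lemma = solve 3 (λ a y t → a :- (y :+ t) := (a :- y) :- t) ≃-refl
        where open ℝ-solver

    0≤T : 0ℝ ≤ T
    0≤T = 0≤sum (λ i → G (suc i) (suc i)) λ i → 0≤dot (X (suc i))
    0≤D : 0ℝ ≤ D
    0≤D = 0≤sum (λ i → G (suc i) zero * G (suc i) zero) λ i → 0≤x*x (G (suc i) zero)

    0≤t : 0ℝ ≤ t
    0≤t = *-cancelˡ-≤ (0<fromℕ k) (≤-respˡ (≃-sym (*-zeroʳ _)) (≤-trans 0≤T T≤Kt))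

    trace≤ : sum (λ i → Gram projected i i) ≤ fromℕ K * (y * y * t)
    trace≤ = ≤-trans
      (≤-respˡ (≃-sym trace-Gram-projected)
        (0≤⇒≤ (lemma₁ (y * y * T) y D) (0≤x*y 0≤y 0≤D)))
      (≤-respʳ (lemma₂ y (fromℕ K) t) (*-monoˡ-≤ (<⇒≤ 0<y²) T≤Kt))
      where
      lemma₁ : ∀ a y d → y * d ≃ a - (a + (- y) * d)
      lemma₁ = solve 3 (λ a y d → y :* d := a :- (a :+ (:- y) :* d)) ≃-refl
        where open ℝ-solver
      lemma₂ : ∀ y n t → y * y * (n * t) ≃ n * (y * y * t)
      lemma₂ = solve 3 (λ y n t → y :* y :* (n :* t) := n :* (y :* y :* t)) ≃-refl
        where open ℝ-solver

    power : ∀ s → (y * y * s) ^ K ≃ y ^ K * y ^ K * s ^ K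
    power s = ≃-trans (^-distrib-* K (y * y) s) (*-cong (^-distrib-* K y y) ≃-refl)

    det≤ : det G ≤ y * t ^ K
    det≤ = *-cancelˡ-≤ (0<x*y 0<y^K 0<y^K) (≤-respˡ
      (≃-trans det-Gram-projected (≃-sym (*-assoc (y ^ K) (y ^ K) (det G))))
      (≤-respʳ (≃-trans (*-congˡ y (power t)) (x*[y*z]≃y*[x*z] y (y ^ K * y ^ K) (t ^ K)))
        (*-monoˡ-≤ 0≤y (hadamard-bound hadamard projected (y * y * t)
          (0≤x*y (<⇒≤ 0<y²) 0≤t) trace≤))))

    y≃ : y ≃ fromℕ (suc K) * c - fromℕ K * t
    y≃ = ≃-trans (lemma (fromℕ (suc K) * c) y) (+-congˡ _ (-‿cong (≃-sym Kt≃)))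
      where
      lemma : ∀ a y → y ≃ a - (a - y)
      lemma = solve 2 (λ a y → y := a :- (a :- y)) ≃-refl
        where open ℝ-solver

    t≃c : t ≃ c
    t≃c = am-gm-equality k 0≤t 0<c (≤-trans c^≤det (≤-respʳ (*-cong y≃ ≃-refl) det≤))

    y≃c : y ≃ c
    y≃c = begin
      y
        ≈⟨ y≃ ⟩
      fromℕ (suc K) * c - fromℕ K * t
        ≈⟨ +-cong (*-cong (fromℕ-suc K) ≃-refl) (-‿cong (*-congˡ _ t≃c)) ⟩
      (1ℝ + fromℕ K) * c - fromℕ K * c
        ≈⟨ lemma (fromℕ K) c ⟩
      c ∎
      where
      lemma : ∀ n c → (1ℝ + n) * c - n * c ≃ c
      lemma = solve 2 (λ n c → (con 1ℚ :+ n) :* c :- n :* c := c) ≃-refl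
        where open ℝ-solver

    trace≤c : sum (λ i → Gram projected i i) ≤ fromℕ K * (y * y * c)
    trace≤c = ≤-respʳ (*-congˡ _ (*-congˡ _ t≃c)) trace≤

    ≤det : (y * y * c) ^ K ≤ det (Gram projected)
    ≤det = *-cancelˡ-≤ 0<y (≤-respʳ (≃-sym det-Gram-projected) (≤-respˡ
      (begin
        y ^ K * (y ^ K * (c * c ^ K))  ≈⟨ *-congˡ _ (*-congˡ _ (*-cong y≃c ≃-refl)) ⟨
        y ^ K * (y ^ K * (y * c ^ K))  ≈⟨ lemma y (y ^ K) (c ^ K) ⟩
        y * (y ^ K * y ^ K * c ^ K)    ≈⟨ *-congˡ y (power c) ⟨
        y * (y * y * c) ^ K            ∎)
      (*-monoˡ-≤ (<⇒≤ 0<y^K) (*-monoˡ-≤ (<⇒≤ 0<y^K) c^≤det))))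
      where
      lemma : ∀ y p q → p * (p * (y * q)) ≃ y * (p * p * q)
      lemma = solve 3 (λ y p q → p :* (p :* (y :* q)) := y :* (p :* p :* q)) ≃-refl
        where open ℝ-solver

    orthogonal : Gram projected ≋ (y * y * c) · I K
    orthogonal = hadamard projected (y * y * c) (0≤x*y (<⇒≤ 0<y²) (<⇒≤ 0<c)) trace≤c ≤det

    trace≃ : sum (λ i → Gram projected i i) ≃ fromℕ K * (y * y * c)
    trace≃ = ≃-trans
      (sum-cong λ i → ≃-trans (orthogonal i i)
        (≃-trans (*-congˡ _ (I-refl i)) (≃-trans (*-comm _ _) (*-identityˡ _))))
      (sum-const K (y * y * c))

    -- The projected rows use up their allowance `K y² c`, whereas their trace is `y² T - y D` with
    -- `T ≤ K c`; nothing is left for `D`.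
    D≤0 : D ≤ 0ℝ
    D≤0 = *-cancelˡ-≤ 0<y (≤-respʳ (≃-sym (*-zeroʳ y)) (0≤⇒≤
      (begin
        y * y * (fromℕ K * t) - y * y * T
          ≈⟨ +-cong (≃-trans (*-congˡ _ (*-congˡ _ t≃c)) (lemma₁ y (fromℕ K) c)) ≃-refl ⟩
        fromℕ K * (y * y * c) - y * y * T
          ≈⟨ +-cong (≃-trans (≃-sym trace≃) trace-Gram-projected) ≃-refl ⟩
        y * y * T + (- y) * D - y * y * T
          ≈⟨ lemma₂ (y * y * T) y D ⟩
        0ℝ - y * D ∎)
      (≤⇒0≤ (*-monoˡ-≤ (<⇒≤ 0<y²) T≤Kt))))
      where
      lemma₁ : ∀ y n c → y * y * (n * c) ≃ n * (y * y * c)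
      lemma₁ = solve 3 (λ y n c → y :* y :* (n :* c) := n :* (y :* y :* c)) ≃-refl
        where open ℝ-solver
      lemma₂ : ∀ a y d → a + (- y) * d - a ≃ 0ℝ - y * d
      lemma₂ = solve 3 (λ a y d → a :+ (:- y) :* d :- a := con 0ℚ :- y :* d) ≃-refl
        where open ℝ-solver

    G[i,0]≃0 : ∀ i → G (suc i) zero ≃ 0ℝ
    G[i,0]≃0 i = x*x≤0⇒x≃0 (≤-reflexive
      (sum≤0⇒≃0 (λ i → G (suc i) zero * G (suc i) zero) (λ i → 0≤x*x (G (suc i) zero)) D≤0 i))

    result : G ≋ c · I (suc K)
    result zero zero = ≃-trans y≃c (≃-sym
      (≃-trans (*-congˡ c (I-refl {suc K} zero)) (≃-trans (*-comm c 1ℝ) (*-identityˡ c))))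
    result zero (suc j) = ≃-trans (dot-comm (X zero) (X (suc j)))
      (≃-trans (G[i,0]≃0 j) (≃-sym (*-zeroʳ c)))
    result (suc i) zero = ≃-trans (G[i,0]≃0 i) (≃-sym (*-zeroʳ c))
    result (suc i) (suc j) = ≃-trans
      (*-cancelˡ-≃ 0<y² (begin
        y * y * G (suc i) (suc j)
          ≈⟨ lemma y (G (suc i) (suc j)) (G zero (suc j)) ⟩
        y * (y * G (suc i) (suc j) + (- 0ℝ) * G zero (suc j))
          ≈⟨ *-congˡ y (+-congˡ _ (*-cong (-‿cong (G[i,0]≃0 i)) ≃-refl)) ⟨
        y * schur i j
          ≈⟨ Gram-projected i j ⟨
        Gram projected i j
          ≈⟨ orthogonal i j ⟩
        y * y * c * I K i j
          ≈⟨ *-assoc _ _ _ ⟩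
        y * y * (c * I K i j) ∎))
      (*-congˡ c (≃-sym (I-suc i j)))
      where
      lemma : ∀ y g h → y * y * g ≃ y * (y * g + (- 0ℝ) * h)
      lemma = solve 3 (λ y g h → y :* y :* g := y :* (y :* g :+ (:- con 0ℚ) :* h)) ≃-refl
        where open ℝ-solver

-- The step needs `c` and the first row to be nonzero. If `c = 0`, the trace bound annihilates every
-- row; if only the first row vanishes, the determinant is zero and cannot reach `c ^ k`.
hadamard-equality : ∀ k → HadamardEquality k
hadamard-equality zero X c 0≤c tr≤ c^≤det ()
hadamard-equality (suc k) X c 0≤c tr≤ c^≤det i j = by-cases ≃-stable 0ℝ c
  (λ 0<c → by-cases ≃-stable 0ℝ (Gram X zero zero)
    (λ 0<y → positive k X 0<c 0<y tr≤ c^≤det i j)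
    (λ y≤0 → contradiction
      (≤-trans c^≤det (≤-reflexive (singular (dot≤0⇒≃0 (X zero) y≤0))))
      (<⇒≱ (0<^ (suc k) 0<c))))
  λ c≤0 →
    let c≃0 = ≤-antisym c≤0 0≤c
        diagonal≃0 = sum≤0⇒≃0 (λ i → Gram X i i) (λ i → 0≤dot (X i))
          (≤-respʳ (≃-trans (*-congˡ _ c≃0) (*-zeroʳ _)) tr≤)
    in ≃-trans (dot-zeroˡ (X j) (dot≤0⇒≃0 (X i) (≤-reflexive (diagonal≃0 i))))
         (≃-sym (≃-trans (*-cong c≃0 ≃-refl) (*-zeroˡ _)))
  where
  singular : (∀ l → X zero l ≃ 0ℝ) → det (Gram X) ≃ 0ℝ
  singular X₀≃0 = ≃-trans
    (det-block (Gram X) λ j → dot-zeroˡ (X (suc j)) X₀≃0)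
    (≃-trans (*-cong (dot-zeroˡ (X zero) X₀≃0) ≃-refl) (*-zeroˡ _))
  positive : ∀ k {n} (X : Vector (Vector ℝ n) (suc k)) {c} → 0ℝ < c → 0ℝ < Gram X zero zero →
    sum (λ i → Gram X i i) ≤ fromℕ (suc k) * c → c ^ suc k ≤ det (Gram X) → Gram X ≋ c · I (suc k)
  -- For a single row, trace and determinant are the same number, bounded by `c` from either side.
  positive zero X {c} _ _ tr≤ c≤det zero zero = ≃-trans
    (≤-antisym
      (≤-respˡ (+-identityʳ _) (≤-respʳ (*-identityˡ c) tr≤))
      (≤-respʳ (≃-trans (det-block (Gram X) λ ()) (≃-trans (*-comm _ _) (*-identityˡ _)))
        (≤-respˡ (≃-trans (*-comm c 1ℝ) (*-identityˡ c)) c≤det)))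
    (≃-sym (≃-trans (*-congˡ c (I-refl {1} zero)) (≃-trans (*-comm c 1ℝ) (*-identityˡ c))))
  positive (suc k) X {c} 0<c 0<y tr≤ c^≤det =
    hadamard-step k (hadamard-equality (suc k)) X c 0<c 0<y tr≤ c^≤det

-- Matrix products and the matrices a I + b J

x^2≃x*x : ∀ x → x ^ 2 ≃ x * x
x^2≃x*x x = *-congˡ x (*-identityʳ x)

≋-trans : ∀ {n} {A B C : Matrix n} → A ≋ B → B ≋ C → A ≋ C
≋-trans A≋B B≋C i j = ≃-trans (A≋B i j) (B≋C i j)

⊗-assoc : ∀ {n} (A B C : Matrix n) → (A ⊗ B) ⊗ C ≋ A ⊗ (B ⊗ C)
⊗-assoc A B C i j = begin
  sum (λ l → sum (λ k → A i k * B k l) * C l j)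
    ≈⟨ sum-cong (λ l → *-distribʳ-sum (C l j) (λ k → A i k * B k l)) ⟩
  sum (λ l → sum (λ k → A i k * B k l * C l j))
    ≈⟨ ∑-comm (λ l k → A i k * B k l * C l j) ⟩
  sum (λ k → sum (λ l → A i k * B k l * C l j))
    ≈⟨ sum-cong (λ k → sum-cong λ l → *-assoc (A i k) (B k l) (C l j)) ⟩
  sum (λ k → sum (λ l → A i k * (B k l * C l j)))
    ≈⟨ sum-cong (λ k → *-distribˡ-sum (A i k) (λ l → B k l * C l j)) ⟨
  sum (λ k → A i k * (B ⊗ C) k j) ∎
  where open ≃-Reasoning

⊗-ᵀ : ∀ {n} (A B : Matrix n) → (A ⊗ B) ᵀ ≋ B ᵀ ⊗ A ᵀ
⊗-ᵀ A B i j = sum-cong λ k → *-comm (A j k) (B k i)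

scaledI-⊗ : ∀ {n} c (A : Matrix n) → (c · I n) ⊗ A ≋ c · A
scaledI-⊗ {n} c A i j = begin
  sum (λ k → c * I n i k * A k j)    ≈⟨ sum-cong (λ k → *-assoc c (I n i k) (A k j)) ⟩
  sum (λ k → c * (I n i k * A k j))  ≈⟨ *-distribˡ-sum c (λ k → I n i k * A k j) ⟨
  c * sum (λ k → I n i k * A k j)    ≈⟨ *-congˡ c (sum-I i (λ k → A k j)) ⟩
  c * A i j                          ∎
  where open ≃-Reasoning

⊗-scaled : ∀ {n} c (A B : Matrix n) → A ⊗ (c · B) ≋ c · (A ⊗ B)
⊗-scaled c A B i j = ≃-trans
  (sum-cong λ k → x*[y*z]≃y*[x*z] (A i k) c (B k j)) (≃-sym (*-distribˡ-sum c (λ k → A i k * B k j)))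

-- Reassociation gives `P (X Xᵀ) Pᵀ`, from which the scalar can be pulled out.
Gram-⊗ : ∀ {n} (P X : Matrix n) {c} → Gram X ≋ c · I n → Gram (P ⊗ X) ≋ c · Gram P
Gram-⊗ P X {c} Gram-X =
  ≋-trans (⊗-cong {A = P ⊗ X} (λ _ _ → ≃-refl) (⊗-ᵀ P X))
  (≋-trans (⊗-assoc P X (X ᵀ ⊗ P ᵀ))
  (≋-trans (⊗-cong {A = P} (λ _ _ → ≃-refl) (λ i j → ≃-sym (⊗-assoc X (X ᵀ) (P ᵀ) i j)))
  (≋-trans (⊗-cong {A = P} (λ _ _ → ≃-refl)
    (≋-trans (⊗-cong {C = P ᵀ} Gram-X (λ _ _ → ≃-refl)) (scaledI-⊗ c (P ᵀ))))
  (⊗-scaled c P (P ᵀ)))))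

det-Gram : ∀ {n} (A : Matrix n) → det (Gram A) ≃ det A * det A
det-Gram A = ≃-trans (det-⊗ A (A ᵀ)) (*-congˡ (det A) (det-ᵀ A))

q≃trace : ∀ {n} (A : Matrix n) → q A ≃ sum (λ i → Gram A i i)
q≃trace A = sum-cong λ i → sum-cong λ j → x^2≃x*x (A i j)

row-aI+bJ : ∀ {n} a b i (x : Vector ℝ n) →
  sum (λ j → (a · I n ⊕ b · J n) i j * x j) ≃ a * x i + b * sum x
row-aI+bJ {n} a b i x = begin
  sum (λ j → (a * I n i j + b * 1ℝ) * x j)
    ≈⟨ sum-cong (λ j → lemma a b (I n i j) (x j)) ⟩
  sum (λ j → a * (I n i j * x j) + b * x j)
    ≈⟨ sum-linear a b (λ j → I n i j * x j) x ⟩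
  a * sum (λ j → I n i j * x j) + b * sum x
    ≈⟨ +-cong (*-congˡ a (sum-I i x)) ≃-refl ⟩
  a * x i + b * sum x ∎
  where
  open ≃-Reasoning
  lemma : ∀ a b e x → (a * e + b * 1ℝ) * x ≃ a * (e * x) + b * x
  lemma = solve 4 (λ a b e x → (a :* e :+ b :* con 1ℚ) :* x := a :* (e :* x) :+ b :* x) ≃-refl
    where open ℝ-solver

rowSum-aI+bJ : ∀ {n} a b i → rowSum (a · I n ⊕ b · J n) i ≃ a + fromℕ n * b
rowSum-aI+bJ {n} a b i = begin
  sum (λ j → (a · I n ⊕ b · J n) i j)
    ≈⟨ sum-cong (λ j → *-identityʳ ((a · I n ⊕ b · J n) i j)) ⟨
  sum (λ j → (a · I n ⊕ b · J n) i j * 1ℝ)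
    ≈⟨ row-aI+bJ a b i (λ _ → 1ℝ) ⟩
  a * 1ℝ + b * sum {n} (λ _ → 1ℝ)
    ≈⟨ +-congˡ _ (*-congˡ b (sum-const n 1ℝ)) ⟩
  a * 1ℝ + b * (fromℕ n * 1ℝ)
    ≈⟨ lemma a b (fromℕ n) ⟩
  a + fromℕ n * b ∎
  where
  open ≃-Reasoning
  lemma : ∀ a b n → a * 1ℝ + b * (n * 1ℝ) ≃ a + n * b
  lemma = solve 3 (λ a b n → a :* con 1ℚ :+ b :* (n :* con 1ℚ) := a :+ n :* b) ≃-refl
    where open ℝ-solver

aI+bJ-sym : ∀ n a b (i j : Fin n) → (a · I n ⊕ b · J n) i j ≃ (a · I n ⊕ b · J n) j i
aI+bJ-sym n a b i j = +-cong (*-congˡ a (I-sym i j)) ≃-refl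

aI+bJ-⊗ : ∀ n a b c d → (a · I n ⊕ b · J n) ⊗ (c · I n ⊕ d · J n) ≋
  (a * c) · I n ⊕ (a * d + b * (c + fromℕ n * d)) · J n
aI+bJ-⊗ n a b c d i j = begin
  ((a · I n ⊕ b · J n) ⊗ (c · I n ⊕ d · J n)) i j
    ≈⟨ row-aI+bJ a b i (λ k → (c · I n ⊕ d · J n) k j) ⟩
  a * (c * I n i j + d * 1ℝ) + b * sum (λ k → (c · I n ⊕ d · J n) k j)
    ≈⟨ +-congˡ _ (*-congˡ b (≃-trans (sum-cong λ k → aI+bJ-sym n c d k j) (rowSum-aI+bJ c d j))) ⟩
  a * (c * I n i j + d * 1ℝ) + b * (c + fromℕ n * d)
    ≈⟨ lemma a c d (I n i j) (b * (c + fromℕ n * d)) ⟩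
  a * c * I n i j + (a * d + b * (c + fromℕ n * d)) * 1ℝ ∎
  where
  open ≃-Reasoning
  lemma : ∀ a c d e f → a * (c * e + d * 1ℝ) + f ≃ a * c * e + (a * d + f) * 1ℝ
  lemma = solve 5 (λ a c d e f →
    a :* (c :* e :+ d :* con 1ℚ) :+ f := a :* c :* e :+ (a :* d :+ f) :* con 1ℚ) ≃-refl
    where open ℝ-solver

-- Adding all rows to the first, and then subtracting the first column from the
-- others, makes a I + b J triangular; P records the row operation.

det-aI+bJ : ∀ k a b → det (a · I (suc k) ⊕ b · J (suc k)) ≃ (a + fromℕ (suc k) * b) * a ^ k
det-aI+bJ k a b = begin
  det N                                   ≈⟨ *-identityˡ (det N) ⟨
  1ℝ * det N                              ≈⟨ *-cong det-P ≃-refl ⟨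
  det P * det N                           ≈⟨ det-⊗ P N ⟨
  det (P ⊗ N)                             ≈⟨ det-cong PN≋TP ⟩
  det (T ⊗ P)                             ≈⟨ det-⊗ T P ⟩
  det T * det P                           ≈⟨ *-cong det-T det-P ⟩
  (a + fromℕ (suc k) * b) * a ^ k * 1ℝ    ≈⟨ *-identityʳ _ ⟩
  (a + fromℕ (suc k) * b) * a ^ k         ∎
  where
  open ≃-Reasoning
  e : ℝ
  e = a + fromℕ (suc k) * b
  N P T : Matrix (suc k)
  N = a · I (suc k) ⊕ b · J (suc k)
  P zero    = λ _ → 1ℝ
  P (suc i) = I (suc k) (suc i)
  T zero    = (e · I (suc k)) zero
  T (suc i) = b ∷ (a · I k) i
  det-P : det P ≃ 1ℝ
  det-P = begin
    det P                                   ≈⟨ det-ᵀ P ⟨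
    det (P ᵀ)                               ≈⟨ det-block (P ᵀ) (λ _ → ≃-refl) ⟩
    1ℝ * det (λ i j → P (suc j) (suc i))    ≈⟨ *-identityˡ _ ⟩
    det (λ i j → P (suc j) (suc i))
      ≈⟨ det-cong {k} (λ i j → ≃-trans (I-suc j i) (I-sym j i)) ⟩
    det (I k)                               ≈⟨ det-I k ⟩
    1ℝ                                      ∎
  det-T : det T ≃ e * a ^ k
  det-T = ≃-trans (det-block T λ _ → *-zeroʳ e)
    (*-cong (≃-trans (*-congˡ e (I-refl {suc k} zero)) (*-identityʳ e)) (det-scaledI k a))
  PN≋TP : P ⊗ N ≋ T ⊗ P
  PN≋TP zero j = begin
    sum (λ i → 1ℝ * N i j)  ≈⟨ sum-cong (λ i → ≃-trans (*-identityˡ _) (aI+bJ-sym (suc k) a b i j)) ⟩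
    rowSum N j              ≈⟨ rowSum-aI+bJ a b j ⟩
    e                       ≈⟨ *-identityʳ e ⟨
    e * 1ℝ                  ≈⟨ scaledI-⊗ e P zero j ⟨
    (T ⊗ P) zero j          ∎
  PN≋TP (suc i) j = begin
    (P ⊗ N) (suc i) j                            ≈⟨ sum-I (suc i) (λ l → N l j) ⟩
    a * I (suc k) (suc i) j + b * 1ℝ             ≈⟨ +-comm _ _ ⟩
    b * 1ℝ + a * I (suc k) (suc i) j             ≈⟨ +-congˡ _ (*-congˡ a (sum-I i (λ l → P (suc l) j))) ⟨
    b * 1ℝ + a * sum (λ l → I k i l * P (suc l) j)
      ≈⟨ +-congˡ _ (*-distribˡ-sum a (λ l → I k i l * P (suc l) j)) ⟩
    b * 1ℝ + sum (λ l → a * (I k i l * P (suc l) j))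
      ≈⟨ +-congˡ _ (sum-cong λ l → *-assoc a (I k i l) (P (suc l) j)) ⟨
    (T ⊗ P) (suc i) j                            ∎

-- Matrices of maximal determinant

module Maximal {m α β} (M : Matrix (suc (suc m))) (maximal : HasMaximalDet _ α β M) where

  -- Keeps both constraints and negates the determinant, so that `det M` also bounds `- det N`. Two
  -- rows exist because `n ≥ 2`.
  exchange : Matrix (suc (suc m)) → Matrix (suc (suc m))
  exchange N = N (suc zero) ∷ N zero ∷ (λ i → N (suc (suc i)))

  det-exchange : ∀ N → det (exchange N) ≃ - det N
  det-exchange N = Alternating.swap (det-alternating {suc (suc m)}) here {exchange N} {N} (swapped
    (λ _ → ≃-refl) (λ _ → ≃-refl)
    λ { zero 0≢0 _ → contradiction ≡.refl 0≢0
      ; (suc zero) _ 1≢1 → contradiction ≡.refl 1≢1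
      ; (suc (suc i)) _ _ _ → ≃-refl })

  -det≤ : ∀ N → 𝕄 _ α β N → - det N ≤ det M
  -det≤ N (sN , qN) = ≤-respˡ (det-exchange N) (proj₂ maximal (exchange N)
    (≃-trans (x+[y+z]≃y+[x+z] _ _ _) sN , ≃-trans (x+[y+z]≃y+[x+z] _ _ _) qN))

  0≤det : 0ℝ ≤ det M
  0≤det = *-cancelˡ-≤ 0<2 (≤-respˡ (≃-sym (*-zeroʳ (1ℝ + 1ℝ))) (0≤⇒≤ (lemma (det M))
    (≤⇒0≤ (-det≤ M (proj₁ maximal)))))
    where
    0<2 : 0ℝ < 1ℝ + 1ℝ
    0<2 = 0<x+y 0<1 (<⇒≤ 0<1)
    lemma : ∀ x → x - - x ≃ (1ℝ + 1ℝ) * x - 0ℝ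
    lemma = solve 1 (λ x → x :- :- x := (con 1ℚ :+ con 1ℚ) :* x :- con 0ℚ) ≃-refl
      where open ℝ-solver

  det²≤det² : ∀ N → 𝕄 _ α β N → det N * det N ≤ det M * det M
  det²≤det² N N∈𝕄 = 0≤⇒≤ (lemma (det M) (det N))
    (0≤x*y (≤⇒0≤ (proj₂ maximal N N∈𝕄)) (≤⇒0≤ (-det≤ N N∈𝕄)))
    where
    lemma : ∀ x d → (x - d) * (x - - d) ≃ x * x - d * d
    lemma = solve 2 (λ x d → (x :- d) :* (x :- :- d) := x :* x :- d :* d) ≃-refl
      where open ℝ-solver

x*x≤y*y⇒x≤y : ∀ {x y} → 0ℝ ≤ y → x * x ≤ y * y → x ≤ y
x*x≤y*y⇒x≤y {x} {y} 0≤y x²≤y² = ≮⇒≥ λ y<x → <⇒≱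
  (0<⇒< (lemma x y) (0<x*y (<⇒0< y<x) (0<x+y (≤-<-trans 0≤y y<x) 0≤y))) x²≤y²
  where
  open ℝ-solver
  lemma : ∀ x y → (x - y) * (x + y) ≃ x * x - y * y
  lemma = solve 2 (λ x y → (x :- y) :* (x :+ y) := x :* x :- y :* y) ≃-refl

-- The case `α² ≤ β`: a scaled reflection

module SmallSum {m α β} (0<β : 0ℝ < β) (M : Matrix (suc (suc m)))
  (maximal : HasMaximalDet _ α β M) (α²≤β : α ^ 2 ≤ β) where

  open Maximal M maximal
  open ≃-Reasoning

  n : ℕ
  n = suc (suc m)

  ρ : ℝ
  ρ = proj₁ (√ (<⇒≤ 0<β))
  0≤ρ : 0ℝ ≤ ρ
  0≤ρ = proj₁ (proj₂ (√ (<⇒≤ 0<β)))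
  ρ²≃β : ρ * ρ ≃ β
  ρ²≃β = proj₂ (proj₂ (√ (<⇒≤ 0<β)))

  α²≤ρ² : α * α ≤ ρ * ρ
  α²≤ρ² = ≤-respˡ (x^2≃x*x α) (≤-respʳ (≃-sym ρ²≃β) α²≤β)

  -- Radicand of `x`. The entries of `ρ I - v vᵀ` sum up to `n ρ - (sum v)²`, which has to be `n α`;
  -- if `x` is the mean of the entries of `v`, this means `n x² = ρ - α`.
  0≤x² : 0ℝ ≤ (ρ - α) * fromℚ (+ 1 ℚ./ n)
  0≤x² = *-cancelˡ-≤ (0<fromℕ (suc m)) (≤-respˡ (≃-sym (*-zeroʳ _)) (≤-respʳ
    (begin
      ρ - α                                      ≈⟨ *-identityʳ (ρ - α) ⟨
      (ρ - α) * 1ℝ                               ≈⟨ *-congˡ _ (fromℕ*1/n (suc m)) ⟨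
      (ρ - α) * (fromℕ n * fromℚ (+ 1 ℚ./ n))    ≈⟨ x*[y*z]≃y*[x*z] (ρ - α) (fromℕ n) _ ⟩
      fromℕ n * ((ρ - α) * fromℚ (+ 1 ℚ./ n))    ∎)
    (≤⇒0≤ (x*x≤y*y⇒x≤y 0≤ρ α²≤ρ²))))

  -- Radicand of `y`: the condition `n x² + 2 y² = 2 ρ` on the squared length of `v` leaves
  -- `y² = (ρ + α) / 2`.
  0≤y² : 0ℝ ≤ fromℚ ½ * (ρ - - α)
  0≤y² = 0≤x*y (<⇒≤ (0<fromℚ (ℚ.positive⁻¹ ½))) (≤⇒0≤ (x*x≤y*y⇒x≤y 0≤ρ (≤-respˡ (≃-sym (-x*-x≃x*x α)) α²≤ρ²)))

  x y : ℝ
  x = proj₁ (√ 0≤x²)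
  y = proj₁ (√ 0≤y²)

  n*x²≃ρ-α : fromℕ n * (x * x) ≃ ρ - α
  n*x²≃ρ-α = begin
    fromℕ n * (x * x)                          ≈⟨ *-congˡ _ (proj₂ (proj₂ (√ 0≤x²))) ⟩
    fromℕ n * ((ρ - α) * fromℚ (+ 1 ℚ./ n))    ≈⟨ x*[y*z]≃y*[x*z] (fromℕ n) (ρ - α) _ ⟩
    (ρ - α) * (fromℕ n * fromℚ (+ 1 ℚ./ n))    ≈⟨ *-congˡ _ (fromℕ*1/n (suc m)) ⟩
    (ρ - α) * 1ℝ                               ≈⟨ *-identityʳ (ρ - α) ⟩
    ρ - α                                      ∎

  -- Shifting two entries by `y` in opposite directions adjusts the length without changing the sum.
  v : Vector ℝ n
  v = (x + y) ∷ (x - y) ∷ λ _ → x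

  fromℕ-n : fromℕ n ≃ 1ℝ + (1ℝ + fromℕ m)
  fromℕ-n = ≃-trans (fromℕ-suc (suc m)) (+-congˡ 1ℝ (fromℕ-suc m))

  sum-v : sum v ≃ fromℕ n * x
  sum-v = begin
    (x + y) + ((x - y) + sum {m} (λ _ → x))  ≈⟨ +-congˡ _ (+-congˡ _ (sum-const m x)) ⟩
    (x + y) + ((x - y) + fromℕ m * x)        ≈⟨ lemma x y (fromℕ m) ⟩
    (1ℝ + (1ℝ + fromℕ m)) * x                ≈⟨ *-cong fromℕ-n ≃-refl ⟨
    fromℕ n * x                              ∎
    where
    lemma : ∀ x y k → (x + y) + ((x - y) + k * x) ≃ (1ℝ + (1ℝ + k)) * x
    lemma = solve 3 (λ x y k →
      (x :+ y) :+ ((x :- y) :+ k :* x) := (con 1ℚ :+ (con 1ℚ :+ k)) :* x) ≃-refl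
      where open ℝ-solver

  dot-v : dot v v ≃ ρ + ρ
  dot-v = begin
    (x + y) * (x + y) + ((x - y) * (x - y) + sum {m} (λ _ → x * x))
      ≈⟨ +-congˡ _ (+-congˡ _ (sum-const m (x * x))) ⟩
    (x + y) * (x + y) + ((x - y) * (x - y) + fromℕ m * (x * x))
      ≈⟨ lemma₁ x y (fromℕ m) ⟩
    (1ℝ + (1ℝ + fromℕ m)) * (x * x) + fromℚ (+ 2 ℚ./ 1) * (y * y)
      ≈⟨ +-cong (≃-trans (*-cong (≃-sym fromℕ-n) ≃-refl) n*x²≃ρ-α)
           (*-congˡ _ (proj₂ (proj₂ (√ 0≤y²)))) ⟩
    ρ - α + fromℚ (+ 2 ℚ./ 1) * (fromℚ ½ * (ρ - - α))
      ≈⟨ lemma₂ ρ α ⟩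
    ρ + ρ ∎
    where
    lemma₁ : ∀ x y k → (x + y) * (x + y) + ((x - y) * (x - y) + k * (x * x)) ≃
      (1ℝ + (1ℝ + k)) * (x * x) + fromℚ (+ 2 ℚ./ 1) * (y * y)
    lemma₁ = solve 3 (λ x y k → (x :+ y) :* (x :+ y) :+ ((x :- y) :* (x :- y) :+ k :* (x :* x)) :=
      (con 1ℚ :+ (con 1ℚ :+ k)) :* (x :* x) :+ con (+ 2 ℚ./ 1) :* (y :* y)) ≃-refl
      where open ℝ-solver
    lemma₂ : ∀ ρ α → ρ - α + fromℚ (+ 2 ℚ./ 1) * (fromℚ ½ * (ρ - - α)) ≃ ρ + ρ
    lemma₂ = solve 2 (λ ρ α → ρ :- α :+ con (+ 2 ℚ./ 1) :* (con ½ :* (ρ :- :- α)) := ρ :+ ρ) ≃-refl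
      where open ℝ-solver

  -- `ρ` times the reflection along `v`: as `|v|² = 2 ρ`, the usual factor `2 / |v|²` is `1 / ρ` and
  -- cancels.
  N : Matrix n
  N i j = ρ * I n i j + (- v i) * v j

  dot-N : ∀ i u → dot (N i) u ≃ ρ * u i + (- v i) * dot v u
  dot-N i u = ≃-trans (dot-linear ρ (- v i) (I n i) v u) (+-cong (*-congˡ ρ (sum-I i u)) ≃-refl)

  Gram-N : Gram N ≋ β · I n
  Gram-N i j = begin
    dot (N i) (N j)
      ≈⟨ dot-N i (N j) ⟩
    ρ * (ρ * I n j i + (- v j) * v i) + (- v i) * dot v (N j)
      ≈⟨ +-congˡ _ (*-congˡ (- v i) (≃-trans (dot-comm v (N j)) (≃-trans (dot-N j v)
           (+-congˡ _ (*-congˡ (- v j) dot-v))))) ⟩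
    ρ * (ρ * I n j i + (- v j) * v i) + (- v i) * (ρ * v j + (- v j) * (ρ + ρ))
      ≈⟨ lemma ρ (I n j i) (v i) (v j) ⟩
    ρ * ρ * I n j i
      ≈⟨ *-cong ρ²≃β (I-sym j i) ⟩
    β * I n i j ∎
    where
    lemma : ∀ ρ e a b → ρ * (ρ * e + (- b) * a) + (- a) * (ρ * b + (- b) * (ρ + ρ)) ≃ ρ * ρ * e
    lemma = solve 4 (λ ρ e a b →
      ρ :* (ρ :* e :+ (:- b) :* a) :+ (:- a) :* (ρ :* b :+ (:- b) :* (ρ :+ ρ)) := ρ :* ρ :* e) ≃-refl
      where open ℝ-solver

  N∈𝕄 : 𝕄 n α β N
  N∈𝕄 = s-N , q-N
    where
    row : ∀ i → rowSum N i ≃ ρ * 1ℝ + (- sum v) * v i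
    row i = begin
      rowSum N i                          ≈⟨ sum-cong (λ j → *-identityʳ (N i j)) ⟨
      dot (N i) (λ _ → 1ℝ)                ≈⟨ dot-N i (λ _ → 1ℝ) ⟩
      ρ * 1ℝ + (- v i) * dot v (λ _ → 1ℝ) ≈⟨ +-congˡ _ (*-congˡ _ (sum-cong λ j → *-identityʳ (v j))) ⟩
      ρ * 1ℝ + (- v i) * sum v            ≈⟨ +-congˡ _ (lemma (v i) (sum v)) ⟩
      ρ * 1ℝ + (- sum v) * v i            ∎
      where
      lemma : ∀ a b → (- a) * b ≃ (- b) * a
      lemma = solve 2 (λ a b → (:- a) :* b := (:- b) :* a) ≃-refl
        where open ℝ-solver
    s-N : s N ≃ fromℕ n * α
    s-N = begin
      s N
        ≈⟨ sum-cong row ⟩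
      sum (λ i → ρ * 1ℝ + (- sum v) * v i)
        ≈⟨ sum-linear ρ (- sum v) (λ _ → 1ℝ) v ⟩
      ρ * sum {n} (λ _ → 1ℝ) + (- sum v) * sum v
        ≈⟨ +-cong (*-congˡ ρ (sum-const n 1ℝ)) (*-cong (-‿cong sum-v) sum-v) ⟩
      ρ * (fromℕ n * 1ℝ) + (- (fromℕ n * x)) * (fromℕ n * x)
        ≈⟨ lemma₁ ρ (fromℕ n) x ⟩
      fromℕ n * (ρ - fromℕ n * (x * x))
        ≈⟨ *-congˡ _ (+-congˡ ρ (-‿cong n*x²≃ρ-α)) ⟩
      fromℕ n * (ρ - (ρ - α))
        ≈⟨ *-congˡ _ (lemma₂ ρ α) ⟩
      fromℕ n * α ∎
      where
      lemma₁ : ∀ ρ n x → ρ * (n * 1ℝ) + (- (n * x)) * (n * x) ≃ n * (ρ - n * (x * x))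
      lemma₁ = solve 3 (λ ρ n x →
        ρ :* (n :* con 1ℚ) :+ (:- (n :* x)) :* (n :* x) := n :* (ρ :- n :* (x :* x))) ≃-refl
        where open ℝ-solver
      lemma₂ : ∀ ρ α → ρ - (ρ - α) ≃ α
      lemma₂ = solve 2 (λ ρ α → ρ :- (ρ :- α) := α) ≃-refl
        where open ℝ-solver
    q-N : q N ≃ fromℕ n * β
    q-N = ≃-trans (q≃trace N) (≃-trans
      (sum-cong λ i → ≃-trans (Gram-N i i) (≃-trans (*-congˡ β (I-refl i)) (*-identityʳ β)))
      (sum-const n β))

  Gram-M : Gram M ≋ β · I n
  Gram-M = hadamard-equality n M β (<⇒≤ 0<β)
    (≤-reflexive (≃-trans (≃-sym (q≃trace M)) (proj₂ (proj₁ maximal))))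
    (≤-respˡ (≃-trans (≃-sym (det-Gram N)) (≃-trans (det-cong Gram-N) (det-scaledI n β)))
      (≤-respʳ (≃-sym (det-Gram M)) (det²≤det² N N∈𝕄)))

  det-M : IsHalfPower β n (det M)
  det-M = ρ , 0≤ρ , ≃-trans (x^2≃x*x ρ) ρ²≃β , x*x≃y*y⇒x≃y 0≤det (0≤^ n 0≤ρ) (begin
    det M * det M    ≈⟨ det-Gram M ⟨
    det (Gram M)     ≈⟨ det-cong Gram-M ⟩
    det (β · I n)    ≈⟨ det-scaledI n β ⟩
    β ^ n            ≈⟨ ^-cong n ρ²≃β ⟨
    (ρ * ρ) ^ n      ≈⟨ ^-distrib-* n ρ ρ ⟩
    ρ ^ n * ρ ^ n    ∎)

-- The case `α² ≥ β`: comparison with `r I + b J`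

module LargeSum {m α β} (0<β : 0ℝ < β) (α²<nβ : α ^ 2 < fromℕ (suc (suc m)) * β)
  (M : Matrix (suc (suc m))) (maximal : HasMaximalDet _ α β M) (β≤α² : β ≤ α ^ 2) where

  open Maximal M maximal
  open ≃-Reasoning

  n : ℕ
  n = suc (suc m)

  δ′ γ ν ι : ℝ
  δ′ = δ n α β
  γ = β - δ′
  ν = fromℕ (suc m)
  ι = fromℚ (+ 1 ℚ./ suc m)

  0<α² : 0ℝ < α * α
  0<α² = <-respʳ (x^2≃x*x α) (<-≤-trans 0<β β≤α²)

  νδ≃α²-β : ν * δ′ ≃ α * α - β
  νδ≃α²-β = begin
    ν * ((α ^ 2 - β) * ι)  ≈⟨ lemma ν (α ^ 2 - β) ι ⟩
    (ν * ι) * (α ^ 2 - β)  ≈⟨ *-cong (fromℕ*1/n m) (+-cong (x^2≃x*x α) ≃-refl) ⟩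
    1ℝ * (α * α - β)       ≈⟨ *-identityˡ _ ⟩
    α * α - β              ∎
    where
    lemma : ∀ a b c → a * (b * c) ≃ (a * c) * b
    lemma = solve 3 (λ a b c → a :* (b :* c) := (a :* c) :* b) ≃-refl
      where open ℝ-solver

  νγ≃nβ-α² : ν * γ ≃ fromℕ n * β - α * α
  νγ≃nβ-α² = begin
    ν * (β - δ′)                ≈⟨ lemma₁ ν β δ′ ⟩
    ν * β - ν * δ′              ≈⟨ +-congˡ _ (-‿cong νδ≃α²-β) ⟩
    ν * β - (α * α - β)         ≈⟨ lemma₂ ν β (α * α) ⟩
    (1ℝ + ν) * β - α * α        ≈⟨ +-cong (*-cong (fromℕ-suc (suc m)) ≃-refl) ≃-refl ⟨
    fromℕ n * β - α * α         ∎
    where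
    lemma₁ : ∀ ν β d → ν * (β - d) ≃ ν * β - ν * d
    lemma₁ = solve 3 (λ ν β d → ν :* (β :- d) := ν :* β :- ν :* d) ≃-refl
      where open ℝ-solver
    lemma₂ : ∀ ν β a → ν * β - (a - β) ≃ (1ℝ + ν) * β - a
    lemma₂ = solve 3 (λ ν β a → ν :* β :- (a :- β) := (con 1ℚ :+ ν) :* β :- a) ≃-refl
      where open ℝ-solver

  γ≃ : γ ≃ (fromℕ n * β - α ^ 2) /[ n -1]
  γ≃ = begin
    γ                                ≈⟨ *-identityˡ γ ⟨
    1ℝ * γ                           ≈⟨ *-cong (fromℕ*1/n m) ≃-refl ⟨
    (ν * ι) * γ                      ≈⟨ lemma ν ι γ ⟩
    (ν * γ) * ι                      ≈⟨ *-cong νγ≃nβ-α² ≃-refl ⟩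
    (fromℕ n * β - α * α) * ι        ≈⟨ *-cong (+-congˡ _ (-‿cong (x^2≃x*x α))) ≃-refl ⟨
    (fromℕ n * β - α ^ 2) * ι        ∎
    where
    lemma : ∀ a b c → (a * b) * c ≃ (a * c) * b
    lemma = solve 3 (λ a b c → (a :* b) :* c := (a :* c) :* b) ≃-refl
      where open ℝ-solver

  -- The strict bound `α² < n β` enters here; it makes `c` positive and hence cancellable.
  0<γ : 0ℝ < γ
  0<γ = 0<⇒< (lemma γ) (0<ν*⇒0< (<-respʳ (≃-sym νγ≃nβ-α²)
    (<-respʳ (+-congˡ _ (-‿cong (x^2≃x*x α))) (<⇒0< α²<nβ))))
    where
    lemma : ∀ a → a ≃ a - 0ℝ
    lemma = solve 1 (λ a → a := a :- con 0ℚ) ≃-refl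
      where open ℝ-solver
    0<ι : 0ℝ < ι
    0<ι = 0<fromℚ (ℚ.positive⁻¹ _ {{ℚ.normalize-pos 1 (suc m)}})
    0<ν*⇒0< : 0ℝ < ν * γ → 0ℝ < γ
    0<ν*⇒0< 0<νγ = <-respʳ (≃-trans (rearrange ν ι γ)
      (≃-trans (*-cong (fromℕ*1/n m) ≃-refl) (*-identityˡ γ))) (0<x*y 0<ι 0<νγ)
      where
      rearrange : ∀ a b c → b * (a * c) ≃ (a * b) * c
      rearrange = solve 3 (λ a b c → b :* (a :* c) := (a :* b) :* c) ≃-refl
        where open ℝ-solver

  0≤δ : 0ℝ ≤ δ′
  0≤δ = *-cancelˡ-≤ (0<fromℕ m) (≤-respˡ (≃-sym (*-zeroʳ ν)) (≤-respʳ (≃-sym νδ≃α²-β)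
    (≤⇒0≤ (≤-respʳ (x^2≃x*x α) β≤α²))))

  r : ℝ
  r = proj₁ (√ (<⇒≤ 0<γ))
  0≤r : 0ℝ ≤ r
  0≤r = proj₁ (proj₂ (√ (<⇒≤ 0<γ)))
  r²≃γ : r * r ≃ γ
  r²≃γ = proj₂ (proj₂ (√ (<⇒≤ 0<γ)))

  -- Chosen so that the row sums `r + n b` of `N` are `α`.
  b : ℝ
  b = (α - r) * fromℚ (+ 1 ℚ./ n)

  nb≃α-r : fromℕ n * b ≃ α - r
  nb≃α-r = begin
    fromℕ n * ((α - r) * fromℚ (+ 1 ℚ./ n))  ≈⟨ x*[y*z]≃y*[x*z] (fromℕ n) (α - r) _ ⟩
    (α - r) * (fromℕ n * fromℚ (+ 1 ℚ./ n))  ≈⟨ *-congˡ _ (fromℕ*1/n (suc m)) ⟩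
    (α - r) * 1ℝ                             ≈⟨ *-identityʳ (α - r) ⟩
    α - r                                    ∎

  -- On the all-ones vector `N` acts as `α`, and `N Nᵀ` as this number.
  γ+nδ≃α² : γ + fromℕ n * δ′ ≃ α * α
  γ+nδ≃α² = begin
    β - δ′ + fromℕ n * δ′       ≈⟨ +-congˡ _ (*-cong (fromℕ-suc (suc m)) ≃-refl) ⟩
    β - δ′ + (1ℝ + ν) * δ′      ≈⟨ lemma₁ β δ′ ν ⟩
    β + ν * δ′                  ≈⟨ +-congˡ β νδ≃α²-β ⟩
    β + (α * α - β)             ≈⟨ lemma₂ β (α * α) ⟩
    α * α                       ∎
    where
    lemma₁ : ∀ β d ν → β - d + (1ℝ + ν) * d ≃ β + ν * d
    lemma₁ = solve 3 (λ β d ν → β :- d :+ (con 1ℚ :+ ν) :* d := β :+ ν :* d) ≃-refl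
      where open ℝ-solver
    lemma₂ : ∀ β a → β + (a - β) ≃ a
    lemma₂ = solve 2 (λ β a → β :+ (a :- β) := a) ≃-refl
      where open ℝ-solver

  -- This is the coefficient of `J` in `N²` and, negated, in `B²`: both `2 r b + n b²` and
  -- `2 α b - n b²` reduce to `b (r + α)` by `n b = α - r`.
  b[r+α]≃δ : b * (r + α) ≃ δ′
  b[r+α]≃δ = *-cancelˡ-≃ (0<fromℕ (suc m)) (begin
    fromℕ n * (b * (r + α))         ≈⟨ *-assoc _ _ _ ⟨
    fromℕ n * b * (r + α)           ≈⟨ *-cong nb≃α-r ≃-refl ⟩
    (α - r) * (r + α)               ≈⟨ lemma₁ α r ⟩
    α * α - r * r                   ≈⟨ +-cong (≃-sym γ+nδ≃α²) (-‿cong r²≃γ) ⟩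
    γ + fromℕ n * δ′ - γ            ≈⟨ lemma₂ γ (fromℕ n * δ′) ⟩
    fromℕ n * δ′                    ∎)
    where
    lemma₁ : ∀ α r → (α - r) * (r + α) ≃ α * α - r * r
    lemma₁ = solve 2 (λ α r → (α :- r) :* (r :+ α) := α :* α :- r :* r) ≃-refl
      where open ℝ-solver
    lemma₂ : ∀ γ d → γ + d - γ ≃ d
    lemma₂ = solve 2 (λ γ d → γ :+ d :- γ := d) ≃-refl
      where open ℝ-solver

  N B : Matrix n
  N = r · I n ⊕ b · J n
  B = α · I n ⊕ (- b) · J n

  B⊗N : B ⊗ N ≋ (α * r) · I n
  B⊗N i j = begin
    (B ⊗ N) i j
      ≈⟨ aI+bJ-⊗ n α (- b) r b i j ⟩
    α * r * I n i j + (α * b + (- b) * (r + fromℕ n * b)) * 1ℝ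
      ≈⟨ +-congˡ _ (*-cong (+-congˡ _ (*-congˡ _ (+-congˡ r nb≃α-r))) ≃-refl) ⟩
    α * r * I n i j + (α * b + (- b) * (r + (α - r))) * 1ℝ
      ≈⟨ lemma α r b (I n i j) ⟩
    α * r * I n i j ∎
    where
    lemma : ∀ α r b e → α * r * e + (α * b + (- b) * (r + (α - r))) * 1ℝ ≃ α * r * e
    lemma = solve 4 (λ α r b e →
      α :* r :* e :+ (α :* b :+ (:- b) :* (r :+ (α :- r))) :* con 1ℚ := α :* r :* e) ≃-refl
      where open ℝ-solver

  N⊗B : N ⊗ B ≋ (α * r) · I n
  N⊗B i j = begin
    (N ⊗ B) i j
      ≈⟨ aI+bJ-⊗ n r b α (- b) i j ⟩
    r * α * I n i j + (r * (- b) + b * (α + fromℕ n * (- b))) * 1ℝ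
      ≈⟨ lemma₁ α r b (fromℕ n) (I n i j) ⟩
    r * α * I n i j + (r * (- b) + b * (α - fromℕ n * b)) * 1ℝ
      ≈⟨ +-congˡ _ (*-cong (+-congˡ _ (*-congˡ b (+-congˡ α (-‿cong nb≃α-r)))) ≃-refl) ⟩
    r * α * I n i j + (r * (- b) + b * (α - (α - r))) * 1ℝ
      ≈⟨ lemma₂ α r b (I n i j) ⟩
    α * r * I n i j ∎
    where
    lemma₁ : ∀ α r b n e → r * α * e + (r * (- b) + b * (α + n * (- b))) * 1ℝ ≃
      r * α * e + (r * (- b) + b * (α - n * b)) * 1ℝ
    lemma₁ = solve 5 (λ α r b n e → r :* α :* e :+ (r :* (:- b) :+ b :* (α :+ n :* (:- b))) :* con 1ℚ
      := r :* α :* e :+ (r :* (:- b) :+ b :* (α :- n :* b)) :* con 1ℚ) ≃-refl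
      where open ℝ-solver
    lemma₂ : ∀ α r b e → r * α * e + (r * (- b) + b * (α - (α - r))) * 1ℝ ≃ α * r * e
    lemma₂ = solve 4 (λ α r b e →
      r :* α :* e :+ (r :* (:- b) :+ b :* (α :- (α :- r))) :* con 1ℚ := α :* r :* e) ≃-refl
      where open ℝ-solver

  Gram-N : Gram N ≋ γ · I n ⊕ δ′ · J n
  Gram-N i j = begin
    dot (N i) (N j)
      ≈⟨ sum-cong (λ k → *-congˡ (N i k) (aI+bJ-sym n r b j k)) ⟩
    (N ⊗ N) i j
      ≈⟨ aI+bJ-⊗ n r b r b i j ⟩
    r * r * I n i j + (r * b + b * (r + fromℕ n * b)) * 1ℝ
      ≈⟨ +-cong (*-cong r²≃γ ≃-refl) (*-cong (+-congˡ _ (*-congˡ b (+-congˡ r nb≃α-r))) ≃-refl) ⟩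
    γ * I n i j + (r * b + b * (r + (α - r))) * 1ℝ
      ≈⟨ +-congˡ _ (*-cong (≃-trans (lemma α r b) b[r+α]≃δ) ≃-refl) ⟩
    γ * I n i j + δ′ * 1ℝ ∎
    where
    lemma : ∀ α r b → r * b + b * (r + (α - r)) ≃ b * (r + α)
    lemma = solve 3 (λ α r b → r :* b :+ b :* (r :+ (α :- r)) := b :* (r :+ α)) ≃-refl
      where open ℝ-solver

  N∈𝕄 : 𝕄 n α β N
  N∈𝕄 =
    ≃-trans (sum-cong λ i → ≃-trans (rowSum-aI+bJ {n} r b i) (≃-trans (+-congˡ r nb≃α-r) (lemma₁ r α)))
      (sum-const n α) ,
    ≃-trans (q≃trace N) (≃-trans
      (sum-cong λ i → ≃-trans (Gram-N i i)
        (≃-trans (+-cong (*-congˡ γ (I-refl i)) ≃-refl) (lemma₂ β δ′)))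
      (sum-const n β))
    where
    lemma₁ : ∀ r α → r + (α - r) ≃ α
    lemma₁ = solve 2 (λ r α → r :+ (α :- r) := α) ≃-refl
      where open ℝ-solver
    lemma₂ : ∀ β d → (β - d) * 1ℝ + d * 1ℝ ≃ β
    lemma₂ = solve 2 (λ β d → (β :- d) :* con 1ℚ :+ d :* con 1ℚ := β) ≃-refl
      where open ℝ-solver

  C : Vector ℝ n
  C = colSum M

  -- Applied to the all-ones vector, `Mᵀ` gives the column sums, so `M Mᵀ` gives `M C`.
  rowSum-Gram : ∀ i → rowSum (Gram M) i ≃ dot (M i) C
  rowSum-Gram i = begin
    sum (λ j → sum λ k → M i k * M j k)  ≈⟨ ∑-comm (λ j k → M i k * M j k) ⟩
    sum (λ k → sum λ j → M i k * M j k)  ≈⟨ sum-cong (λ k → *-distribˡ-sum (M i k) (λ j → M j k)) ⟨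
    dot (M i) C                          ∎

  ∑dot≃dotC : sum (λ i → dot (M i) C) ≃ dot C C
  ∑dot≃dotC = begin
    sum (λ i → sum λ k → M i k * C k)    ≈⟨ ∑-comm (λ i k → M i k * C k) ⟩
    sum (λ k → sum λ i → M i k * C k)    ≈⟨ sum-cong (λ k → *-distribʳ-sum (C k) (λ i → M i k)) ⟨
    dot C C                              ∎

  sum-C : sum C ≃ fromℕ n * α
  sum-C = ≃-trans (∑-comm (λ j i → M i j)) (proj₁ (proj₁ maximal))

  -- The prescribed sum makes `α` the mean of the column sums, so the mixed terms contribute
  -- `- 2 n α²`.
  variance : sum (λ j → (C j - α) * (C j - α)) ≃ dot C C - fromℕ n * (α * α)
  variance = begin
    sum (λ j → (C j - α) * (C j - α))
      ≈⟨ sum-cong (λ j → lemma₁ (C j) α) ⟩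
    -- The factors `1ℝ` bring the summands into the shape that `sum-linear` expects.
    sum (λ j → 1ℝ * (C j * C j) + 1ℝ * ((- α - α) * C j + (α * α) * 1ℝ))
      ≈⟨ sum-linear 1ℝ 1ℝ (λ j → C j * C j) (λ j → (- α - α) * C j + (α * α) * 1ℝ) ⟩
    1ℝ * dot C C + 1ℝ * sum (λ j → (- α - α) * C j + (α * α) * 1ℝ)
      ≈⟨ +-congˡ _ (*-congˡ 1ℝ (sum-linear (- α - α) (α * α) C (λ _ → 1ℝ))) ⟩
    1ℝ * dot C C + 1ℝ * ((- α - α) * sum C + (α * α) * sum {n} (λ _ → 1ℝ))
      ≈⟨ +-congˡ _ (*-congˡ 1ℝ (+-cong (*-congˡ _ sum-C) (*-congˡ _ (sum-const n 1ℝ)))) ⟩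
    1ℝ * dot C C + 1ℝ * ((- α - α) * (fromℕ n * α) + (α * α) * (fromℕ n * 1ℝ))
      ≈⟨ lemma₂ (dot C C) α (fromℕ n) ⟩
    dot C C - fromℕ n * (α * α) ∎
    where
    lemma₁ : ∀ c α → (c - α) * (c - α) ≃ 1ℝ * (c * c) + 1ℝ * ((- α - α) * c + (α * α) * 1ℝ)
    lemma₁ = solve 2 (λ c α → (c :- α) :* (c :- α) :=
      con 1ℚ :* (c :* c) :+ con 1ℚ :* ((:- α :- α) :* c :+ (α :* α) :* con 1ℚ)) ≃-refl
      where open ℝ-solver
    lemma₂ : ∀ h α n → 1ℝ * h + 1ℝ * ((- α - α) * (n * α) + (α * α) * (n * 1ℝ)) ≃ h - n * (α * α)
    lemma₂ = solve 3 (λ h α n →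
      con 1ℚ :* h :+ con 1ℚ :* ((:- α :- α) :* (n :* α) :+ (α :* α) :* (n :* con 1ℚ))
      := h :- n :* (α :* α)) ≃-refl
      where open ℝ-solver

  X : Matrix n
  X = B ⊗ M

  c : ℝ
  c = (α * r) * (α * r)

  c≃α²γ : c ≃ α * α * γ
  c≃α²γ = ≃-trans (lemma α r) (*-congˡ _ r²≃γ)
    where
    lemma : ∀ α r → (α * r) * (α * r) ≃ α * α * (r * r)
    lemma = solve 2 (λ α r → (α :* r) :* (α :* r) := α :* α :* (r :* r)) ≃-refl
      where open ℝ-solver

  0<c : 0ℝ < c
  0<c = <-respʳ (≃-sym c≃α²γ) (0<x*y 0<α² 0<γ)

  -- As `B` is symmetric with `B² = α² I - δ J`, this is the trace of `(α² I - δ J) M Mᵀ`, and the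
  -- entries of `M Mᵀ` add up to `dot C C`.
  trace-Gram-X : sum (λ i → Gram X i i) ≃ α * α * (fromℕ n * β) - δ′ * dot C C
  trace-Gram-X = begin
    sum (λ i → dot (X i) (X i))
      ≈⟨ sum-cong (λ i → sum-cong λ j → *-cong (row i j) (row i j)) ⟩
    sum (λ i → dot (Y i) (Y i))
      ≈⟨ sum-cong expandY ⟩
    sum (λ i → α * α * dot (M i) (M i) + 1ℝ * ((- (α * b) - α * b) * dot (M i) C + (b * b * dot C C) * 1ℝ))
      ≈⟨ sum-linear (α * α) 1ℝ (λ i → dot (M i) (M i))
           (λ i → (- (α * b) - α * b) * dot (M i) C + (b * b * dot C C) * 1ℝ) ⟩
    α * α * sum (λ i → dot (M i) (M i)) +
      1ℝ * sum (λ i → (- (α * b) - α * b) * dot (M i) C + (b * b * dot C C) * 1ℝ)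
      ≈⟨ +-cong (*-congˡ _ (≃-trans (≃-sym (q≃trace M)) (proj₂ (proj₁ maximal))))
           (*-congˡ 1ℝ (sum-linear (- (α * b) - α * b) (b * b * dot C C) (λ i → dot (M i) C) (λ _ → 1ℝ))) ⟩
    α * α * (fromℕ n * β) +
      1ℝ * ((- (α * b) - α * b) * sum (λ i → dot (M i) C) + (b * b * dot C C) * sum {n} (λ _ → 1ℝ))
      ≈⟨ +-congˡ _ (*-congˡ 1ℝ (+-cong (*-congˡ _ ∑dot≃dotC) (*-congˡ _ (sum-const n 1ℝ)))) ⟩
    α * α * (fromℕ n * β) +
      1ℝ * ((- (α * b) - α * b) * dot C C + (b * b * dot C C) * (fromℕ n * 1ℝ))
      ≈⟨ lemma₁ (α * α * (fromℕ n * β)) α b (fromℕ n) (dot C C) ⟩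
    α * α * (fromℕ n * β) - b * (α + α - fromℕ n * b) * dot C C
      ≈⟨ +-congˡ _ (-‿cong (*-cong (≃-trans
           (*-congˡ b (≃-trans (+-congˡ _ (-‿cong nb≃α-r)) (lemma₂ α r))) b[r+α]≃δ) ≃-refl)) ⟩
    α * α * (fromℕ n * β) - δ′ * dot C C ∎
    where
    Y : Fin n → Vector ℝ n
    Y i j = α * M i j + (- b) * C j
    row : ∀ i j → X i j ≃ Y i j
    row i j = row-aI+bJ α (- b) i (λ k → M k j)
    expandY : ∀ i → dot (Y i) (Y i) ≃
      α * α * dot (M i) (M i) + 1ℝ * ((- (α * b) - α * b) * dot (M i) C + (b * b * dot C C) * 1ℝ)
    expandY i = begin
      dot (Y i) (Y i)
        ≈⟨ dot-linear α (- b) (M i) C (Y i) ⟩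
      α * dot (M i) (Y i) + (- b) * dot C (Y i)
        ≈⟨ +-cong (*-congˡ α (expandʳ (M i))) (*-congˡ (- b) (expandʳ C)) ⟩
      α * (α * dot (M i) (M i) + (- b) * dot C (M i)) + (- b) * (α * dot (M i) C + (- b) * dot C C)
        ≈⟨ +-cong (*-congˡ α (+-congˡ _ (*-congˡ (- b) (dot-comm C (M i))))) ≃-refl ⟩
      α * (α * dot (M i) (M i) + (- b) * dot (M i) C) + (- b) * (α * dot (M i) C + (- b) * dot C C)
        ≈⟨ lemma α b (dot (M i) (M i)) (dot (M i) C) (dot C C) ⟩
      α * α * dot (M i) (M i) + 1ℝ * ((- (α * b) - α * b) * dot (M i) C + (b * b * dot C C) * 1ℝ) ∎
      where
      expandʳ : ∀ z → dot z (Y i) ≃ α * dot (M i) z + (- b) * dot C z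
      expandʳ z = ≃-trans (dot-comm z (Y i)) (dot-linear α (- b) (M i) C z)
      lemma : ∀ α b p q h → α * (α * p + (- b) * q) + (- b) * (α * q + (- b) * h) ≃
        α * α * p + 1ℝ * ((- (α * b) - α * b) * q + (b * b * h) * 1ℝ)
      lemma = solve 5 (λ α b p q h →
        α :* (α :* p :+ (:- b) :* q) :+ (:- b) :* (α :* q :+ (:- b) :* h) :=
        α :* α :* p :+ con 1ℚ :* ((:- (α :* b) :- α :* b) :* q :+ (b :* b :* h) :* con 1ℚ)) ≃-refl
        where open ℝ-solver
    lemma₁ : ∀ t α b n h → t + 1ℝ * ((- (α * b) - α * b) * h + (b * b * h) * (n * 1ℝ)) ≃
      t - b * (α + α - n * b) * h
    lemma₁ = solve 5 (λ t α b n h →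
      t :+ con 1ℚ :* ((:- (α :* b) :- α :* b) :* h :+ (b :* b :* h) :* (n :* con 1ℚ)) :=
      t :- b :* (α :+ α :- n :* b) :* h) ≃-refl
      where open ℝ-solver
    lemma₂ : ∀ α r → α + α - (α - r) ≃ r + α
    lemma₂ = solve 2 (λ α r → α :+ α :- (α :- r) := r :+ α) ≃-refl
      where open ℝ-solver

  trace≤ : sum (λ i → Gram X i i) ≤ fromℕ n * c
  trace≤ = 0≤⇒≤
    (begin
      δ′ * sum (λ j → (C j - α) * (C j - α))
        ≈⟨ *-congˡ δ′ variance ⟩
      δ′ * (dot C C - fromℕ n * (α * α))
        ≈⟨ lemma δ′ (dot C C) (fromℕ n) (α * α) β ⟩
      fromℕ n * (α * α * γ) - (α * α * (fromℕ n * β) - δ′ * dot C C)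
        ≈⟨ +-cong (*-congˡ _ c≃α²γ) (-‿cong trace-Gram-X) ⟨
      fromℕ n * c - sum (λ i → Gram X i i) ∎)
    (0≤x*y 0≤δ (0≤sum _ λ j → 0≤x*x (C j - α)))
    where
    lemma : ∀ d h n a β → d * (h - n * a) ≃ n * (a * (β - d)) - (a * (n * β) - d * h)
    lemma = solve 5 (λ d h n a β →
      d :* (h :- n :* a) := n :* (a :* (β :- d)) :- (a :* (n :* β) :- d :* h)) ≃-refl
      where open ℝ-solver

  ≤det : c ^ n ≤ det (Gram X)
  ≤det = ≤-respˡ
    (begin
      (det B * det B) * (det N * det N)
        ≈⟨ lemma (det B) (det N) ⟩
      (det B * det N) * (det B * det N)
        ≈⟨ *-cong det-B*det-N det-B*det-N ⟩
      (α * r) ^ n * (α * r) ^ n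
        ≈⟨ ^-distrib-* n (α * r) (α * r) ⟨
      c ^ n ∎)
    (≤-respʳ
      (begin
        (det B * det B) * (det M * det M)
          ≈⟨ lemma (det B) (det M) ⟩
        (det B * det M) * (det B * det M)
          ≈⟨ *-cong (det-⊗ B M) (det-⊗ B M) ⟨
        det X * det X
          ≈⟨ det-Gram X ⟨
        det (Gram X) ∎)
      (*-monoˡ-≤ (0≤x*x (det B)) (det²≤det² N N∈𝕄)))
    where
    lemma : ∀ a b → (a * a) * (b * b) ≃ (a * b) * (a * b)
    lemma = solve 2 (λ a b → (a :* a) :* (b :* b) := (a :* b) :* (a :* b)) ≃-refl
      where open ℝ-solver
    det-B*det-N : det B * det N ≃ (α * r) ^ n
    det-B*det-N = ≃-trans (≃-sym (det-⊗ B N)) (≃-trans (det-cong B⊗N) (det-scaledI n (α * r)))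

  Gram-X : Gram X ≋ c · I n
  Gram-X = hadamard-equality n X c (<⇒≤ 0<c) trace≤ ≤det

  -- Undoes the multiplication by `B`, since `N` inverts it up to the factor `α r`.
  N⊗X : N ⊗ X ≋ (α * r) · M
  N⊗X i j = begin
    (N ⊗ (B ⊗ M)) i j              ≈⟨ ⊗-assoc N B M i j ⟨
    ((N ⊗ B) ⊗ M) i j              ≈⟨ ⊗-cong {C = M} N⊗B (λ _ _ → ≃-refl) i j ⟩
    (((α * r) · I n) ⊗ M) i j      ≈⟨ scaledI-⊗ (α * r) M i j ⟩
    α * r * M i j                  ∎

  -- The sign of `α r` is unknown, but its square `c` is positive, so cancellation waits until Gram
  -- matrices are formed: both sides are the Gram matrix of `N ⊗ X`.
  Gram-M≋Gram-N : Gram M ≋ Gram N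
  Gram-M≋Gram-N i j = *-cancelˡ-≃ 0<c (begin
    c * Gram M i j
      ≈⟨ *-distribˡ-sum c (λ k → M i k * M j k) ⟩
    sum (λ k → c * (M i k * M j k))
      ≈⟨ sum-cong (λ k → lemma (α * r) (M i k) (M j k)) ⟩
    sum (λ k → (α * r * M i k) * (α * r * M j k))
      ≈⟨ sum-cong (λ k → *-cong (N⊗X i k) (N⊗X j k)) ⟨
    Gram (N ⊗ X) i j
      ≈⟨ Gram-⊗ N X Gram-X i j ⟩
    c * Gram N i j ∎)
    where
    lemma : ∀ a u v → (a * a) * (u * v) ≃ (a * u) * (a * v)
    lemma = solve 3 (λ a u v → (a :* a) :* (u :* v) := (a :* u) :* (a :* v)) ≃-refl
      where open ℝ-solver

  Gram-M : Gram M ≋ γ · I n ⊕ δ′ · J n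
  Gram-M = ≋-trans Gram-M≋Gram-N Gram-N

  dot-C : ∀ i → dot (M i) C ≃ α * α
  dot-C i = begin
    dot (M i) C                            ≈⟨ rowSum-Gram i ⟨
    rowSum (Gram M) i                      ≈⟨ sum-cong (Gram-M i) ⟩
    rowSum (γ · I n ⊕ δ′ · J n) i          ≈⟨ rowSum-aI+bJ γ δ′ i ⟩
    γ + fromℕ n * δ′                       ≈⟨ γ+nδ≃α² ⟩
    α * α                                  ∎

  -- The entries of `M Mᵀ` add up to `n α²`, so the variance of the column sums is zero. Equality in
  -- `trace≤` would not be enough, because `δ` vanishes when `α² = β`.
  colSums : ∀ j → colSum M j ≃ α
  colSums j = begin
    C j            ≈⟨ lemma (C j) α ⟩
    C j - α + α    ≈⟨ +-cong (x*x≤0⇒x≃0 (≤-reflexive (sum≤0⇒≃0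
                        (λ j → (C j - α) * (C j - α)) (λ j → 0≤x*x (C j - α))
                        (≤-reflexive variance≃0) j))) ≃-refl ⟩
    0ℝ + α         ≈⟨ +-identityˡ α ⟩
    α              ∎
    where
    lemma : ∀ c α → c ≃ c - α + α
    lemma = solve 2 (λ c α → c := c :- α :+ α) ≃-refl
      where open ℝ-solver
    variance≃0 : sum (λ j → (C j - α) * (C j - α)) ≃ 0ℝ
    variance≃0 = begin
      sum (λ j → (C j - α) * (C j - α))  ≈⟨ variance ⟩
      dot C C - fromℕ n * (α * α)
        ≈⟨ +-cong (≃-trans (≃-sym ∑dot≃dotC) (≃-trans (sum-cong dot-C) (sum-const n (α * α)))) ≃-refl ⟩
      fromℕ n * (α * α) - fromℕ n * (α * α)
        ≈⟨ +-inverseʳ _ ⟩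
      0ℝ ∎

  -- With constant column sums, `dot-C` reads `α` times the row sum equals `α²`. A further factor
  -- `α` replaces cancellation of `α`, whose sign is unknown, by that of `α²`.
  rowSums : ∀ i → rowSum M i ≃ α
  rowSums i = *-cancelˡ-≃ 0<α² (begin
    α * α * rowSum M i                ≈⟨ *-assoc α α _ ⟩
    α * (α * rowSum M i)              ≈⟨ *-congˡ α (*-distribˡ-sum α (M i)) ⟩
    α * sum (λ j → α * M i j)
      ≈⟨ *-congˡ α (sum-cong λ j → ≃-trans (*-comm α (M i j)) (*-congˡ (M i j) (≃-sym (colSums j)))) ⟩
    α * dot (M i) C                   ≈⟨ *-congˡ α (dot-C i) ⟩
    α * (α * α)                       ≈⟨ *-assoc α α α ⟨
    α * α * α                         ∎)

  -- `det N = α r^(n-1)` may be negative. Only its square is compared with that of `det M`, and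
  -- `0≤det` selects the absolute value.
  det-M : Σ[ p ∈ ℝ ] IsHalfPower γ (suc m) p × det M ≃ ∣ α ∣ * p
  det-M = p , (r , 0≤r , ≃-trans (x^2≃x*x r) r²≃γ , ≃-refl) ,
    x*x≃y*y⇒x≃y 0≤det (0≤x*y (0≤∣x∣ α) (0≤^ (suc m) 0≤r)) (begin
      det M * det M              ≈⟨ det-Gram M ⟨
      det (Gram M)               ≈⟨ det-cong Gram-M≋Gram-N ⟩
      det (Gram N)               ≈⟨ det-Gram N ⟩
      det N * det N              ≈⟨ *-cong det-N det-N ⟩
      (α * p) * (α * p)          ≈⟨ lemma₁ α p ⟩
      (α * α) * (p * p)          ≈⟨ *-cong (∣x∣*∣x∣≃x*x α) ≃-refl ⟨
      (∣ α ∣ * ∣ α ∣) * (p * p)  ≈⟨ lemma₁ ∣ α ∣ p ⟨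
      (∣ α ∣ * p) * (∣ α ∣ * p)  ∎)
    where
    p : ℝ
    p = r ^ suc m
    lemma₁ : ∀ a b → (a * b) * (a * b) ≃ (a * a) * (b * b)
    lemma₁ = solve 2 (λ a b → (a :* b) :* (a :* b) := (a :* a) :* (b :* b)) ≃-refl
      where open ℝ-solver
    lemma₂ : ∀ r α → r + (α - r) ≃ α
    lemma₂ = solve 2 (λ r α → r :+ (α :- r) := α) ≃-refl
      where open ℝ-solver
    det-N : det N ≃ α * p
    det-N = ≃-trans (det-aI+bJ (suc m) r b)
      (*-cong (≃-trans (+-congˡ r nb≃α-r) (lemma₂ r α)) ≃-refl)

mainTheorem4 : (n : ℕ) .{{_ : NonTrivial n}} (α β : ℝ) →
    0ℝ < β → α ^ 2 < fromℕ n * β →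
    (M : Matrix n) → HasMaximalDet n α β M →
    (α ^ 2 ≤ β →
    M ⊗ M ᵀ ≋ β · I n ×
    IsHalfPower β n (det M)) ×
    (β ≤ α ^ 2 →
    (∀ i → rowSum M i ≃ α) ×
    (∀ j → colSum M j ≃ α) ×
    M ⊗ M ᵀ ≋ (β - δ n α β) · I n ⊕ δ n α β · J n ×
    β - δ n α β ≃ (fromℕ n * β - α ^ 2) /[ n -1] ×
    (Σ[ p ∈ ℝ ] IsHalfPower (β - δ n α β) (pred n) p × det M ≃ ∣ α ∣ * p))
mainTheorem4 (suc (suc m)) α β 0<β α²<nβ M maximal =
  (λ α²≤β → let open SmallSum 0<β M maximal α²≤β in Gram-M , det-M) ,
  (λ β≤α² → let open LargeSum 0<β α²<nβ M maximal β≤α² in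
    rowSums , colSums , Gram-M , γ≃ , det-M)
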